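{- Let $k\geq 0$ be an integer. Then the graph classes $\mathcal{C}_k$ and $\mathcal{H}_k$ coincide.
   Context: Graphs are finite, undirected, without loops or multiple edges; $\chi$ is the chromatic number. A graph $G$ is critical if every proper subgraph $H$ of $G$ satisfies $\chi(H)<\chi(G)$. For distinct vertices $v,w$, $\lambda_G(v,w)$ is the maximum number of pairwise edge-disjoint $v$-$w$ paths in $G$; $\lambda(G)=\max\{\lambda_G(v,w): v\neq w\}$ if $|V(G)|\geq 2$, and $\lambda(G)=0$ if $|V(G)|=1$. $\mathcal{C}_k$ is the class of critical graphs $H$ with $\chi(H)=k+1$ and $\lambda(H)\leq k$. Hajós join: for vertex-disjoint graphs $G_1,G_2$ and edges $e_i=v_iw_i\in E(G_i)$, the Hajós join $G_1\triangle G_2$ is obtained by deleting $e_1,e_2$, identifying $v_1$ with $v_2$, and adding the edge $w_1w_2$. $\mathcal{H}_k$: for $k\in\{0,1\}$, the complete graphs of order $k+1$; $\mathcal{H}_2$ the odd cycles; $\mathcal{H}_3$ the smallest class containing all odd wheels (an odd cycle plus a new vertex adjacent to all cycle vertices) and closed under Hajós joins; for $k\geq 4$, the smallest class containing all complete graphs of order $k+1$ and closed under Hajós joins. -}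

module Defs where

open import Data.Nat using (ℕ; zero; suc; _+_; _*_; _≤_; _<_)
open import Data.Fin using (Fin; toℕ; fromℕ; inject₁)
open import Data.Bool using (Bool; true; false)
open import Data.Product using (Σ; ∃; ∃-syntax; _×_; _,_)
open import Data.Sum using (_⊎_)
open import Data.Empty using (⊥)
open import Data.Unit using (⊤)
open import Relation.Nullary using (¬_)
open import Relation.Binary.PropositionalEquality using (_≡_; _≢_)
open import Function.Bundles using (_⇔_)

record Graph : Set where
  field
    n      : ℕ
    adj    : Fin n → Fin n → Bool
    sym    : ∀ u v → adj u v ≡ adj v u
    irrefl : ∀ u → adj u u ≡ false

open Graph public

E : (G : Graph) → Fin (n G) → Fin (n G) → Set
E G u v = adj G u v ≡ true

Colorable : Graph → ℕ → Set
Colorable G c = Σ (Fin (n G) → Fin c) λ f → ∀ u v → E G u v → f u ≢ f v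

IsChromaticNumber : Graph → ℕ → Set
IsChromaticNumber G m = Colorable G m × (∀ c → Colorable G c → m ≤ c)

record SubgraphOf (H G : Graph) : Set where
  field
    φ     : Fin (n H) → Fin (n G)
    inj   : ∀ a b → φ a ≡ φ b → a ≡ b
    edges : ∀ a b → E H a b → E G (φ a) (φ b)

record ProperSubgraphOf (H G : Graph) : Set where
  field
    sub    : SubgraphOf H G
    proper : ¬ ((∀ z → ∃[ a ] SubgraphOf.φ sub a ≡ z)
                × (∀ a b → E G (SubgraphOf.φ sub a) (SubgraphOf.φ sub b) → E H a b))

Critical : Graph → Set
Critical G = ∀ (H : Graph) → ProperSubgraphOf H G →
             ∀ a b → IsChromaticNumber H a → IsChromaticNumber G b → a < b

record Path (G : Graph) (v w : Fin (n G)) : Set where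
  field
    len   : ℕ
    vs    : Fin (suc len) → Fin (n G)
    start : vs Data.Fin.zero ≡ v
    end   : vs (fromℕ len) ≡ w
    inj   : ∀ i j → vs i ≡ vs j → i ≡ j
    steps : ∀ (i : Fin len) → E G (vs (inject₁ i)) (vs (Data.Fin.suc i))

PathEdge : ∀ {G v w} → (P : Path G v w) → Fin (Path.len P) → Fin (n G) → Fin (n G) → Set
PathEdge P i a b =
  (Path.vs P (inject₁ i) ≡ a × Path.vs P (Data.Fin.suc i) ≡ b)
  ⊎ (Path.vs P (inject₁ i) ≡ b × Path.vs P (Data.Fin.suc i) ≡ a)

EdgeDisjoint : ∀ {G v w} → Path G v w → Path G v w → Set
EdgeDisjoint {G} P Q = ∀ i j (a b : Fin (n G)) → PathEdge P i a b → ¬ PathEdge Q j a b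

EdgeDisjointPaths : (G : Graph) → Fin (n G) → Fin (n G) → ℕ → Set
EdgeDisjointPaths G v w p =
  Σ (Fin p → Path G v w) λ P → ∀ i j → i ≢ j → EdgeDisjoint (P i) (P j)

-- λ(G) ≤ k : for all distinct v,w, λ_G(v,w) ≤ k, i.e. there are no
-- k+1 pairwise edge-disjoint v-w paths.  (If |V(G)| ≤ 1 this holds
-- vacuously, matching λ(G) = 0.)
LambdaAtMost : Graph → ℕ → Set
LambdaAtMost G k = ∀ v w → v ≢ w → ¬ EdgeDisjointPaths G v w (suc k)

𝒞 : ℕ → Graph → Set
𝒞 k G = Critical G × IsChromaticNumber G (suc k) × LambdaAtMost G k

record IsoTo (G : Graph) (N : ℕ) (R : Fin N → Fin N → Set) : Set where
  field
    to      : Fin (n G) → Fin N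
    from    : Fin N → Fin (n G)
    from-to : ∀ u → from (to u) ≡ u
    to-from : ∀ x → to (from x) ≡ x
    adj-iff : ∀ u v → E G u v ⇔ R (to u) (to v)

KAdj : ∀ {N} → Fin N → Fin N → Set
KAdj a b = a ≢ b

CycSucc : ∀ N → Fin N → Fin N → Set
CycSucc N a b = (suc (toℕ a) ≡ toℕ b) ⊎ (suc (toℕ a) ≡ N × toℕ b ≡ 0)

CycAdj : ∀ N → Fin N → Fin N → Set
CycAdj N a b = CycSucc N a b ⊎ CycSucc N b a

WheelAdj : ∀ N → Fin (suc N) → Fin (suc N) → Set
WheelAdj N Data.Fin.zero Data.Fin.zero = ⊥
WheelAdj N Data.Fin.zero (Data.Fin.suc b) = ⊤
WheelAdj N (Data.Fin.suc a) Data.Fin.zero = ⊤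
WheelAdj N (Data.Fin.suc a) (Data.Fin.suc b) = CycAdj N a b

IsComplete : ℕ → Graph → Set
IsComplete N G = IsoTo G N KAdj

IsOddCycle : Graph → Set
IsOddCycle G = ∃[ m ] IsoTo G (suc (suc (suc (2 * m)))) (CycAdj (suc (suc (suc (2 * m)))))

IsOddWheel : Graph → Set
IsOddWheel G = ∃[ m ] IsoTo G (suc (suc (suc (suc (2 * m))))) (WheelAdj (suc (suc (suc (2 * m)))))

-- Hajós join (up to isomorphism): H is G₁ △ G₂ for edges v₁w₁, v₂w₂.
-- ι₁, ι₂ embed the vertex sets of G₁, G₂ into H, identifying exactly
-- v₁ with v₂ and covering V(H); the edges of H are the edges of G₁
-- other than v₁w₁, the edges of G₂ other than v₂w₂, and w₁w₂.

SameEdge : ∀ {m} → Fin m → Fin m → Fin m → Fin m → Set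
SameEdge x y v w = (x ≡ v × y ≡ w) ⊎ (x ≡ w × y ≡ v)

EdgeVia : (G H : Graph) → (Fin (n G) → Fin (n H)) → Fin (n G) → Fin (n G) →
          Fin (n H) → Fin (n H) → Set
EdgeVia G H ι v w a b =
  ∃[ x ] ∃[ y ] (ι x ≡ a × ι y ≡ b × E G x y × ¬ SameEdge x y v w)

record HajosJoin (G₁ G₂ H : Graph) : Set where
  field
    v₁ w₁ : Fin (n G₁)
    e₁    : E G₁ v₁ w₁
    v₂ w₂ : Fin (n G₂)
    e₂    : E G₂ v₂ w₂
    ι₁    : Fin (n G₁) → Fin (n H)
    ι₂    : Fin (n G₂) → Fin (n H)
    inj₁  : ∀ x y → ι₁ x ≡ ι₁ y → x ≡ y
    inj₂  : ∀ x y → ι₂ x ≡ ι₂ y → x ≡ y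
    glue  : ι₁ v₁ ≡ ι₂ v₂
    meet : ∀ x y → ι₁ x ≡ ι₂ y → (x ≡ v₁ × y ≡ v₂)
    cover : ∀ z → (∃[ x ] ι₁ x ≡ z) ⊎ (∃[ y ] ι₂ y ≡ z)
    adj-iff : ∀ a b → E H a b ⇔
      (EdgeVia G₁ H ι₁ v₁ w₁ a b ⊎ EdgeVia G₂ H ι₂ v₂ w₂ a b
       ⊎ SameEdge a b (ι₁ w₁) (ι₂ w₂))

data HajosClosure (B : Graph → Set) : Graph → Set where
  base  : ∀ {G} → B G → HajosClosure B G
  join  : ∀ {G₁ G₂ H} → HajosClosure B G₁ → HajosClosure B G₂ →
          HajosJoin G₁ G₂ H → HajosClosure B H

ℋ : ℕ → Graph → Set
ℋ 0 G = IsComplete 1 G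
ℋ 1 G = IsComplete 2 G
ℋ 2 G = IsOddCycle G
ℋ 3 G = HajosClosure IsOddWheel G
ℋ (suc (suc (suc (suc j)))) G = HajosClosure (IsComplete (suc (suc (suc (suc (suc j)))))) G

{-# OPTIONS --safe #-}
module Submission where

-- For k ≥ 3 let G ∈ 𝒞 k.  By Menger's theorem any two vertices are separated by at
-- most k edges, and recolouring shows that every edge cut has at least k edges; when
-- it has exactly k, the ends on one side have one colour in every k-colouring of that
-- side and the ends on the other side have k different colours.
--
-- Say that G has a bridge separation if deleting some vertex z leaves a connected
-- graph with a bridge; then G is the Hajós join at z of two smaller members of 𝒞 k.
-- It remains to show that a G without one is a cone over a Hamiltonian cycle.
-- If two vertices have degree > k, take a k-edge cut between them and replace its
-- many-coloured side by a clique on the ends of the cut: this is a smaller member of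
-- 𝒞 k, and a bridge separation of it is one of G.
-- If all vertices but h have degree k, close a maximal path of G − h to a cycle C
-- through all neighbours of its end.  Colouring greedily round C shows that all
-- neighbours of C outside C get the colour of h, in every colouring of G − C, and moving
-- an uncoloured vertex along a path shows that a component of G − C − h sends only
-- one edge to C.  So C spans G − h unless there is a bridge separation.
--
-- A cone over a cycle of vertices of degree 3 is a wheel.  For k ≥ 4, Brooks'
-- colouring makes the two neighbours of a vertex on C adjacent, so that exchanging
-- consecutive vertices again gives a Hamiltonian cycle; hence G is complete.

open import Defs hiding (sym)
open import Data.Bool using (Bool; true; false; not; _∧_; _∨_; if_then_else_)
import Data.Bool.Properties as Bool
open import Data.Nat using (ℕ; zero; suc; _+_; _*_; _≤_; _<_; z≤n; s≤s; s≤s⁻¹; z<s)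
import Data.Nat.Properties as ℕ
open import Data.Nat.Induction using (<-wellFounded)
open import Induction.WellFounded using (Acc; acc)
open import Data.Fin using (Fin; zero; suc; toℕ; fromℕ; inject₁; inject≤; fromℕ<; cast; punchIn; punchOut; _≟_)
import Data.Fin.Properties as Fin
open import Data.Fin.Permutation.Components using (transpose; transpose-inverse)
open import Data.List using (List; []; _∷_; _++_; [_]; length; map; filter; lookup; allFin; cartesianProduct; initLast; _∷ʳ′_)
import Data.List.Properties as List
open import Data.List.Membership.Propositional using (_∈_; _∉_)
import Data.List.Membership.Propositional.Properties as Mem
open import Data.List.Relation.Unary.Any using (Any; here; there; index)
import Data.List.Relation.Unary.Any as Any
import Data.List.Relation.Unary.Any.Properties as Any
open import Data.List.Relation.Unary.All using (All; []; _∷_)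
import Data.List.Relation.Unary.All as All
import Data.List.Relation.Unary.All.Properties as All
open import Data.List.Relation.Unary.AllPairs using ([]; _∷_)
open import Data.List.Relation.Unary.Unique.Propositional using (Unique)
import Data.List.Relation.Unary.Unique.Propositional.Properties as Unique
open import Data.Product using (Σ; ∃; ∃-syntax; _×_; _,_; proj₁; proj₂; map₂; swap; uncurry)
import Data.Product.Properties as Product
open import Data.Sum using (_⊎_; inj₁; inj₂; [_,_]′)
import Data.Sum as Sum
open import Data.Empty using (⊥; ⊥-elim)
open import Data.Unit using (⊤; tt)
open import Function using (_∘_; id; case_of_)
open import Function.Bundles using (_⇔_; mk⇔; Equivalence)
open import Relation.Nullary using (¬_; Dec; yes; no; does; contradiction)
open import Relation.Nullary.Decidable using (¬?; _×-dec_; _⊎-dec_; _→-dec_; map′; dec-true; dec-false; decidable-stable)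
open import Relation.Binary.PropositionalEquality using (_≡_; _≢_; refl; sym; trans; cong; cong₂; subst; subst₂; _≗_; module ≡-Reasoning)
open import Data.List.Membership.DecPropositional using () renaming (_∈?_ to mem?)
open import Data.Nat.Solver using (module +-*-Solver)
open import Data.List.Relation.Unary.Linked using (Linked; []; [-]; _∷_)
import Data.List.Relation.Unary.Linked as Linked
open import Data.List.Relation.Binary.Permutation.Propositional using (_↭_; ↭-refl; ↭-sym; ↭-trans; prep)
import Data.List.Relation.Binary.Permutation.Propositional.Properties as Perm

-- Families of disjoint paths occur only in the translation of `LambdaAtMost`; afterwards
-- connectivity means cuts. When a graph is changed, a cut survives by exchanging one edge for
-- another, whereas paths would have to be rerouted. The recolouring arguments share one pattern: an
-- exceptional colouring of one side of a separation could be matched, after a permutation of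
-- colours, with a colouring of the other side, and `G` would be `k`-colourable. At a bridge
-- separation the permutation changes the colour of one vertex and fixes that of another, which
-- takes a third colour. The cases `k ≤ 2` are settled directly. Greedy colouring needs an
-- uncoloured neighbour at every vertex of degree `k` and fails at a vertex of larger degree. One
-- such vertex can be coloured at the outset and play the apex; a second one cannot, hence the
-- induction through a cut between two of them. The clique put in place of one side forces different
-- colours on the ends of the cut just as that side did, and its vertices have degree at most `k`,
-- so it brings in no high vertex.

V : Graph → Set
V G = Fin (n G)

adj? : ∀ G (a b : V G) → Dec (E G a b)
adj? G a b = adj G a b Bool.≟ true

E-sym : ∀ G {a b} → E G a b → E G b a
E-sym G {a} {b} e = trans (Graph.sym G b a) e

E⇒≢ : ∀ G {a b} → E G a b → a ≢ b
E⇒≢ G {a} e refl = case trans (sym e) (irrefl G a) of λ ()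

dec-does : ∀ {A : Set} (A? : Dec A) → does A? ≡ true → A
dec-does (yes a) _ = a

dec-does-not : ∀ {A : Set} (A? : Dec A) → does A? ≡ false → ¬ A
dec-does-not (no ¬a) _ = ¬a

true-or-false : ∀ (b : Bool) → (b ≡ true) ⊎ (b ≡ false)
true-or-false true  = inj₁ refl
true-or-false false = inj₂ refl

true≢false : ∀ {A : Set} {b : Bool} → b ≡ true → b ≡ false → A
true≢false refl ()

-- Counting in lists, fresh colours and degrees

injection⇒≤length : ∀ {A : Set} {m} (p : Fin m → A) (L : List A) →
                    (∀ i j → p i ≡ p j → i ≡ j) → (∀ i → p i ∈ L) → m ≤ length L
injection⇒≤length p L inj mem = Fin.injective⇒≤ {f = λ i → index (mem i)} λ {i} {j} eq →
  inj i j (trans (Any.lookup-index (mem i))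
    (trans (cong (lookup L) eq) (sym (Any.lookup-index (mem j)))))

lookup-injective : ∀ {A : Set} {xs : List A} → Unique xs → ∀ i j → lookup xs i ≡ lookup xs j → i ≡ j
lookup-injective {xs = _ ∷ _}  _          zero    zero    _  = refl
lookup-injective {xs = _ ∷ xs} (x∉ ∷ _)   zero    (suc j) eq = contradiction eq (All.lookup x∉ (Mem.∈-lookup j))
lookup-injective {xs = _ ∷ xs} (x∉ ∷ _)   (suc i) zero    eq = contradiction (sym eq) (All.lookup x∉ (Mem.∈-lookup i))
lookup-injective {xs = _ ∷ _}  (_ ∷ uniq) (suc i) (suc j) eq = cong suc (lookup-injective uniq i j eq)

length-map≤ : ∀ {A B : Set} (f : A → B) L {k} → length L ≤ k → length (map f L) ≤ k
length-map≤ f L {k} = subst (_≤ k) (sym (List.length-map f L))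

unique⊆⇒≤length : ∀ {A : Set} {xs ys : List A} → Unique xs → (∀ {x} → x ∈ xs → x ∈ ys) → length xs ≤ length ys
unique⊆⇒≤length {xs = xs} {ys} uniq sub =
  injection⇒≤length (lookup xs) ys (lookup-injective uniq) (λ i → sub (Mem.∈-lookup i))

-- Otherwise a missed `x`, put in front, would give an injection of one more index into `L`.
injection-covers : ∀ {A : Set} {m} (_≟ᴬ_ : (a b : A) → Dec (a ≡ b)) (p : Fin m → A) (L : List A) →
                   (∀ i j → p i ≡ p j → i ≡ j) → (∀ i → p i ∈ L) → length L ≤ m →
                   ∀ {x} → x ∈ L → ∃[ i ] p i ≡ x
injection-covers {A} {m} _≟ᴬ_ p L inj mem L≤m {x} x∈L with Fin.any? (λ i → p i ≟ᴬ x)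
... | yes found = found
... | no ¬found = contradiction (injection⇒≤length p⁺ L inj⁺ mem⁺) (ℕ.<⇒≱ (s≤s L≤m))
  where
  p⁺ : Fin (suc m) → A
  p⁺ zero    = x
  p⁺ (suc i) = p i
  inj⁺ : ∀ i j → p⁺ i ≡ p⁺ j → i ≡ j
  inj⁺ zero    zero    _  = refl
  inj⁺ zero    (suc j) eq = contradiction (j , sym eq) ¬found
  inj⁺ (suc i) zero    eq = contradiction (i , eq) ¬found
  inj⁺ (suc i) (suc j) eq = cong suc (inj i j eq)
  mem⁺ : ∀ i → p⁺ i ∈ L
  mem⁺ zero    = x∈L
  mem⁺ (suc i) = mem i

injective⇒surjective : ∀ {m} (p : Fin m → Fin m) → (∀ i j → p i ≡ p j → i ≡ j) → ∀ c → ∃[ i ] p i ≡ c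
injective⇒surjective {m} p inj c =
  injection-covers _≟_ p (allFin m) inj (λ i → Mem.∈-allFin (p i))
    (ℕ.≤-reflexive (List.length-tabulate {n = m} id)) (Mem.∈-allFin c)

freshColour : ∀ {k} (cs : List (Fin k)) → length cs < k → ∃[ c ] c ∉ cs
freshColour {k} cs <k with Fin.any? (λ c → ¬? (Fin.any? {n = length cs} (λ i → lookup cs i ≟ c)))
... | yes (c , ∉cs) = c , λ c∈ → ∉cs (index c∈ , sym (Any.lookup-index c∈))
... | no ¬fresh = contradiction (injection⇒≤length id cs (λ _ _ eq → eq) all∈) (ℕ.<⇒≱ <k)
  where
  all∈ : ∀ c → c ∈ cs
  all∈ c with Fin.any? (λ i → lookup cs i ≟ c)
  ... | yes (i , eq) = subst (_∈ cs) eq (Mem.∈-lookup i)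
  ... | no ¬∈ = contradiction (c , ¬∈) ¬fresh

count : ∀ {A : Set} → (A → Bool) → List A → ℕ
count p []       = 0
count p (x ∷ xs) = (if p x then 1 else 0) + count p xs

bit-≤ : ∀ b c → (b ≡ true → c ≡ true) → (if b then 1 else 0) ≤ (if c then 1 else 0)
bit-≤ false c     _ = z≤n
bit-≤ true  true  _ = s≤s z≤n
bit-≤ true  false f = case f refl of λ ()

count-mono : ∀ {A : Set} (p q : A → Bool) xs → (∀ x → p x ≡ true → q x ≡ true) → count p xs ≤ count q xs
count-mono p q []       _   = z≤n
count-mono p q (x ∷ xs) p⇒q = ℕ.+-mono-≤ (bit-≤ (p x) (q x) (p⇒q x)) (count-mono p q xs p⇒q)

count-strict : ∀ {A : Set} (p q : A → Bool) {xs x} → x ∈ xs → (∀ x → p x ≡ true → q x ≡ true) →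
               p x ≡ false → q x ≡ true → count p xs < count q xs
count-strict p q {y ∷ xs} (here refl) p⇒q px qx rewrite px | qx = s≤s (count-mono p q xs p⇒q)
count-strict p q {y ∷ xs} (there x∈)  p⇒q px qx =
  ℕ.+-mono-≤-< (bit-≤ (p y) (q y) (p⇒q y)) (count-strict p q x∈ p⇒q px qx)

nbrs : ∀ G → V G → List (V G)
nbrs G v = filter (adj? G v) (allFin (n G))

∈-nbrs : ∀ G {v w} → E G v w → w ∈ nbrs G v
∈-nbrs G {v} {w} e = Mem.∈-filter⁺ (adj? G v) (Mem.∈-allFin w) e

nbrs-E : ∀ G {v w} → w ∈ nbrs G v → E G v w
nbrs-E G {v} w∈ = proj₂ (Mem.∈-filter⁻ (adj? G v) {xs = allFin (n G)} w∈)

deg : ∀ G → V G → ℕ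
deg G v = length (nbrs G v)

deg≤ : ∀ G v (L : List (V G)) → (∀ w → E G v w → w ∈ L) → deg G v ≤ length L
deg≤ G v L cov = unique⊆⇒≤length (Unique.filter⁺ (adj? G v) (Unique.allFin⁺ (n G))) (λ w∈ → cov _ (nbrs-E G w∈))

without : ∀ {m} → Fin m → List (Fin m) → List (Fin m)
without a = filter (λ b → ¬? (b ≟ a))

length-without : ∀ {m} {a : Fin m} {xs} → a ∈ xs → length (without a xs) < length xs
length-without {a = a} {xs} a∈ = List.filter-notAll (λ b → ¬? (b ≟ a)) xs (Any.map (λ where refl ¬a → ¬a refl) a∈)

∈-without : ∀ {m} {a b : Fin m} {xs} → b ∈ xs → b ≢ a → b ∈ without a xs
∈-without {a = a} b∈ b≢a = Mem.∈-filter⁺ (λ b → ¬? (b ≟ a)) b∈ b≢a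

-- Partial colourings

-- Partial colourings are total functions with a domain `P`. Values outside `P` are ignored, so
-- colouring or uncolouring a vertex changes only `P`.
ProperOn : ∀ G {k} → (V G → Set) → (V G → Fin k) → Set
ProperOn G P f = ∀ a b → P a → P b → E G a b → f a ≢ f b

infix 30 _[_↦_]
_[_↦_] : ∀ {m} {A : Set} → (Fin m → A) → Fin m → A → Fin m → A
(f [ v ↦ c ]) w = if does (w ≟ v) then c else f w

update-same : ∀ {m} {A : Set} (f : Fin m → A) v c → (f [ v ↦ c ]) v ≡ c
update-same f v c rewrite dec-true (v ≟ v) refl = refl

update-other : ∀ {m} {A : Set} (f : Fin m → A) {v} c {w} → w ≢ v → (f [ v ↦ c ]) w ≡ f w
update-other f {v} c {w} w≢v rewrite dec-false (w ≟ v) w≢v = refl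

paint : ∀ G {k} {P Q : V G → Set} (f : V G → Fin k) v c → ProperOn G P f →
        (∀ a → Q a → a ≢ v → P a) → (∀ b → Q b → E G v b → f b ≢ c) → ProperOn G Q (f [ v ↦ c ])
paint G f v c proper Q⊆P free a b Qa Qb e eq with a ≟ v | b ≟ v
... | yes refl | yes refl = E⇒≢ G e refl
... | yes refl | no b≢v   = free b Qb e (sym eq)
... | no a≢v   | yes refl = free a Qa (E-sym G e) eq
... | no a≢v   | no b≢v   = proper a b (Q⊆P a Qa a≢v) (Q⊆P b Qb b≢v) e eq

-- Of at most `k` neighbours one, `u`, is uncoloured afterwards, so a colour is left for `v`. `P`
-- and `Q` are the domains before and after; `Q` may omit vertices of `P`, so that `v` can be
-- coloured and `u` uncoloured in one step.
paint-gap : ∀ G {k} {P Q : V G → Set} (f : V G → Fin k) {v u} → ProperOn G P f → deg G v ≤ k →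
            (∀ a → Q a → a ≢ v → P a) → E G v u → ¬ Q u → ∃[ c ] ProperOn G Q (f [ v ↦ c ])
paint-gap G {k} f {v} {u} proper low Q⊆P vu ¬Qu
  with c , c∉ ← freshColour (map f (without u (nbrs G v)))
                  (subst (_< k) (sym (List.length-map f (without u (nbrs G v))))
                    (ℕ.<-≤-trans (length-without (∈-nbrs G vu)) low))
  = c , paint G f v c proper Q⊆P λ b Qb vb fb≡c →
      c∉ (subst (_∈ _) fb≡c (Mem.∈-map⁺ f (∈-without (∈-nbrs G vb) λ where refl → ¬Qu Qb)))

-- Two neighbours of one colour block a single colour between them.
paint-twins : ∀ G {k} {P Q : V G → Set} (f : V G → Fin k) {v x y} → ProperOn G P f → deg G v ≤ k →
              (∀ a → Q a → a ≢ v → P a) → E G v x → E G v y → x ≢ y → f x ≡ f y →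
              ∃[ c ] ProperOn G Q (f [ v ↦ c ])
paint-twins G {k} f {v} {x} {y} proper low Q⊆P vx vy x≢y fx≡fy
  with c , c∉ ← freshColour (map f (without x (nbrs G v)))
                  (subst (_< k) (sym (List.length-map f (without x (nbrs G v))))
                    (ℕ.<-≤-trans (length-without (∈-nbrs G vx)) low))
  = c , paint G f v c proper Q⊆P λ b Qb vb fb≡c → c∉ (subst (_∈ _) fb≡c (colour∈ b vb))
  where
  colour∈ : ∀ b → E G v b → f b ∈ map f (without x (nbrs G v))
  colour∈ b vb with b ≟ x
  ... | yes refl = subst (_∈ map f (without x (nbrs G v))) (sym fx≡fy) (Mem.∈-map⁺ f (∈-without (∈-nbrs G vy) (x≢y ∘ sym)))
  ... | no b≢x   = Mem.∈-map⁺ f (∈-without (∈-nbrs G vb) b≢x)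

-- Two uncoloured neighbours leave two colours free, hence one besides the forbidden `c₀`.
paint-two-gaps : ∀ G {k} {P Q : V G → Set} (f : V G → Fin k) {v u w} c₀ → ProperOn G P f → deg G v ≤ k →
                 (∀ a → Q a → a ≢ v → P a) → E G v u → E G v w → u ≢ w → ¬ Q u → ¬ Q w →
                 ∃[ c ] c ≢ c₀ × ProperOn G Q (f [ v ↦ c ])
paint-two-gaps G {k} f {v} {u} {w} c₀ proper low Q⊆P vu vw u≢w ¬Qu ¬Qw
  with c , c∉ ← freshColour (c₀ ∷ map f (without w (without u (nbrs G v))))
                  (subst (λ l → suc l < k) (sym (List.length-map f (without w (without u (nbrs G v)))))
                    (ℕ.<-≤-trans (s≤s (length-without (∈-without (∈-nbrs G vw) (u≢w ∘ sym))))
                      (ℕ.≤-trans (length-without (∈-nbrs G vu)) low)))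
  = c , (λ eq → c∉ (here eq)) , paint G f v c proper Q⊆P λ b Qb vb fb≡c →
      c∉ (there (subst (_∈ _) fb≡c (Mem.∈-map⁺ f
        (∈-without (∈-without (∈-nbrs G vb) λ where refl → ¬Qu Qb) λ where refl → ¬Qw Qb))))

transpose-injective : ∀ {k} (i j : Fin k) {a b} → transpose i j a ≡ transpose i j b → a ≡ b
transpose-injective i j {a} {b} eq =
  trans (sym (transpose-inverse j i)) (trans (cong (transpose j i) eq) (transpose-inverse j i))

transpose-fst : ∀ {k} (i j : Fin k) → transpose i j i ≡ j
transpose-fst i j rewrite dec-true (i ≟ i) refl = refl

transpose-snd : ∀ {k} (i j : Fin k) → transpose i j j ≡ i
transpose-snd i j with j ≟ i
... | yes refl = refl
... | no _ rewrite dec-true (j ≟ j) refl = refl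

transpose-other : ∀ {k} (i j : Fin k) {a} → a ≢ i → a ≢ j → transpose i j a ≡ a
transpose-other i j {a} a≢i a≢j rewrite dec-false (a ≟ i) a≢i | dec-false (a ≟ j) a≢j = refl

permute-proper : ∀ G {k} {P : V G → Set} {f : V G → Fin k} i j → ProperOn G P f → ProperOn G P (transpose i j ∘ f)
permute-proper G i j proper a b Pa Pb e eq = proper a b Pa Pb e (transpose-injective i j eq)

-- Edge cuts

Cross : ∀ G → (V G → Bool) → V G → V G → Set
Cross G X a b = X a ≡ true × X b ≡ false × E G a b

cross? : ∀ G X a b → Dec (Cross G X a b)
cross? G X a b = X a Bool.≟ true ×-dec X b Bool.≟ false ×-dec adj? G a b

CutAtMost : ∀ G → (V G → Bool) → ℕ → Set
CutAtMost G X k = Σ (List (V G × V G)) λ L → length L ≤ k × (∀ a b → Cross G X a b → (a , b) ∈ L)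

cross-not : ∀ G X {a b} → Cross G (not ∘ X) a b → Cross G X b a
cross-not G X {a} {b} (Xa , Xb , e) = Bool.not-injective Xb , Bool.not-injective Xa , E-sym G e

not-cross : ∀ G X {a b} → Cross G X a b → Cross G (not ∘ X) b a
not-cross G X (Xa , Xb , e) = cong not Xb , cong not Xa , E-sym G e

cutAtMost-not : ∀ G X {k} → CutAtMost G X k → CutAtMost G (not ∘ X) k
cutAtMost-not G X {k} (L , L≤k , cov) =
  map swap L , length-map≤ swap L L≤k ,
  λ a b c → Mem.∈-map⁺ swap (cov b a (cross-not G X c))

pairs : ∀ G → List (V G × V G)
pairs G = cartesianProduct (allFin (n G)) (allFin (n G))

∈-pairs : ∀ G a b → (a , b) ∈ pairs G
∈-pairs G a b = Mem.∈-cartesianProduct⁺ (Mem.∈-allFin a) (Mem.∈-allFin b)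

join-colourings : ∀ G {k} (X : V G → Bool) (f g : V G → Fin k) →
                  ProperOn G (λ v → X v ≡ true) f → ProperOn G (λ v → X v ≡ false) g →
                  (∀ a b → Cross G X a b → f a ≢ g b) → Colorable G k
join-colourings G X f g pf pg ok = (λ v → if X v then f v else g v) , proper
  where
  proper : ∀ a b → E G a b → (if X a then f a else g a) ≢ (if X b then f b else g b)
  proper a b e with X a in Xa | X b in Xb
  ... | true  | true  = pf a b Xa Xb e
  ... | false | false = pg a b Xa Xb e
  ... | true  | false = ok a b (Xa , Xb , e)
  ... | false | true  = ok b a (Xb , Xa , E-sym G e) ∘ sym

-- Up to a permutation σ of the colours of g, each colour j is met by a crossing
-- edge whose end colours are {c₀, j}.
record ColourStar G (X : V G → Bool) {k} (f g : V G → Fin k) : Set where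
  field
    σ       : Fin k → Fin k
    σ-inj   : ∀ {a b} → σ a ≡ σ b → a ≡ b
    c₀      : Fin k
    x y     : Fin k → V G
    cross   : ∀ j → Cross G X (x j) (y j)
    colours : ∀ j → (f (x j) ≡ c₀ × σ (g (y j)) ≡ j) ⊎ (f (x j) ≡ j × σ (g (y j)) ≡ c₀)

  -- The unordered pair of `c₀` and `j` determines `j`. So the star has `k` different crossing
  -- edges, the source of every lower bound on cuts.
  edge-inj : ∀ i j → (x i , y i) ≡ (x j , y j) → i ≡ j
  edge-inj i j eq with cong (f ∘ proj₁) eq | cong (σ ∘ g ∘ proj₂) eq | colours i | colours j
  ... | _ | p | inj₁ (_ , q) | inj₁ (_ , r) = trans (sym q) (trans p r)
  ... | p | _ | inj₂ (q , _) | inj₂ (r , _) = trans (sym q) (trans p r)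
  ... | p | q | inj₁ (r , s) | inj₂ (t , u) = trans (sym s) (trans q (trans u (trans (sym r) (trans p t))))
  ... | p | q | inj₂ (r , s) | inj₁ (t , u) = trans (sym r) (trans p (trans t (trans (sym s) (trans q u))))

-- A choice of colours minimising the number of monochromatic crossing edges is
-- not improved by exchanging the colour of such an edge with any other colour.
colourStar : ∀ G {k} (X : V G → Bool) (f g : V G → Fin k) → ¬ Colorable G k →
             ProperOn G (λ v → X v ≡ true) f → ProperOn G (λ v → X v ≡ false) g → ColourStar G X f g
colourStar G {k} X f g₀ ¬col pf pg₀ = go g₀ pg₀ (<-wellFounded _)
  where
  Conflict : (V G → Fin k) → V G → V G → Set
  Conflict g a b = Cross G X a b × f a ≡ g b

  conflict? : ∀ g a b → Dec (Conflict g a b)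
  conflict? g a b = cross? G X a b ×-dec f a ≟ g b

  conflicts : (V G → Fin k) → ℕ
  conflicts g = count (λ (a , b) → does (conflict? g a b)) (pairs G)

  Meets : (V G → Fin k) → Fin k → Fin k → Set
  Meets g c j = ∃[ a ] ∃[ b ] Cross G X a b × ((f a ≡ c × g b ≡ j) ⊎ (f a ≡ j × g b ≡ c))

  meets? : ∀ g c j → Dec (Meets g c j)
  meets? g c j = Fin.any? λ a → Fin.any? λ b →
    cross? G X a b ×-dec ((f a ≟ c ×-dec g b ≟ j) ⊎-dec (f a ≟ j ×-dec g b ≟ c))

  go : ∀ g → ProperOn G (λ v → X v ≡ false) g → Acc _<_ (conflicts g) → ColourStar G X f g
  go g pg (acc rec) with Fin.any? (λ a → Fin.any? (λ b → conflict? g a b))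
  ... | no ¬conflict = contradiction
          (join-colourings G X f g pf pg (λ a b c eq → ¬conflict (a , b , c , eq))) ¬col
  ... | yes (a , b , c , fa≡gb) with Fin.any? (λ j → ¬? (meets? g (f a) j))
  ...   | no ¬miss = record
    { σ = id ; σ-inj = id ; c₀ = f a
    ; x = λ j → proj₁ (all j) ; y = λ j → proj₁ (proj₂ (all j))
    ; cross = λ j → proj₁ (proj₂ (proj₂ (all j))) ; colours = λ j → proj₂ (proj₂ (proj₂ (all j))) }
    where
    all : ∀ j → Meets g (f a) j
    all j = decidable-stable (meets? g (f a) j) (λ ¬m → ¬miss (j , ¬m))
  ...   | yes (j , ¬meet) = record
    { σ = R.σ ∘ π ; σ-inj = λ eq → transpose-injective (f a) j (R.σ-inj eq) ; c₀ = R.c₀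
    ; x = R.x ; y = R.y ; cross = R.cross ; colours = R.colours }
    where
    π : Fin k → Fin k
    π = transpose (f a) j
    -- The exchange creates no conflict: where a colour has changed, a conflict would be a crossing
    -- edge with end colours `f a` and `j`, and there is none.
    sub : ∀ a′ b′ → Conflict (π ∘ g) a′ b′ → Conflict g a′ b′
    sub a′ b′ (c′ , eq) = cases (g b′ ≟ f a) (g b′ ≟ j)
      where
      cases : Dec (g b′ ≡ f a) → Dec (g b′ ≡ j) → Conflict g a′ b′
      cases (yes p) _ = contradiction
        (a′ , b′ , c′ , inj₂ (trans eq (trans (cong π p) (transpose-fst (f a) j)) , p)) ¬meet
      cases (no _) (yes p) = contradiction
        (a′ , b′ , c′ , inj₁ (trans eq (trans (cong π p) (transpose-snd (f a) j)) , p)) ¬meet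
      cases (no p) (no q) = c′ , trans eq (transpose-other (f a) j p q)
    gone : ¬ Conflict (π ∘ g) a b
    gone (_ , eq) = ¬meet (a , b , c , inj₁ (refl ,
      trans (sym fa≡gb) (trans eq (trans (cong π (sym fa≡gb)) (transpose-fst (f a) j)))))
    fewer : conflicts (π ∘ g) < conflicts g
    fewer = count-strict _ _ (∈-pairs G a b)
      (λ (a′ , b′) p → dec-true (conflict? g a′ b′) (sub a′ b′ (dec-does (conflict? (π ∘ g) a′ b′) p)))
      (dec-false (conflict? (π ∘ g) a b) gone) (dec-true (conflict? g a b) (c , fa≡gb))
    module R = ColourStar (go (π ∘ g) (permute-proper G (f a) j pg) (rec fewer))

-- The two shapes of the ends of a minimum cut, `f` colouring the near and `g` the far side.
-- `Rainbow` concludes equality of both ends, so distinct crossing edges have distinct far ends.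
Mono Rainbow : ∀ G {k} → (V G → Bool) → (V G → Fin k) → Set
Mono    G X f = ∀ {a b a′ b′} → Cross G X a b → Cross G X a′ b′ → f a ≡ f a′
Rainbow G X g = ∀ {a b a′ b′} → Cross G X a b → Cross G X a′ b′ → g b ≡ g b′ → a ≡ a′ × b ≡ b′

_≟²_ : ∀ {m} (p q : Fin m × Fin m) → Dec (p ≡ q)
_≟²_ = Product.≡-dec _≟_ _≟_

module StarCut G {k} {X : V G → Bool} {f g : V G → Fin k} (S : ColourStar G X f g) where
  open ColourStar S

  size≥ : ∀ {m} → CutAtMost G X m → k ≤ m
  size≥ (L , L≤m , cov) =
    ℕ.≤-trans (injection⇒≤length (λ j → x j , y j) L edge-inj (λ j → cov _ _ (cross j))) L≤m

  enumerates : CutAtMost G X k → ∀ {a b} → Cross G X a b → ∃[ j ] x j ≡ a × y j ≡ b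
  enumerates (L , L≤k , cov) {a} {b} c =
    map₂ Product.,-injective (injection-covers _≟²_ (λ j → x j , y j) L edge-inj (λ j → cov _ _ (cross j)) L≤k (cov a b c))

  -- If one crossing edge has colours (c₀ , a) and another (b , c₀), the 3-cycle
  -- b ↦ c₀ ↦ a ↦ b of the colours of g removes every conflict.
  dichotomy : ¬ Colorable G k → ProperOn G (λ v → X v ≡ true) f → ProperOn G (λ v → X v ≡ false) g →
              CutAtMost G X k → (Mono G X f × Rainbow G X g) ⊎ (Mono G (not ∘ X) g × Rainbow G (not ∘ X) f)
  dichotomy ¬col pf pg cut with Fin.any? (λ j → ¬? (f (x j) ≟ c₀ ×-dec σ (g (y j)) ≟ j))
                              | Fin.any? (λ j → ¬? (f (x j) ≟ j ×-dec σ (g (y j)) ≟ c₀))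
  ... | no ¬col′ | _ = inj₁ (mono , rainbow)
    where
    row : ∀ j → f (x j) ≡ c₀ × σ (g (y j)) ≡ j
    row j = decidable-stable (f (x j) ≟ c₀ ×-dec σ (g (y j)) ≟ j) (λ ¬r → ¬col′ (j , ¬r))
    mono : Mono G X f
    mono c c′ with enumerates cut c | enumerates cut c′
    ... | i , refl , refl | j , refl , refl = trans (proj₁ (row i)) (sym (proj₁ (row j)))
    rainbow : Rainbow G X g
    rainbow c c′ eq with enumerates cut c | enumerates cut c′
    ... | i , refl , refl | j , refl , refl =
      case trans (sym (proj₂ (row i))) (trans (cong σ eq) (proj₂ (row j))) of λ where refl → refl , refl
  ... | yes _ | no ¬row = inj₂ (mono , rainbow)
    where
    col : ∀ j → f (x j) ≡ j × σ (g (y j)) ≡ c₀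
    col j = decidable-stable (f (x j) ≟ j ×-dec σ (g (y j)) ≟ c₀) (λ ¬c → ¬row (j , ¬c))
    mono : Mono G (not ∘ X) g
    mono c c′ with enumerates cut (cross-not G X c) | enumerates cut (cross-not G X c′)
    ... | i , refl , refl | j , refl , refl = σ-inj (trans (proj₂ (col i)) (sym (proj₂ (col j))))
    rainbow : Rainbow G (not ∘ X) f
    rainbow c c′ eq with enumerates cut (cross-not G X c) | enumerates cut (cross-not G X c′)
    ... | i , refl , refl | j , refl , refl =
      case trans (sym (proj₁ (col i))) (trans eq (proj₁ (col j))) of λ where refl → refl , refl
  ... | yes (b , ¬row-b) | yes (a , ¬col-a) with colours b | colours a
  ...   | inj₁ r | _ = contradiction r ¬row-b
  ...   | inj₂ _ | inj₂ c = contradiction c ¬col-a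
  ...   | inj₂ (fb , gb) | inj₁ (fa , ga) =
    contradiction (join-colourings G X f g′ pf pg′ ok) ¬col
    where
    ρ : Fin k → Fin k
    ρ = transpose a b ∘ transpose c₀ b
    ρ-inj : ∀ {c d} → ρ c ≡ ρ d → c ≡ d
    ρ-inj = transpose-injective c₀ b ∘ transpose-injective a b
    b≢c₀ : b ≢ c₀
    b≢c₀ refl = ¬row-b (fb , gb)
    a≢c₀ : a ≢ c₀
    a≢c₀ refl = ¬col-a (fa , ga)
    a≢b : a ≢ b
    a≢b refl = a≢c₀ (trans (sym ga) gb)
    ρb : ρ b ≡ c₀
    ρb = trans (cong (transpose a b) (transpose-snd c₀ b)) (transpose-other a b (a≢c₀ ∘ sym) (b≢c₀ ∘ sym))
    ρc₀ : ρ c₀ ≡ a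
    ρc₀ = trans (cong (transpose a b) (transpose-fst c₀ b)) (transpose-snd a b)
    g′ : V G → Fin k
    g′ v = ρ (σ (g v))
    pg′ : ProperOn G (λ v → X v ≡ false) g′
    pg′ u v Xu Xv e eq = pg u v Xu Xv e (σ-inj (ρ-inj eq))
    -- A conflict on edge `j` forces `j = b` if its near end has colour `c₀`, and `j = a` if its far
    -- end has; but the edges `b` and `a` are of the opposite kinds.
    ok : ∀ u v → Cross G X u v → f u ≢ g′ v
    ok u v c eq with enumerates cut c
    ... | j , refl , refl with colours j
    ...   | inj₁ (p , q) = b≢c₀ (trans (sym fb) (subst (λ i → f (x i) ≡ c₀) j≡b p))
      where
      j≡b : j ≡ b
      j≡b = ρ-inj (trans (cong ρ (sym q)) (trans (sym eq) (trans p (sym ρb))))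
    ...   | inj₂ (p , q) = a≢c₀ (trans (sym ga) (subst (λ i → σ (g (y i)) ≡ c₀) j≡a q))
      where
      j≡a : j ≡ a
      j≡a = trans (sym p) (trans eq (trans (cong ρ q) ρc₀))

-- The class 𝒞 k, with criticality tested on single edges and local edge
-- connectivity bounded by cuts.
record Good (k : ℕ) (G : Graph) : Set where
  field
    uncolourable  : ¬ Colorable G k
    edge-critical : ∀ u v → E G u v →
                    Σ (V G → Fin k) λ f → ∀ a b → E G a b → ¬ SameEdge a b u v → f a ≢ f b
    no-isolated   : ∀ u → ∃[ v ] E G u v
    cut           : ∀ u v → u ≢ v → ∃[ X ] X u ≡ true × X v ≡ false × CutAtMost G X k

  vertex-critical : ∀ v → Σ (V G → Fin k) λ f → ProperOn G (_≢ v) f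
  vertex-critical v with no-isolated v
  ... | w , vw = map₂ (λ proper a b a≢v b≢v ab → proper a b ab
          λ where (inj₁ (a≡v , _)) → a≢v a≡v
                  (inj₂ (_ , b≡v)) → b≢v b≡v) (edge-critical v w vw)

  side-colouring : ∀ (P : V G → Set) {v} → ¬ P v → Σ (V G → Fin k) λ f → ProperOn G P f
  side-colouring P {v} ¬Pv = map₂ (λ proper a b Pa Pb → proper a b
    (λ where refl → ¬Pv Pa) (λ where refl → ¬Pv Pb)) (vertex-critical v)

  -- Each side misses a vertex and is therefore colourable; the star of two such colourings supplies
  -- `k` crossing edges.
  edge-connected : ∀ X {u v m} → X u ≡ true → X v ≡ false → CutAtMost G X m → k ≤ m
  edge-connected X {u} {v} Xu Xv =
    let f , pf = side-colouring (λ a → X a ≡ true) {v} (λ Xv′ → true≢false Xv′ Xv)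
        g , pg = side-colouring (λ a → X a ≡ false) {u} (λ Xu′ → true≢false Xu Xu′)
    in StarCut.size≥ G (colourStar G X f g uncolourable pf pg)

  degree≥ : ∀ v (L : List (V G)) → (∀ w → E G v w → w ∈ L) → k ≤ length L
  degree≥ v L cov = edge-connected X {v} {w} (dec-true (v ≟ v) refl) (dec-false (w ≟ v) (E⇒≢ G vw ∘ sym))
    ( map (v ,_) L , ℕ.≤-reflexive (List.length-map (v ,_) L)
    , λ a b (Xa , _ , ab) → case dec-does (a ≟ v) Xa of λ where refl → Mem.∈-map⁺ (v ,_) (cov b ab) )
    where
    w = proj₁ (no-isolated v)
    vw = proj₂ (no-isolated v)
    X : V G → Bool
    X a = does (a ≟ v)

-- Simple paths and reachability

-- Paths run from `v` to a fixed end `t` and grow at the front; `l` lists their vertices.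
data SPath {m} (R : Fin m → Fin m → Set) (t : Fin m) : Fin m → List (Fin m) → Set where
  stop : SPath R t t [ t ]
  step : ∀ {a b l} → R a b → SPath R t b l → a ∉ l → SPath R t a (a ∷ l)

start∈ : ∀ {m R} {t v : Fin m} {l} → SPath R t v l → v ∈ l
start∈ stop         = here refl
start∈ (step _ _ _) = here refl

SPath-map : ∀ {m} {R R′ : Fin m → Fin m → Set} {t v l} →
            (∀ {a b} → a ∈ l → b ∈ l → R a b → R′ a b) → SPath R t v l → SPath R′ t v l
SPath-map _ stop = stop
SPath-map h (step r p a∉) =
  step (h (here refl) (there (start∈ p)) r) (SPath-map (λ a∈ b∈ → h (there a∈) (there b∈)) p) a∉

-- `S` is the set of vertices from which `t` can be reached. The paths stay in `S`, so a vertex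
-- newly added to `S` can be put in front of one without repetition.
record Reach {m} (R : Fin m → Fin m → Set) (t : Fin m) : Set where
  field
    S      : Fin m → Bool
    t∈S    : S t ≡ true
    path   : ∀ {v} → S v ≡ true → ∃[ l ] SPath R t v l × All (λ x → S x ≡ true) l
    closed : ∀ {a b} → R a b → S b ≡ true → S a ≡ true

reach : ∀ {m} {R : Fin m → Fin m → Set} → (∀ a b → Dec (R a b)) → ∀ t → Reach R t
reach {m} {R} R? t = go (λ v → does (v ≟ t)) (dec-true (t ≟ t) refl)
    (λ {v} Sv → case dec-does (v ≟ t) Sv of λ where refl → [ t ] , stop , Sv ∷ []) (<-wellFounded _)
  where
  go : (S : Fin m → Bool) → S t ≡ true →
       (∀ {v} → S v ≡ true → ∃[ l ] SPath R t v l × All (λ x → S x ≡ true) l) →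
       Acc _<_ (count (not ∘ S) (allFin m)) → Reach R t
  go S t∈S path (acc rec)
    with Fin.any? (λ a → Fin.any? (λ b → S a Bool.≟ false ×-dec S b Bool.≟ true ×-dec R? a b))
  ... | no ¬exit = record { S = S ; t∈S = t∈S ; path = path ; closed = closed }
    where
    closed : ∀ {a b} → R a b → S b ≡ true → S a ≡ true
    closed {a} {b} r Sb with S a in Sa
    ... | true  = refl
    ... | false = contradiction (a , b , Sa , Sb , r) ¬exit
  ... | yes (a , b , Sa , Sb , r) = go S′ (S⊆S′ t∈S) path′ (rec fewer)
    where
    S′ : Fin m → Bool
    S′ = S [ a ↦ true ]
    S⊆S′ : ∀ {v} → S v ≡ true → S′ v ≡ true
    S⊆S′ {v} Sv with v ≟ a
    ... | yes _ = refl
    ... | no _  = Sv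
    path′ : ∀ {v} → S′ v ≡ true → ∃[ l ] SPath R t v l × All (λ x → S′ x ≡ true) l
    path′ {v} S′v with v ≟ a
    ... | no _ = map₂ (map₂ (All.map S⊆S′)) (path S′v)
    ... | yes refl with path Sb
    ...   | l , p , l⊆S = a ∷ l , step r p (λ a∈ → true≢false (All.lookup l⊆S a∈) Sa) ,
                          update-same S a true ∷ All.map S⊆S′ l⊆S
    fewer : count (not ∘ S′) (allFin m) < count (not ∘ S) (allFin m)
    fewer = count-strict _ _ (Mem.∈-allFin a)
      (λ v ¬S′v → case true-or-false (S v) of λ where
        (inj₁ Sv) → case trans (sym ¬S′v) (cong not (S⊆S′ Sv)) of λ ()
        (inj₂ Sv) → cong not Sv)
      (cong not (update-same S a true)) (cong not Sa)

-- Menger's theorem for edge-disjoint paths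

Arcs : ℕ → Set
Arcs m = List (Fin m × Fin m)

_∈ᵃ?_ : ∀ {m} (e : Fin m × Fin m) (F : Arcs m) → Dec (e ∈ F)
_∈ᵃ?_ = mem? _≟²_

-- At most one orientation of each edge occurs, so that arc-disjoint paths are edge-disjoint.
record ArcSet G (F : Arcs (n G)) : Set where
  field
    uniq : Unique F
    edge : ∀ {a b} → (a , b) ∈ F → E G a b
    anti : ∀ {a b} → (a , b) ∈ F → (b , a) ∉ F

bit : Bool → ℕ
bit b = if b then 1 else 0

-- Flow conservation in integrated form: F has, over every vertex set P, the
-- stated balance of tails and heads.
Balanced : ∀ {m} → Arcs m → (X Y : (Fin m → Bool) → ℕ) → Set
Balanced F X Y = ∀ P → count (P ∘ proj₁) F + X P ≡ count (P ∘ proj₂) F + Y P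

_∖_ : ∀ {m} → Arcs m → Fin m × Fin m → Arcs m
F ∖ e = filter (λ e′ → ¬? (e′ ≟² e)) F

∖⊆ : ∀ {m} (F : Arcs m) e {e′} → e′ ∈ F ∖ e → e′ ∈ F
∖⊆ F e e′∈ = proj₁ (Mem.∈-filter⁻ (λ e′ → ¬? (e′ ≟² e)) {xs = F} e′∈)

∉∖ : ∀ {m} (F : Arcs m) e → e ∉ F ∖ e
∉∖ F e e∈ = proj₂ (Mem.∈-filter⁻ (λ e′ → ¬? (e′ ≟² e)) {xs = F} e∈) refl

∈∖ : ∀ {m} {F : Arcs m} {e e′} → e′ ∈ F → e′ ≢ e → e′ ∈ F ∖ e
∈∖ {e = e} e′∈ ≢e = Mem.∈-filter⁺ (λ e′ → ¬? (e′ ≟² e)) e′∈ ≢e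

count-∖ : ∀ {m} (p : Fin m × Fin m → Bool) {F e} → Unique F → e ∈ F →
          count p F ≡ bit (p e) + count p (F ∖ e)
count-∖ p {e ∷ F} {.e} (e∉ ∷ _) (here refl)
  rewrite List.filter-reject (λ e′ → ¬? (e′ ≟² e)) {e} {F} (λ ¬r → ¬r refl)
        | List.filter-all (λ e′ → ¬? (e′ ≟² e)) (All.map (λ ≢e eq → ≢e (sym eq)) e∉) = refl
count-∖ p {d ∷ F} {e} (d∉ ∷ uniq) (there e∈)
  rewrite List.filter-accept (λ e′ → ¬? (e′ ≟² e)) {d} {F} (All.lookup d∉ e∈)
        | count-∖ p uniq e∈ = solve 3 (λ x y z → x :+ (y :+ z) := y :+ (x :+ z)) refl (bit (p d)) (bit (p e)) _
  where open +-*-Solver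

removeArc : ∀ G {F} e → ArcSet G F → ArcSet G (F ∖ e)
removeArc G {F} e A = record
  { uniq = Unique.filter⁺ (λ e′ → ¬? (e′ ≟² e)) uniq
  ; edge = λ ab∈ → edge (∖⊆ F e ab∈)
  ; anti = λ ab∈ ba∈ → anti (∖⊆ F e ab∈) (∖⊆ F e ba∈) }
  where open ArcSet A

Residual : ∀ G → Arcs (n G) → V G → V G → Set
Residual G F a b = (E G a b × (a , b) ∉ F × (b , a) ∉ F) ⊎ (b , a) ∈ F

residual? : ∀ G F a b → Dec (Residual G F a b)
residual? G F a b = (adj? G a b ×-dec ¬? ((a , b) ∈ᵃ? F) ×-dec ¬? ((b , a) ∈ᵃ? F)) ⊎-dec ((b , a) ∈ᵃ? F)

-- The term for `u` is a surplus in the balance. Adding the arc `(a , b)` or cancelling `(b , a)`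
-- moves it from `a` to `b`, until it arrives at `t`.
push : ∀ G {t} l {u F} {X Y : (V G → Bool) → ℕ} → SPath (Residual G F) t u l → ArcSet G F →
       Balanced F (λ P → X P + bit (P u)) Y →
       ∃[ F′ ] ArcSet G F′ × Balanced F′ (λ P → X P + bit (P t)) Y
push G (t ∷ []) stop A bal = _ , A , bal
push G (a ∷ l) {F = F} {X} {Y} (step {b = b} (inj₂ ba∈) p a∉) A bal =
  push G l {F = F ∖ (b , a)} {X = X} {Y = Y} (SPath-map keep p) (removeArc G (b , a) A) bal′
  where
  keep : ∀ {x y} → x ∈ l → y ∈ l → Residual G F x y → Residual G (F ∖ (b , a)) x y
  keep x∈ y∈ (inj₁ (e , xy∉ , yx∉)) = inj₁ (e , xy∉ ∘ ∖⊆ F _ , yx∉ ∘ ∖⊆ F _)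
  keep x∈ y∈ (inj₂ yx∈) = inj₂ (∈∖ yx∈ λ where refl → a∉ x∈)
  bal′ : Balanced (F ∖ (b , a)) (λ P → X P + bit (P b)) Y
  bal′ P = ℕ.+-cancelˡ-≡ (bit (P a)) _ _ (begin
    bit (P a) + (cs + (X P + bit (P b)))
      ≡⟨ solve 4 (λ i j x c → i :+ (c :+ (x :+ j)) := (j :+ c) :+ (x :+ i)) refl (bit (P a)) (bit (P b)) (X P) cs ⟩
    (bit (P b) + cs) + (X P + bit (P a))
      ≡⟨ cong (_+ (X P + bit (P a))) (sym (count-∖ (P ∘ proj₁) (ArcSet.uniq A) ba∈)) ⟩
    count (P ∘ proj₁) F + (X P + bit (P a))
      ≡⟨ bal P ⟩
    count (P ∘ proj₂) F + Y P
      ≡⟨ cong (_+ Y P) (count-∖ (P ∘ proj₂) (ArcSet.uniq A) ba∈) ⟩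
    (bit (P a) + ct) + Y P
      ≡⟨ ℕ.+-assoc (bit (P a)) ct (Y P) ⟩
    bit (P a) + (ct + Y P) ∎)
    where
    open ≡-Reasoning
    open +-*-Solver
    cs ct : ℕ
    cs = count (P ∘ proj₁) (F ∖ (b , a))
    ct = count (P ∘ proj₂) (F ∖ (b , a))
push G (a ∷ l) {F = F} {X} {Y} (step {b = b} (inj₁ (e , ab∉ , ba∉)) p a∉) A bal =
  push G l {F = (a , b) ∷ F} {X = X} {Y = Y} (SPath-map keep p) addArc bal′
  where
  keep : ∀ {x y} → x ∈ l → y ∈ l → Residual G F x y → Residual G ((a , b) ∷ F) x y
  keep x∈ y∈ (inj₂ yx∈) = inj₂ (there yx∈)
  keep x∈ y∈ (inj₁ (e , xy∉ , yx∉)) = inj₁ (e ,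
    (λ where (here refl) → a∉ x∈ ; (there xy∈) → xy∉ xy∈) ,
    (λ where (here refl) → a∉ y∈ ; (there yx∈) → yx∉ yx∈))
  addArc : ArcSet G ((a , b) ∷ F)
  addArc = record
    { uniq = All.tabulate (λ {d} d∈ eq → ab∉ (subst (_∈ F) (sym eq) d∈)) ∷ ArcSet.uniq A
    ; edge = (λ where (here refl) → e ; (there d∈) → ArcSet.edge A d∈)
    ; anti = λ where
        (here refl) (here eq)   → E⇒≢ G e (cong proj₂ eq)
        (here refl) (there ba∈) → ba∉ ba∈
        (there d∈)  (here refl) → ba∉ d∈
        (there d∈)  (there d∈′) → ArcSet.anti A d∈ d∈′ }
  bal′ : Balanced ((a , b) ∷ F) (λ P → X P + bit (P b)) Y
  bal′ P = begin
    (bit (P a) + cs) + (X P + bit (P b))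
      ≡⟨ solve 4 (λ i j x c → (i :+ c) :+ (x :+ j) := j :+ (c :+ (x :+ i))) refl (bit (P a)) (bit (P b)) (X P) cs ⟩
    bit (P b) + (cs + (X P + bit (P a)))
      ≡⟨ cong (bit (P b) +_) (bal P) ⟩
    bit (P b) + (count (P ∘ proj₂) F + Y P)
      ≡⟨ sym (ℕ.+-assoc (bit (P b)) _ (Y P)) ⟩
    (bit (P b) + count (P ∘ proj₂) F) + Y P ∎
    where
    open ≡-Reasoning
    open +-*-Solver
    cs : ℕ
    cs = count (P ∘ proj₁) F

-- Outflow minus inflow is `p` at `s` and `-p` at `t`; the terms stand on opposite sides so that no
-- subtraction occurs.
Flow : ∀ G → V G → V G → ℕ → Set
Flow G s t p = Σ (Arcs (n G)) λ F → ArcSet G F ×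
  Balanced F (λ P → p * bit (P t)) (λ P → p * bit (P s))

leaving? : ∀ {m} (X : Fin m → Bool) (e : Fin m × Fin m) → Dec (X (proj₁ e) ≡ true × X (proj₂ e) ≡ false)
leaving? X (a , b) = X a Bool.≟ true ×-dec X b Bool.≟ false

count-split : ∀ {m} (X : Fin m → Bool) (F : Arcs m) → (∀ {a b} → (a , b) ∈ F → X b ≡ true → X a ≡ true) →
              count (X ∘ proj₁) F ≡
              count (X ∘ proj₂) F + length (filter (leaving? X) F)
count-split X [] _ = refl
count-split X ((a , b) ∷ F) h with X a in Xa | X b in Xb | count-split X F (h ∘ there)
... | true  | true  | ih = cong suc ih
... | true  | false | ih = trans (cong suc ih) (sym (ℕ.+-suc _ _))
... | false | false | ih = ih
... | false | true  | _  = case trans (sym Xa) (h (here refl) Xb) of λ ()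

augment : ∀ G s t p → Flow G s t p →
          Flow G s t (suc p) ⊎ (∃[ X ] X s ≡ true × X t ≡ false × CutAtMost G X p)
augment G s t p (F , A , bal) with reach (residual? G F) t
... | R with Reach.S R s in Ss
...   | true with l , q , _ ← Reach.path R Ss = inj₁ (push′ (push G l {X = λ P → p * bit (P t)} {Y = λ P → p * bit (P s) + bit (P s)} q A
          λ P → trans (sym (ℕ.+-assoc (count (P ∘ proj₁) F) _ _))
                  (trans (cong (_+ bit (P s)) (bal P)) (ℕ.+-assoc (count (P ∘ proj₂) F) _ _))))
  where
  push′ : ∃[ F′ ] ArcSet G F′ × Balanced F′ (λ P → p * bit (P t) + bit (P t)) (λ P → p * bit (P s) + bit (P s)) →
          Flow G s t (suc p)
  push′ (F′ , A′ , bal′) = F′ , A′ , λ P → trans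
    (cong (count (P ∘ proj₁) F′ +_) (ℕ.+-comm (bit (P t)) _))
    (trans (bal′ P) (cong (count (P ∘ proj₂) F′ +_) (ℕ.+-comm (p * bit (P s)) _)))
...   | false = inj₂ (X , cong not Ss , cong not t∈S ,
          filter (leaving? X) F , ℕ.≤-reflexive size , covers)
  where
  open Reach R
  -- `X` consists of the vertices that cannot reach `t` in the residual graph. Every edge leaving it
  -- is an arc of the flow and no arc enters it, so the balance over `X` gives the cut exactly `p`
  -- edges.
  X : V G → Bool
  X = not ∘ S
  covers : ∀ a b → Cross G X a b → (a , b) ∈ filter (leaving? X) F
  covers a b (Xa , Xb , e) with (a , b) ∈ᵃ? F
  ... | yes ab∈ = Mem.∈-filter⁺ (leaving? X) ab∈ (Xa , Xb)
  ... | no ab∉ = true≢false (closed r (Bool.not-injective Xb)) (Bool.not-injective Xa)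
    where
    r : Residual G F a b
    r with (b , a) ∈ᵃ? F
    ... | yes ba∈ = inj₂ ba∈
    ... | no ba∉  = inj₁ (e , ab∉ , ba∉)
  no-entering : ∀ {a b} → (a , b) ∈ F → X b ≡ true → X a ≡ true
  no-entering {a} ab∈ Xb = case true-or-false (S a) of λ where
    (inj₁ Sa) → true≢false (closed (inj₂ ab∈) Sa) (Bool.not-injective Xb)
    (inj₂ Sa) → cong not Sa
  size : length (filter (leaving? X) F) ≡ p
  size = ℕ.+-cancelˡ-≡ (count (X ∘ proj₂) F) _ _ (begin
    count (X ∘ proj₂) F + length (filter (leaving? X) F)
      ≡⟨ sym (count-split X F no-entering) ⟩
    count (X ∘ proj₁) F
      ≡⟨ sym (ℕ.+-identityʳ _) ⟩
    count (X ∘ proj₁) F + 0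
      ≡⟨ cong (count (X ∘ proj₁) F +_) (sym (trans (cong (λ b → p * bit (not b)) t∈S) (ℕ.*-zeroʳ p))) ⟩
    count (X ∘ proj₁) F + p * bit (X t)
      ≡⟨ bal X ⟩
    count (X ∘ proj₂) F + p * bit (X s)
      ≡⟨ cong (count (X ∘ proj₂) F +_) (trans (cong (λ b → p * bit (not b)) Ss) (ℕ.*-identityʳ p)) ⟩
    count (X ∘ proj₂) F + p ∎)
    where open ≡-Reasoning

flow-or-cut : ∀ G s t k → Flow G s t (suc k) ⊎ (∃[ X ] X s ≡ true × X t ≡ false × CutAtMost G X k)
flow-or-cut G s t zero = augment G s t 0 ([] , record { uniq = [] ; edge = λ () ; anti = λ () } , λ P → refl)
flow-or-cut G s t (suc k) with flow-or-cut G s t k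
... | inj₁ φ = augment G s t (suc k) φ
... | inj₂ (X , Xs , Xt , L , L≤k , cov) = inj₂ (X , Xs , Xt , L , ℕ.m≤n⇒m≤1+n L≤k , cov)

data Consecutive {m} : List (Fin m) → Fin m → Fin m → Set where
  now   : ∀ {a b l} → Consecutive (a ∷ b ∷ l) a b
  later : ∀ {x a b l} → Consecutive l a b → Consecutive (x ∷ l) a b

consecutive-R : ∀ {m R} {t v : Fin m} {l a b} → SPath R t v l → Consecutive l a b → R a b
consecutive-R (step r stop _)         now       = r
consecutive-R (step r (step _ _ _) _) now       = r
consecutive-R (step _ p _)            (later c) = consecutive-R p c
consecutive-R stop                    (later ())

PathRemoved : ∀ G → V G → List (V G) → Arcs (n G) → (X Y : (V G → Bool) → ℕ) → Set
PathRemoved G t l F X Y =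
  ∃[ F′ ] ArcSet G F′ × Balanced F′ X (λ P → Y P + bit (P t)) ×
          (∀ {e} → e ∈ F′ → e ∈ F) × (∀ {a b} → Consecutive l a b → (a , b) ∉ F′)

-- The arcs of the path are deleted one by one; each deletion moves the balance term from `a` to
-- `b`.
pull : ∀ G {t} l {u F X Y} → SPath (λ a b → (a , b) ∈ F) t u l → ArcSet G F →
       Balanced F X (λ P → Y P + bit (P u)) → PathRemoved G t l F X Y
pull G (t ∷ []) stop A bal = _ , A , bal , id , λ where (later ())
pull G {t} (a ∷ l) {F = F} {X} {Y} (step {b = b} ab∈ p a∉) A bal =
  finish (pull G l {F = F ∖ (a , b)} {X = X} {Y = Y}
    (SPath-map (λ x∈ _ xy∈ → ∈∖ xy∈ λ where refl → a∉ x∈) p) (removeArc G (a , b) A) bal″)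
  where
  gone′ : ∀ {F′} → SPath (λ a b → (a , b) ∈ F) _ b l → (∀ {e} → e ∈ F′ → e ∈ F ∖ (a , b)) →
          (∀ {x y} → Consecutive l x y → (x , y) ∉ F′) →
          ∀ {x y} → Consecutive (a ∷ l) x y → (x , y) ∉ F′
  gone′ stop         sub gone now       = λ e∈ → ∉∖ F (a , b) (sub e∈)
  gone′ (step _ _ _) sub gone now       = λ e∈ → ∉∖ F (a , b) (sub e∈)
  gone′ _            sub gone (later c) = gone c
  finish : PathRemoved G t l (F ∖ (a , b)) X Y → PathRemoved G t (a ∷ l) F X Y
  finish (F′ , A′ , bal′ , sub , gone) = F′ , A′ , bal′ , (λ e∈ → ∖⊆ F _ (sub e∈)) , gone′ p sub gone
  bal″ : Balanced (F ∖ (a , b)) X (λ P → Y P + bit (P b))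
  bal″ P = ℕ.+-cancelˡ-≡ (bit (P a)) _ _ (begin
    bit (P a) + (cs + X P)
      ≡⟨ sym (ℕ.+-assoc (bit (P a)) cs (X P)) ⟩
    (bit (P a) + cs) + X P
      ≡⟨ cong (_+ X P) (sym (count-∖ (P ∘ proj₁) (ArcSet.uniq A) ab∈)) ⟩
    count (P ∘ proj₁) F + X P
      ≡⟨ bal P ⟩
    count (P ∘ proj₂) F + (Y P + bit (P a))
      ≡⟨ cong (_+ (Y P + bit (P a))) (count-∖ (P ∘ proj₂) (ArcSet.uniq A) ab∈) ⟩
    (bit (P b) + ct) + (Y P + bit (P a))
      ≡⟨ solve 4 (λ i j y c → (j :+ c) :+ (y :+ i) := i :+ (c :+ (y :+ j))) refl (bit (P a)) (bit (P b)) (Y P) ct ⟩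
    bit (P a) + (ct + (Y P + bit (P b))) ∎)
    where
    open ≡-Reasoning
    open +-*-Solver
    cs ct : ℕ
    cs = count (P ∘ proj₁) (F ∖ (a , b))
    ct = count (P ∘ proj₂) (F ∖ (a , b))

count-mono-∈ : ∀ {A : Set} (p q : A → Bool) xs → (∀ {x} → x ∈ xs → p x ≡ true → q x ≡ true) → count p xs ≤ count q xs
count-mono-∈ p q []       _   = z≤n
count-mono-∈ p q (x ∷ xs) p⇒q = ℕ.+-mono-≤ (bit-≤ (p x) (q x) (p⇒q (here refl))) (count-mono-∈ p q xs (p⇒q ∘ there))

-- If `s` could not reach `t` along `F`, no arc would leave the set `X` of such vertices, although
-- by the balance `suc p` more arcs start in `X` than end there.
flow-path : ∀ G s t p (F : Arcs (n G)) → Balanced F (λ P → suc p * bit (P t)) (λ P → suc p * bit (P s)) →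
            ∃[ l ] SPath (λ a b → (a , b) ∈ F) t s l
flow-path G s t p F bal with reach (λ a b → (a , b) ∈ᵃ? F) t
... | R with Reach.S R s in Ss
...   | true  = map₂ proj₁ (Reach.path R Ss)
...   | false = contradiction (begin-strict
    count (X ∘ proj₁) F              ≤⟨ count-mono-∈ _ _ F stays ⟩
    count (X ∘ proj₂) F              <⟨ ℕ.m<m+n _ z<s ⟩
    count (X ∘ proj₂) F + suc p      ≡⟨ cong (count (X ∘ proj₂) F +_) (sym (trans (cong (λ b → suc p * bit (not b)) Ss) (ℕ.*-identityʳ _))) ⟩
    count (X ∘ proj₂) F + suc p * bit (X s) ≡⟨ sym (bal X) ⟩
    count (X ∘ proj₁) F + suc p * bit (X t) ≡⟨ cong (count (X ∘ proj₁) F +_) (trans (cong (λ b → suc p * bit (not b)) t∈S) (ℕ.*-zeroʳ (suc p))) ⟩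
    count (X ∘ proj₁) F + 0          ≡⟨ ℕ.+-identityʳ _ ⟩
    count (X ∘ proj₁) F              ∎) (ℕ.<-irrefl refl)
  where
  open Reach R
  open ℕ.≤-Reasoning
  X : V G → Bool
  X = not ∘ S
  stays : ∀ {e} → e ∈ F → X (proj₁ e) ≡ true → X (proj₂ e) ≡ true
  stays {a , b} ab∈ Xa = case true-or-false (S b) of λ where
    (inj₁ Sb) → true≢false (closed ab∈ Sb) (Bool.not-injective Xa)
    (inj₂ Sb) → cong not Sb

record DisjointPaths G s t (F : Arcs (n G)) p : Set where
  field
    l        : Fin p → List (V G)
    path     : ∀ i → SPath (λ a b → (a , b) ∈ F) t s (l i)
    disjoint : ∀ i j → i ≢ j → ∀ {a b} → Consecutive (l i) a b → ¬ Consecutive (l j) a b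

decompose : ∀ G s t p F → ArcSet G F → Balanced F (λ P → p * bit (P t)) (λ P → p * bit (P s)) →
            DisjointPaths G s t F p
decompose G s t zero F A bal = record { l = λ () ; path = λ () ; disjoint = λ () }
decompose G s t (suc p) F A bal
  with l₀ , q ← flow-path G s t p F bal
  with F′ , A′ , bal′ , sub , gone ← pull G l₀ {X = λ P → suc p * bit (P t)} {Y = λ P → p * bit (P s)} q A
         (λ P → trans (bal P) (cong (count (P ∘ proj₂) F +_) (ℕ.+-comm (bit (P s)) _)))
  = record { l = l ; path = path ; disjoint = disjoint }
  where
  rest : DisjointPaths G s t F′ p
  rest = decompose G s t p F′ A′ λ P → ℕ.+-cancelˡ-≡ (bit (P t)) _ _ (trans
    (solve 3 (λ b c q → b :+ (c :+ q) := c :+ (b :+ q)) refl (bit (P t)) (count (P ∘ proj₁) F′) _)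
    (trans (bal′ P)
      (solve 3 (λ b c q → c :+ (q :+ b) := b :+ (c :+ q)) refl (bit (P t)) (count (P ∘ proj₂) F′) _)))
    where open +-*-Solver
  module R = DisjointPaths rest
  l : Fin (suc p) → List (V G)
  l zero    = l₀
  l (suc i) = R.l i
  path : ∀ i → SPath (λ a b → (a , b) ∈ F) t s (l i)
  path zero    = q
  path (suc i) = SPath-map (λ _ _ → sub) (R.path i)
  disjoint : ∀ i j → i ≢ j → ∀ {a b} → Consecutive (l i) a b → ¬ Consecutive (l j) a b
  disjoint zero    zero    0≢0 _ _ = 0≢0 refl
  disjoint zero    (suc j) _ c d = gone c (consecutive-R (R.path j) d)
  disjoint (suc i) zero    _ c d = gone d (consecutive-R (R.path i) c)
  disjoint (suc i) (suc j) i≢j c d = R.disjoint i j (i≢j ∘ cong suc) c d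

record PathAlong G {t v} (l : List (V G)) : Set where
  field
    P  : Path G v t
    on : ∀ i → Path.vs P i ∈ l
    co : ∀ i → Consecutive l (Path.vs P (inject₁ i)) (Path.vs P (suc i))

toPath : ∀ G {R : V G → V G → Set} {t v l} → (∀ {a b} → R a b → E G a b) → SPath R t v l → PathAlong G {t} {v} l
toPath G {t = t} R⊆E stop = record
  { P = record { len = 0 ; vs = λ _ → t ; start = refl ; end = refl
               ; inj = (λ where zero zero _ → refl) ; steps = λ () }
  ; on = λ _ → here refl ; co = λ () }
toPath G {R} {t} {a} {.a ∷ l} R⊆E (step {b = b} r p a∉) = record
  { P = record { len = suc Q.len ; vs = vs ; start = refl ; end = Q.end ; inj = inj ; steps = steps }
  ; on = on ; co = co p }
  where
  rec : PathAlong G {t} {b} l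
  rec = toPath G R⊆E p
  module A = PathAlong rec
  module Q = Path A.P
  vs : Fin (suc (suc Q.len)) → V G
  vs zero    = a
  vs (suc i) = Q.vs i
  inj : ∀ i j → vs i ≡ vs j → i ≡ j
  inj zero    zero    _  = refl
  inj zero    (suc j) eq = contradiction (subst (_∈ l) (sym eq) (A.on j)) a∉
  inj (suc i) zero    eq = contradiction (subst (_∈ l) eq (A.on i)) a∉
  inj (suc i) (suc j) eq = cong suc (Q.inj i j eq)
  steps : ∀ i → E G (vs (inject₁ i)) (vs (suc i))
  steps zero    = subst (E G a) (sym Q.start) (R⊆E r)
  steps (suc i) = Q.steps i
  on : ∀ i → vs i ∈ a ∷ l
  on zero    = here refl
  on (suc i) = there (A.on i)
  co : SPath R t b l → ∀ i → Consecutive (a ∷ l) (vs (inject₁ i)) (vs (suc i))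
  co stop         zero    = subst (Consecutive _ a) (sym Q.start) now
  co (step _ _ _) zero    = subst (Consecutive _ a) (sym Q.start) now
  co _            (suc i) = later (A.co i)

menger : ∀ G k s t → ¬ EdgeDisjointPaths G s t (suc k) → ∃[ X ] X s ≡ true × X t ≡ false × CutAtMost G X k
menger G k s t ¬paths with flow-or-cut G s t k
... | inj₂ cut = cut
... | inj₁ (F , A , bal) = contradiction ((λ i → PathAlong.P (along i)) , disj) ¬paths
  where
  module D = DisjointPaths (decompose G s t (suc k) F A bal)
  along : ∀ i → PathAlong G {t} {s} (D.l i)
  along i = toPath G (ArcSet.edge A) (D.path i)
  at : ∀ i p {a b} → Path.vs (PathAlong.P (along i)) (inject₁ p) ≡ a → Path.vs (PathAlong.P (along i)) (suc p) ≡ b →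
       Consecutive (D.l i) a b
  at i p refl refl = PathAlong.co (along i) p
  arc : ∀ i {a b} → Consecutive (D.l i) a b → (a , b) ∈ F
  arc i = consecutive-R (D.path i)
  disj : ∀ i j → i ≢ j → EdgeDisjoint (PathAlong.P (along i)) (PathAlong.P (along j))
  disj i j i≢j p q a b (inj₁ (d , d′)) (inj₁ (e , e′)) = D.disjoint i j i≢j (at i p d d′) (at j q e e′)
  disj i j i≢j p q a b (inj₁ (d , d′)) (inj₂ (e , e′)) = ArcSet.anti A (arc i (at i p d d′)) (arc j (at j q e e′))
  disj i j i≢j p q a b (inj₂ (d , d′)) (inj₂ (e , e′)) = D.disjoint i j i≢j (at i p d d′) (at j q e e′)
  disj i j i≢j p q a b (inj₂ (d , d′)) (inj₁ (e , e′)) = ArcSet.anti A (arc i (at i p d d′)) (arc j (at j q e e′))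

leaves : ∀ {m} (X : Fin m → Bool) len (vs : Fin (suc len) → Fin m) → X (vs zero) ≡ true → X (vs (fromℕ len)) ≡ false →
         ∃[ i ] X (vs (inject₁ i)) ≡ true × X (vs (suc i)) ≡ false
leaves X zero    vs Xs Xe = true≢false Xs Xe
leaves X (suc l) vs Xs Xe with X (vs (suc zero)) in X1
... | false = zero , Xs , X1
... | true  with i , p ← leaves X l (vs ∘ suc) X1 Xe = suc i , p

cut⇒¬paths : ∀ G k s t X → X s ≡ true → X t ≡ false → CutAtMost G X k → ¬ EdgeDisjointPaths G s t (suc k)
cut⇒¬paths G k s t X Xs Xt (L , L≤k , cov) (P , disj) =
  ℕ.<⇒≱ (s≤s L≤k) (injection⇒≤length (λ i → a i , b i) L inj (λ i → cov _ _ (cr i)))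
  where
  ex : ∀ i → ∃[ j ] X (Path.vs (P i) (inject₁ j)) ≡ true × X (Path.vs (P i) (suc j)) ≡ false
  ex i = leaves X _ (Path.vs (P i)) (trans (cong X (Path.start (P i))) Xs) (trans (cong X (Path.end (P i))) Xt)
  a b : Fin (suc k) → V G
  a i = Path.vs (P i) (inject₁ (proj₁ (ex i)))
  b i = Path.vs (P i) (suc (proj₁ (ex i)))
  cr : ∀ i → Cross G X (a i) (b i)
  cr i = proj₁ (proj₂ (ex i)) , proj₂ (proj₂ (ex i)) , Path.steps (P i) (proj₁ (ex i))
  inj : ∀ i j → (a i , b i) ≡ (a j , b j) → i ≡ j
  inj i j eq with i ≟ j
  ... | yes i≡j = i≡j
  ... | no i≢j = ⊥-elim (disj i j i≢j (proj₁ (ex i)) (proj₁ (ex j)) (a i) (b i) (inj₁ (refl , refl))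
                   (inj₁ (sym (cong proj₁ eq) , sym (cong proj₂ eq))))

-- Graphs on a subset of the vertices

module Restrict {N} (S : Fin N → Bool) where
  members : List (Fin N)
  members = filter (λ v → S v Bool.≟ true) (allFin N)

  size : ℕ
  size = length members

  ι : Fin size → Fin N
  ι = lookup members

  ι-inj : ∀ i j → ι i ≡ ι j → i ≡ j
  ι-inj = lookup-injective (Unique.filter⁺ (λ v → S v Bool.≟ true) (Unique.allFin⁺ N))

  ι∈ : ∀ i → S (ι i) ≡ true
  ι∈ i = proj₂ (Mem.∈-filter⁻ (λ v → S v Bool.≟ true) {xs = allFin N} (Mem.∈-lookup i))

  ι-onto : ∀ {v} → S v ≡ true → ∃[ i ] ι i ≡ v
  ι-onto {v} Sv = index v∈ , sym (Any.lookup-index v∈)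
    where
    v∈ : v ∈ members
    v∈ = Mem.∈-filter⁺ (λ v → S v Bool.≟ true) (Mem.∈-allFin v) Sv

  size< : ∀ {v} → S v ≡ false → size < N
  size< {v} Sv = subst (size <_) (List.length-tabulate {n = N} id)
    (List.filter-notAll (λ v → S v Bool.≟ true) (allFin N)
      (Any.map (λ where refl Sv′ → true≢false Sv′ Sv) (Mem.∈-allFin v)))

  extend : ∀ {A : Set} → A → (Fin size → A) → Fin N → A
  extend d f v with Fin.any? (λ i → ι i ≟ v)
  ... | yes (i , _) = f i
  ... | no _        = d

  extend-ι : ∀ {A : Set} (d : A) f i → extend d f (ι i) ≡ f i
  extend-ι d f i with Fin.any? (λ j → ι j ≟ ι i)
  ... | yes (j , eq) = cong f (ι-inj j i eq)
  ... | no ¬ex       = contradiction (i , refl) ¬ex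

  restrict : (A : Fin N → Fin N → Bool) → (∀ a b → A a b ≡ A b a) → (∀ a → A a a ≡ false) → Graph
  restrict A A-sym A-irrefl = record
    { n = size ; adj = λ i j → A (ι i) (ι j) ; sym = λ i j → A-sym (ι i) (ι j) ; irrefl = λ i → A-irrefl (ι i) }

CutOn : ∀ {N} → (S : Fin N → Bool) (A : Fin N → Fin N → Bool) (X : Fin N → Bool) → ℕ → Set
CutOn {N} S A X k = Σ (List (Fin N × Fin N)) λ L → length L ≤ k ×
  (∀ a b → S a ≡ true → S b ≡ true → X a ≡ true → X b ≡ false → A a b ≡ true → (a , b) ∈ L)

cutOn-not : ∀ {N} {S : Fin N → Bool} {A : Fin N → Fin N → Bool} → (∀ a b → A a b ≡ A b a) →
            ∀ X {k} → CutOn S A X k → CutOn S A (not ∘ X) k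
cutOn-not A-sym X (L , L≤ , cov) = map swap L , length-map≤ swap L L≤ ,
  λ a b Sa Sb Xa Xb Aab → Mem.∈-map⁺ swap
    (cov b a Sb Sa (Bool.not-injective Xb) (Bool.not-injective Xa) (trans (A-sym b a) Aab))

-- `Good` for the vertex set `S` and adjacency `A`, stated on the ambient vertices. Graphs with new
-- edges are checked in this form; the renumbering is done once, in `restrict-good`.
record GoodOn (k : ℕ) {N} (S : Fin N → Bool) (A : Fin N → Fin N → Bool) : Set where
  field
    uncolourable  : ∀ (f : Fin N → Fin k) → ¬ (∀ a b → S a ≡ true → S b ≡ true → A a b ≡ true → f a ≢ f b)
    edge-critical : ∀ u v → S u ≡ true → S v ≡ true → A u v ≡ true → Σ (Fin N → Fin k) λ f →
                    ∀ a b → S a ≡ true → S b ≡ true → A a b ≡ true → ¬ SameEdge a b u v → f a ≢ f b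
    no-isolated   : ∀ u → S u ≡ true → ∃[ v ] S v ≡ true × A u v ≡ true
    cut           : ∀ u v → S u ≡ true → S v ≡ true → u ≢ v →
                    ∃[ X ] X u ≡ true × X v ≡ false × CutOn S A X k

restrict-good : ∀ {k N} (S : Fin N → Bool) A A-sym A-irrefl → GoodOn (suc k) S A →
                Good (suc k) (Restrict.restrict S A A-sym A-irrefl)
restrict-good {k} {N} S A A-sym A-irrefl good = record
  -- Colours outside `S` are irrelevant; the default `zero` is the reason for `suc k`.
  { uncolourable = λ (f , proper) → uncolourable (extend zero f) λ a b Sa Sb Aab → lift f proper a b Sa Sb Aab
  ; edge-critical = λ u v uv → let f , proper = edge-critical (ι u) (ι v) (ι∈ u) (ι∈ v) uv in
      f ∘ ι , λ a b ab ¬same → proper (ι a) (ι b) (ι∈ a) (ι∈ b) ab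
        λ where (inj₁ (p , q)) → ¬same (inj₁ (ι-inj a u p , ι-inj b v q))
                (inj₂ (p , q)) → ¬same (inj₂ (ι-inj a v p , ι-inj b u q))
  ; no-isolated = λ u → isolated u (no-isolated (ι u) (ι∈ u))
  ; cut = cut′ }
  where
  open Restrict S
  open GoodOn good
  G′ : Graph
  G′ = restrict A A-sym A-irrefl
  lift : ∀ f → (∀ u v → E G′ u v → f u ≢ f v) → ∀ a b → S a ≡ true → S b ≡ true → A a b ≡ true →
         extend {Fin (suc k)} zero f a ≢ extend zero f b
  lift f proper a b Sa Sb Aab eq with ι-onto Sa | ι-onto Sb
  ... | i , refl | j , refl = proper i j Aab (trans (sym (extend-ι zero f i)) (trans eq (extend-ι zero f j)))
  isolated : ∀ u → ∃[ v ] S v ≡ true × A (ι u) v ≡ true → ∃[ v ] E G′ u v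
  isolated u (v , Sv , uv) with ι-onto Sv
  ... | j , refl = j , uv
  cut′ : ∀ u v → u ≢ v → ∃[ X ] X u ≡ true × X v ≡ false × CutAtMost G′ X (suc k)
  cut′ u v u≢v with cut (ι u) (ι v) (ι∈ u) (ι∈ v) (u≢v ∘ ι-inj u v)
  ... | X , Xu , Xv , L , L≤ , cov =
    X ∘ ι , Xu , Xv , map back L , length-map≤ back L L≤ ,
    λ a b (Xa , Xb , ab) → subst (_∈ map back L) (cong₂ _,_ (extend-ι u id a) (extend-ι u id b))
      (Mem.∈-map⁺ back (cov (ι a) (ι b) (ι∈ a) (ι∈ b) Xa Xb ab))
    where
    back : Fin N × Fin N → Fin size × Fin size
    back (a , b) = extend u id a , extend u id b

-- The class 𝒞 (suc k) in terms of Good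

-- A function rebuilt from its first value and the rest agrees with the original pointwise, hence
-- the hypothesis that `P` respects `≗`.
any-function? : ∀ m {c} {P : (Fin m → Fin c) → Set} → (∀ {f g} → f ≗ g → P f → P g) →
                (∀ f → Dec (P f)) → Dec (∃ P)
any-function? zero {c} ext P? = map′ (f₀ ,_) (λ (f , Pf) → ext {f} {f₀} (λ ()) Pf) (P? f₀)
  where
  f₀ : Fin 0 → Fin c
  f₀ ()
any-function? (suc m) {c} {P} ext P? =
  map′ (λ (x , f , p) → cons x f , p)
       (λ (f , p) → f zero , f ∘ suc , ext (λ where zero → refl ; (suc _) → refl) p)
       (Fin.any? λ x → any-function? m {P = λ f → P (cons x f)}
         (λ eq → ext λ where zero → refl ; (suc i) → eq i) (λ f → P? (cons x f)))
  where
  cons : Fin c → (Fin m → Fin c) → Fin (suc m) → Fin c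
  cons x f zero    = x
  cons x f (suc i) = f i

colorable? : ∀ G c → Dec (Colorable G c)
colorable? G c = any-function? (n G)
  (λ f≗g proper u v e eq → proper u v e (trans (f≗g u) (trans eq (sym (f≗g v)))))
  (λ f → Fin.all? λ u → Fin.all? λ v → adj? G u v →-dec ¬? (f u ≟ f v))

colorable-mono : ∀ G {c d} → c ≤ d → Colorable G c → Colorable G d
colorable-mono G c≤d (f , proper) =
  (λ v → inject≤ (f v) c≤d) , λ u v e eq → proper u v e (Fin.inject≤-injective c≤d c≤d (f u) (f v) eq)

colorable-sub : ∀ {H G c} → SubgraphOf H G → Colorable G c → Colorable H c
colorable-sub sub (f , proper) = f ∘ φ , λ u v e → proper (φ u) (φ v) (edges u v e)
  where open SubgraphOf sub

-- `Critical` compares chromatic numbers and says nothing until that of `H` is known. Colourability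
-- is decidable, and an `H` needing more than `k` colours has chromatic number `suc k`.
critical⇒colorable : ∀ {G k} → Critical G → IsChromaticNumber G (suc k) → ∀ {H} → ProperSubgraphOf H G → Colorable H k
critical⇒colorable {G} {k} crit χ {H} sub with colorable? H k
... | yes col = col
... | no ¬col = contradiction (crit H sub (suc k) (suc k) (H-col , H-min) χ) (ℕ.<-irrefl refl)
  where
  H-col : Colorable H (suc k)
  H-col = colorable-sub (ProperSubgraphOf.sub sub) (proj₁ χ)
  H-min : ∀ c → Colorable H c → suc k ≤ c
  H-min c col = ℕ.≰⇒> λ c≤k → ¬col (colorable-mono H c≤k col)

sameEdge? : ∀ {m} (a b u v : Fin m) → Dec (SameEdge a b u v)
sameEdge? a b u v = (a ≟ u ×-dec b ≟ v) ⊎-dec (a ≟ v ×-dec b ≟ u)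

sameEdge-swap : ∀ {m} {a b u v : Fin m} → SameEdge a b u v → SameEdge b a u v
sameEdge-swap (inj₁ (p , q)) = inj₂ (q , p)
sameEdge-swap (inj₂ (p , q)) = inj₁ (q , p)

sameEdge-common : ∀ {m} {a b u v x y : Fin m} → SameEdge a b x y → SameEdge u v x y → SameEdge a b u v
sameEdge-common (inj₁ (refl , refl)) (inj₁ (refl , refl)) = inj₁ (refl , refl)
sameEdge-common (inj₁ (refl , refl)) (inj₂ (refl , refl)) = inj₂ (refl , refl)
sameEdge-common (inj₂ (refl , refl)) (inj₁ (refl , refl)) = inj₂ (refl , refl)
sameEdge-common (inj₂ (refl , refl)) (inj₂ (refl , refl)) = inj₁ (refl , refl)

colouring-forced : ∀ {k G} {u v : V G} → ¬ Colorable G k → (f : V G → Fin k) →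
                   (∀ a b → E G a b → ¬ SameEdge a b u v → f a ≢ f b) → f u ≡ f v
colouring-forced {u = u} {v} ¬col f proper = decidable-stable (f u ≟ f v) λ fu≢fv →
  ¬col (f , λ a b ab → case sameEdge? a b u v of λ where
    (no ¬same)                 → proper a b ab ¬same
    (yes (inj₁ (refl , refl))) → fu≢fv
    (yes (inj₂ (refl , refl))) → fu≢fv ∘ sym)

does-cong : ∀ {A B : Set} (A? : Dec A) (B? : Dec B) → (A → B) → (B → A) → does A? ≡ does B?
does-cong (yes a) B? to _ = sym (dec-true B? (to a))
does-cong (no ¬a) B? _ from = sym (dec-false B? (¬a ∘ from))

deleteEdge : ∀ G → V G → V G → Graph
deleteEdge G u v = record
  { n = n G
  ; adj = λ a b → adj G a b ∧ not (does (sameEdge? a b u v))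
  ; sym = λ a b → cong₂ (λ x y → x ∧ not y) (Graph.sym G a b)
            (does-cong (sameEdge? a b u v) (sameEdge? b a u v) sameEdge-swap sameEdge-swap)
  ; irrefl = λ a → cong (_∧ _) (irrefl G a) }

deleteEdge-proper : ∀ G {u v} → E G u v → ProperSubgraphOf (deleteEdge G u v) G
deleteEdge-proper G {u} {v} uv = record
  { sub = record { φ = id ; inj = λ _ _ eq → eq ; edges = λ a b → Bool.∧-conicalˡ (adj G a b) _ }
  ; proper = λ (_ , all) → true≢false (dec-true (sameEdge? u v u v) (inj₁ (refl , refl)))
               (Bool.not-injective (Bool.∧-conicalʳ (adj G u v) _ (all u v uv))) }

deleteVertex : ∀ G → V G → Graph
deleteVertex G v = Restrict.restrict (λ a → not (does (a ≟ v))) (adj G) (Graph.sym G) (irrefl G)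

deleteVertex-proper : ∀ G v → ProperSubgraphOf (deleteVertex G v) G
deleteVertex-proper G v = record
  { sub = record { φ = ι ; inj = ι-inj ; edges = λ _ _ e → e }
  ; proper = λ (onto , _) → let i , ιi≡v = onto v in
      true≢false (dec-true (ι i ≟ v) ιi≡v) (Bool.not-injective (ι∈ i)) }
  where open Restrict (λ a → not (does (a ≟ v)))

-- An isolated vertex could take any colour, so a colouring of the rest would extend. This
-- presupposes a colour: the single vertex of a graph in `𝒞 0` is isolated.
𝒞⇒good : ∀ {k G} → 𝒞 (suc k) G → Good (suc k) G
𝒞⇒good {k} {G} (crit , χ , λ≤) = record
  { uncolourable = λ col → ℕ.<-irrefl refl (proj₂ χ (suc k) col)
  ; edge-critical = λ u v uv → let f , proper = critical⇒colorable crit χ (deleteEdge-proper G uv) in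
      f , λ a b ab ¬same → proper a b (cong₂ (λ x y → x ∧ not y) ab (dec-false (sameEdge? a b u v) ¬same))
  ; no-isolated = no-isolated
  ; cut = λ u v u≢v → menger G (suc k) u v (λ≤ u v u≢v) }
  where
  no-isolated : ∀ u → ∃[ v ] E G u v
  no-isolated u with Fin.any? (adj? G u)
  ... | yes nbr = nbr
  ... | no ¬nbr = contradiction (extend zero f , lift) (λ col → ℕ.<-irrefl refl (proj₂ χ (suc k) col))
    where
    open Restrict (λ a → not (does (a ≟ u)))
    f = proj₁ (critical⇒colorable crit χ (deleteVertex-proper G u))
    proper = proj₂ (critical⇒colorable crit χ (deleteVertex-proper G u))
    lift : ∀ a b → E G a b → extend {Fin (suc k)} zero f a ≢ extend zero f b
    lift a b ab eq with ι-onto {a} (cong not (dec-false (a ≟ u) λ where refl → ¬nbr (b , ab)))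
                      | ι-onto {b} (cong not (dec-false (b ≟ u) λ where refl → ¬nbr (a , E-sym G ab)))
    ... | i , refl | j , refl = proper i j ab (trans (sym (extend-ι zero f i)) (trans eq (extend-ι zero f j)))

-- A proper subgraph misses an edge: if it misses a vertex, then also any edge at that vertex. So
-- deletions of single edges suffice.
good⇒𝒞 : ∀ {k G} → Good (suc k) G → 𝒞 (suc k) G
good⇒𝒞 {k} {G} good = critical , (colourable , minimal) ,
    λ u v u≢v → let X , Xu , Xv , c = cut u v u≢v in cut⇒¬paths G (suc k) u v X Xu Xv c
  where
  open Good good
  minimal : ∀ c → Colorable G c → suc (suc k) ≤ c
  minimal c col = ℕ.≰⇒> λ c≤ → uncolourable (colorable-mono G c≤ col)
  colourable : Colorable G (suc (suc k))
  colourable = case Fin.any? (λ (_ : V G) → yes tt) of λ where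
    (no empty)    → (λ v → contradiction (v , tt) empty) , λ v → contradiction (v , tt) empty
    (yes (v , _)) → let f , proper = vertex-critical v in
      (inject₁ ∘ f) [ v ↦ fromℕ (suc k) ] , λ a b ab →
        paint G {P = _≢ v} {Q = λ _ → ⊤} (inject₁ ∘ f) v (fromℕ (suc k))
          (λ a b a≢v b≢v ab eq → proper a b a≢v b≢v ab (Fin.inject₁-injective eq))
          (λ _ _ a≢v → a≢v) (λ b _ _ eq → Fin.fromℕ≢inject₁ (sym eq)) a b tt tt ab
  critical : Critical G
  critical H sub a b (_ , H-min) (G-col , _) = ℕ.<-≤-trans (s≤s (H-min (suc k) H-col)) (minimal b G-col)
    where
    open ProperSubgraphOf sub renaming (sub to H⊆G)
    open SubgraphOf H⊆G
    via : ∀ u v → E G u v → (∀ i j → E H i j → ¬ SameEdge (φ i) (φ j) u v) → Colorable H (suc k)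
    via u v uv miss with f , proper′ ← edge-critical u v uv =
      f ∘ φ , λ i j ij → proper′ (φ i) (φ j) (edges i j ij) (miss i j ij)
    H-col : Colorable H (suc k)
    H-col with Fin.any? (λ z → ¬? (Fin.any? (λ i → φ i ≟ z)))
             | Fin.any? (λ i → Fin.any? λ j → adj? G (φ i) (φ j) ×-dec ¬? (adj? H i j))
    ... | yes (z , ∉) | _ = let w , zw = no-isolated z in via z w zw λ where
            i j _ (inj₁ (eq , _)) → ∉ (i , eq)
            i j _ (inj₂ (_ , eq)) → ∉ (j , eq)
    ... | no _ | yes (i , j , e , ¬e) = via (φ i) (φ j) e λ where
            i′ j′ e′ (inj₁ (p , q)) → ¬e (subst (λ x → E H x j) (inj i′ i p) (subst (E H i′) (inj j′ j q) e′))
            i′ j′ e′ (inj₂ (p , q)) → ¬e (E-sym H (subst (λ x → E H x i) (inj i′ j p) (subst (E H i′) (inj j′ i q) e′)))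
    ... | no all | no refl′ = contradiction
            ( (λ z → decidable-stable (Fin.any? (λ i → φ i ≟ z)) (λ ∉ → all (z , ∉)))
            , (λ i j e → decidable-stable (adj? H i j) (λ ¬e → refl′ (i , j , e , ¬e))) ) proper

-- Separations by a vertex and an edge

∨-elim : ∀ x {y} → x ∨ y ≡ true → (x ≡ true) ⊎ (y ≡ true)
∨-elim true  _ = inj₁ refl
∨-elim false e = inj₂ e

∨-introˡ : ∀ {x} y → x ≡ true → x ∨ y ≡ true
∨-introˡ _ refl = refl

∨-introʳ : ∀ x {y} → y ≡ true → x ∨ y ≡ true
∨-introʳ x refl = Bool.∨-zeroʳ x

glue-at : ∀ G {k} (Q : V G → Bool) z (g f : V G → Fin k) → Q z ≡ false → g z ≡ f z →
          ProperOn G (λ a → Q a ≡ true ⊎ a ≡ z) g → ProperOn G (λ a → Q a ≡ false) f →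
          (∀ a b → Q a ≡ true → Q b ≡ false → b ≢ z → E G a b → g a ≢ f b) → Colorable G k
glue-at G Q z g f Qz gz≡fz pg pf ok =
  join-colourings G Q g f (λ a b Qa Qb → pg a b (inj₁ Qa) (inj₁ Qb)) pf cross
  where
  cross : ∀ a b → Cross G Q a b → g a ≢ f b
  cross a b (Qa , Qb , ab) with b ≟ z
  ... | yes refl = λ eq → pg a z (inj₁ Qa) (inj₂ refl) ab (trans eq (sym gz≡fz))
  ... | no b≢z   = ok a b Qa Qb b≢z ab

-- Colourings of the two sides share only `z` and agree there after an exchange of two colours.
no-cutvertex : ∀ {k G} → Good k G → ∀ z (Q : V G → Bool) {p q} → Q z ≡ false → Q q ≡ true → Q p ≡ false → p ≢ z →
               (∀ {a b} → Q a ≡ true → Q b ≡ false → b ≢ z → ¬ E G a b) → ⊥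
no-cutvertex {k} {G} good z Q {p} {q} Qz Qq Qp p≢z none =
  let g , pg = side-colouring (λ a → Q a ≡ true ⊎ a ≡ z) {p} λ where
                 (inj₁ Qp′) → true≢false Qp′ Qp
                 (inj₂ eq)  → p≢z eq
      f , pf = side-colouring (λ a → Q a ≡ false) {q} (true≢false Qq)
  in uncolourable (glue-at G Q z (transpose (g z) (f z) ∘ g) f Qz (transpose-fst (g z) (f z))
       (permute-proper G (g z) (f z) pg) pf λ a b Qa Qb b≢z ab → ⊥-elim (none Qa Qb b≢z ab))
  where open Good good

-- `Q` is the side of `q` in the graph without `z`. As `z` is counted outside `Q`, exchanging the
-- sides is `flip-bridge` and not the complement.
record BridgeSep (G : Graph) : Set where
  field
    z p q  : V G
    Q      : V G → Bool
    Qz     : Q z ≡ false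
    Qq     : Q q ≡ true
    Qp     : Q p ≡ false
    p≢z    : p ≢ z
    pq     : E G p q
    unique : ∀ {a b} → Q a ≡ false → a ≢ z → Q b ≡ true → E G a b → a ≡ p × b ≡ q

flip-bridge : ∀ {G} → BridgeSep G → BridgeSep G
flip-bridge {G} B = record
  { z = z ; p = q ; q = p ; Q = λ a → not (Q a ∨ does (a ≟ z))
  ; Qz = cong not (∨-introʳ (Q z) (dec-true (z ≟ z) refl))
  ; Qq = cong not (trans (cong (_∨ _) Qp) (dec-false (p ≟ z) p≢z))
  ; Qp = cong not (∨-introˡ (does (q ≟ z)) Qq)
  ; p≢z = λ where refl → true≢false Qq Qz
  ; pq = E-sym G pq
  ; unique = uniq }
  where
  open BridgeSep B
  uniq : ∀ {a b} → not (Q a ∨ does (a ≟ z)) ≡ false → a ≢ z → not (Q b ∨ does (b ≟ z)) ≡ true → E G a b → a ≡ q × b ≡ p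
  uniq {a} {b} ha a≢z hb ab with Q a in Qa | Q b in Qb
  ... | true  | false = swap (unique Qb (dec-does-not (b ≟ z) (Bool.not-injective hb)) Qa (E-sym G ab))
  ... | false | _     = contradiction (dec-does (a ≟ z) (Bool.not-injective ha)) a≢z
  ... | true  | true  = case hb of λ ()

module Bridge {k G} (good : Good (suc (suc (suc k))) G) (B : BridgeSep G) where
  open Good good
  open BridgeSep B

  K : ℕ
  K = suc (suc (suc k))

  -- Otherwise a colouring of the other side with `z` could be matched with `f` at `z` and made to
  -- differ from `f p` at `q`, which would colour `G`.
  forced : ∀ (f : V G → Fin K) → ProperOn G (λ a → Q a ≡ false) f → f p ≡ f z
  forced f pf = decidable-stable (f p ≟ f z) λ fp≢fz →
    let g₀ , pg₀ = side-colouring (λ a → Q a ≡ true ⊎ a ≡ z) {p} λ where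
                     (inj₁ Qp′) → true≢false Qp′ Qp
                     (inj₂ eq)  → p≢z eq
    in separate fp≢fz (transpose (g₀ z) (f z) ∘ g₀) (permute-proper G (g₀ z) (f z) pg₀) (transpose-fst (g₀ z) (f z))
    where
    done : (g : V G → Fin K) → ProperOn G (λ a → Q a ≡ true ⊎ a ≡ z) g → g z ≡ f z → g q ≢ f p → ⊥
    done g pg gz≡fz gq≢fp = uncolourable (glue-at G Q z g f Qz gz≡fz pg pf λ a b Qa Qb b≢z ab eq →
      case unique Qb b≢z Qa (E-sym G ab) of λ where (refl , refl) → gq≢fp eq)
    separate : f p ≢ f z → (g : V G → Fin K) → ProperOn G (λ a → Q a ≡ true ⊎ a ≡ z) g → g z ≡ f z → ⊥
    separate fp≢fz g pg gz≡fz with g q ≟ f p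
    ... | no gq≢fp = done g pg gz≡fz gq≢fp
    -- A third colour `d` moves `q` away from `f p` while `z` keeps its colour.
    ... | yes gq≡fp with freshColour (f p ∷ f z ∷ []) (s≤s (s≤s (s≤s z≤n)))
    ...   | d , d∉ = done (transpose (f p) d ∘ g) (permute-proper G (f p) d pg)
              (trans (cong (transpose (f p) d) gz≡fz)
                (transpose-other (f p) d (fp≢fz ∘ sym) (λ eq → d∉ (there (here (sym eq))))))
              (λ eq → d∉ (here (trans (sym (trans (cong (transpose (f p) d) gq≡fp) (transpose-fst (f p) d))) eq)))

module BridgePiece {k G} (good : Good (suc (suc (suc k))) G) (B : BridgeSep G) where
  open Good good
  open BridgeSep B
  open Bridge good B
  module Flip = Bridge good (flip-bridge B)

  other-side : ∀ {a} → not (Q a ∨ does (a ≟ z)) ≡ false → Q a ≡ true ⊎ a ≡ z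
  other-side {a} h = Sum.map₂ (dec-does (a ≟ z)) (∨-elim (Q a) (Bool.not-injective h))

  ¬zp : ¬ E G z p
  ¬zp zp = let f , pf = side-colouring (λ a → Q a ≡ false) {q} (true≢false Qq)
           in pf z p Qz Qp zp (sym (forced f pf))

  S : V G → Bool
  S = not ∘ Q
  A : V G → V G → Bool
  A a b = adj G a b ∨ does (sameEdge? a b z p)
  A-sym : ∀ a b → A a b ≡ A b a
  A-sym a b = cong₂ _∨_ (Graph.sym G a b)
    (does-cong (sameEdge? a b z p) (sameEdge? b a z p) sameEdge-swap sameEdge-swap)
  A-irrefl : ∀ a → A a a ≡ false
  A-irrefl a = cong₂ _∨_ (irrefl G a) (dec-false (sameEdge? a a z p)
    λ where (inj₁ (refl , eq)) → p≢z (sym eq)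
            (inj₂ (refl , eq)) → p≢z eq)

  A-elim : ∀ {a b} → A a b ≡ true → E G a b ⊎ SameEdge a b z p
  A-elim {a} {b} h = Sum.map₂ (dec-does (sameEdge? a b z p)) (∨-elim (adj G a b) h)
  A-old : ∀ {a b} → E G a b → A a b ≡ true
  A-old = ∨-introˡ _
  A-new : ∀ {a b} → SameEdge a b z p → A a b ≡ true
  A-new {a} {b} s = ∨-introʳ (adj G a b) (dec-true (sameEdge? a b z p) s)

  out : ∀ {a} → S a ≡ true → Q a ≡ false
  out = Bool.not-injective

  -- This stands in for a path from `z` to `p` through the other side. Without such an edge,
  -- exchanging two colours inside `X` only would turn `g` into a colouring of `Q` and `z` in which
  -- `z` and `q` differ, against `Flip.forced`.
  crossing-outside : ∀ X → X z ≡ true → X p ≡ false → ∃[ a ] ∃[ b ] Cross G X a b × (Q a ≡ true ⊎ Q b ≡ true)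
  crossing-outside X Xz Xp
    with Fin.any? (λ a → Fin.any? λ b → cross? G X a b ×-dec (Q a Bool.≟ true ⊎-dec Q b Bool.≟ true))
  ... | yes found = found
  ... | no none = ⊥-elim (d∉ (here (trans (sym (trans (cong (λ b → if b then transpose (g z) d (g z) else g z) Xz) (transpose-fst (g z) d)))
                    (trans (sym (Flip.forced g′ pg′)) (trans (cong (λ b → if b then transpose (g z) d (g q) else g q) Xq) (Flip.forced g pg))))))
    where
    Xq : X q ≡ false
    Xq = case true-or-false (X q) of λ where
      (inj₁ Xq) → contradiction (q , p , (Xq , Xp , E-sym G pq) , inj₁ Qq) none
      (inj₂ Xq) → Xq
    outside = side-colouring (λ a → not (Q a ∨ does (a ≟ z)) ≡ false) {p} λ h → case other-side h of λ where
      (inj₁ Qp′) → true≢false Qp′ Qp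
      (inj₂ eq)  → p≢z eq
    g : V G → Fin K
    g = proj₁ outside
    pg = proj₂ outside
    d : Fin K
    d = proj₁ (freshColour (g z ∷ []) (s≤s (s≤s z≤n)))
    d∉ : d ∉ g z ∷ []
    d∉ = proj₂ (freshColour (g z ∷ []) (s≤s (s≤s z≤n)))
    g′ : V G → Fin K
    g′ v = if X v then transpose (g z) d (g v) else g v
    touches : ∀ {a b} → not (Q a ∨ does (a ≟ z)) ≡ false → not (Q b ∨ does (b ≟ z)) ≡ false → E G a b →
              Q a ≡ true ⊎ Q b ≡ true
    touches {a} {b} ha hb ab with other-side {a} ha | other-side {b} hb
    ... | inj₁ Qa   | _         = inj₁ Qa
    ... | inj₂ _    | inj₁ Qb   = inj₂ Qb
    ... | inj₂ refl | inj₂ refl = contradiction refl (E⇒≢ G ab)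
    pg′ : ProperOn G (λ a → not (Q a ∨ does (a ≟ z)) ≡ false) g′
    pg′ a b ha hb ab eq with X a in Xa | X b in Xb
    ... | true  | true  = pg a b ha hb ab (transpose-injective (g z) d eq)
    ... | false | false = pg a b ha hb ab eq
    ... | true  | false = none (a , b , (Xa , Xb , ab) , touches ha hb ab)
    ... | false | true  = none (b , a , (Xb , Xa , E-sym G ab) , Sum.swap (touches ha hb ab))

  -- The new edge `zp` takes the place of a crossing edge outside the piece, so the cut does not
  -- grow.
  piece-cut : ∀ X {m} → X z ≡ true → X p ≡ false → CutAtMost G X m → CutOn S A X m
  piece-cut X {m} Xz Xp (L , L≤ , cov) with crossing-outside X Xz Xp
  ... | a₀ , b₀ , c₀ , out₀ = map swap-in L , length-map≤ swap-in L L≤ , cov′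
    where
    swap-in : V G × V G → V G × V G
    swap-in e = if does (e ≟² (a₀ , b₀)) then (z , p) else e
    new∈ : (z , p) ∈ map swap-in L
    new∈ = subst (_∈ map swap-in L)
      (cong (λ b → if b then (z , p) else (a₀ , b₀)) (dec-true ((a₀ , b₀) ≟² (a₀ , b₀)) refl))
      (Mem.∈-map⁺ swap-in (cov a₀ b₀ c₀))
    cov′ : ∀ a b → S a ≡ true → S b ≡ true → X a ≡ true → X b ≡ false → A a b ≡ true → (a , b) ∈ map swap-in L
    cov′ a b Sa Sb Xa Xb Aab with A-elim {a} {b} Aab
    ... | inj₂ (inj₁ (refl , refl)) = new∈
    ... | inj₂ (inj₂ (refl , refl)) = true≢false Xa Xp
    ... | inj₁ ab = subst (_∈ map swap-in L)
        (cong (λ t → if t then (z , p) else (a , b)) (dec-false ((a , b) ≟² (a₀ , b₀)) λ where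
          refl → case out₀ of λ where
            (inj₁ Qa) → true≢false Qa (out Sa)
            (inj₂ Qb) → true≢false Qb (out Sb)))
        (Mem.∈-map⁺ swap-in (cov a b (Xa , Xb , ab)))

  piece-good : GoodOn K S A
  piece-good = record
    { uncolourable = λ f proper →
        proper z p (cong not Qz) (cong not Qp) (A-new (inj₁ (refl , refl)))
          (sym (forced f λ a b Qa Qb ab → proper a b (cong not Qa) (cong not Qb) (A-old ab)))
    ; edge-critical = λ u v Su Sv Auv → crit u v Su Sv (sameEdge? u v z p) (A-elim Auv)
    ; no-isolated = λ u Su → nbr u Su (no-isolated u)
    ; cut = λ u v _ _ u≢v → let X , Xu , Xv , c = cut u v u≢v in X , Xu , Xv , cutOn X c }
    where
    crit : ∀ u v → S u ≡ true → S v ≡ true → Dec (SameEdge u v z p) → E G u v ⊎ SameEdge u v z p →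
           Σ (V G → Fin K) λ f → ∀ a b → S a ≡ true → S b ≡ true → A a b ≡ true → ¬ SameEdge a b u v → f a ≢ f b
    crit u v Su Sv (yes same) _ = map₂ (λ {f} pf a b Sa Sb Aab ¬same → case A-elim {a} {b} Aab of λ where
        (inj₁ ab)     → pf a b (out Sa) (out Sb) ab
        (inj₂ same′) → contradiction (sameEdge-common same′ same) ¬same)
      (side-colouring (λ a → Q a ≡ false) {q} (true≢false Qq))
    crit u v Su Sv (no ¬same) (inj₂ same) = contradiction same ¬same
    crit u v Su Sv (no _) (inj₁ uv) with edge-critical u v uv
    ... | f , proper = f , λ a b Sa Sb Aab ¬same → case A-elim {a} {b} Aab of λ where
        (inj₁ ab) → proper a b ab ¬same
        (inj₂ (inj₁ (refl , refl))) → fp≢fz ∘ sym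
        (inj₂ (inj₂ (refl , refl))) → fp≢fz
      where
      inside : ∀ {a b} → Q a ≡ true ⊎ a ≡ z → Q b ≡ true ⊎ b ≡ z → S a ≡ true → S b ≡ true → ¬ E G a b
      inside (inj₁ Qa)   _           Sa _  _  = true≢false Qa (out Sa)
      inside (inj₂ _)    (inj₁ Qb)   _  Sb _  = true≢false Qb (out Sb)
      inside (inj₂ refl) (inj₂ refl) _  _  ab = E⇒≢ G ab refl
      -- The edge `uv` lies in the piece, so `f` is proper on the whole other side and `Flip.forced`
      -- applies. The edge `pq` is intact, hence `f p` differs from `f q`, which is `f z`.
      fq≡fz : f q ≡ f z
      fq≡fz = Flip.forced f λ a b ha hb ab → proper a b ab λ where
        (inj₁ (refl , refl)) → inside (other-side ha) (other-side hb) Su Sv ab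
        (inj₂ (refl , refl)) → inside (other-side ha) (other-side hb) Sv Su ab
      fp≢fz : f p ≢ f z
      fp≢fz eq = proper p q pq (λ where
        (inj₁ (_ , refl)) → true≢false Qq (out Sv)
        (inj₂ (_ , refl)) → true≢false Qq (out Su)) (trans eq (sym fq≡fz))
    nbr : ∀ u → S u ≡ true → ∃[ v ] E G u v → ∃[ v ] S v ≡ true × A u v ≡ true
    nbr u Su (v , uv) with Q v in Qv
    ... | false = v , cong not Qv , A-old uv
    ... | true = case u ≟ z of λ where
      (yes u≡z) → p , cong not Qp , A-new (inj₁ (u≡z , refl))
      (no u≢z)  → z , cong not Qz , A-new (inj₂ (proj₁ (unique (out Su) u≢z Qv uv) , refl))
    cutOn : ∀ X → CutAtMost G X K → CutOn S A X K
    cutOn X c with X z in Xz | X p in Xp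
    ... | true | false = piece-cut X Xz Xp c
    ... | false | true with piece-cut (not ∘ X) (cong not Xz) (cong not Xp) (cutAtMost-not G X c)
    ...   | L , L≤ , cov = map swap L , length-map≤ swap L L≤ ,
              λ a b Sa Sb Xa Xb Aab → Mem.∈-map⁺ swap (cov b a Sb Sa (cong not Xb) (cong not Xa) (trans (A-sym b a) Aab))
    cutOn X (L , L≤ , cov) | true | true = L , L≤ , λ a b _ _ Xa Xb Aab → case A-elim {a} {b} Aab of λ where
      (inj₁ ab) → cov a b (Xa , Xb , ab)
      (inj₂ (inj₁ (refl , refl))) → true≢false Xp Xb
      (inj₂ (inj₂ (refl , refl))) → true≢false Xz Xb
    cutOn X (L , L≤ , cov) | false | false = L , L≤ , λ a b _ _ Xa Xb Aab → case A-elim {a} {b} Aab of λ where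
      (inj₁ ab) → cov a b (Xa , Xb , ab)
      (inj₂ (inj₁ (refl , refl))) → true≢false Xa Xz
      (inj₂ (inj₂ (refl , refl))) → true≢false Xa Xp

  open Restrict S public

  piece : Graph
  piece = restrict A A-sym A-irrefl

  good-piece : Good K piece
  good-piece = restrict-good S A A-sym A-irrefl piece-good

  smaller : n piece < n G
  smaller = size< {q} (cong not Qq)

  zᵢ pᵢ : V piece
  zᵢ = proj₁ (ι-onto {z} (cong not Qz))
  pᵢ = proj₁ (ι-onto {p} (cong not Qp))
  ιz : ι zᵢ ≡ z
  ιz = proj₂ (ι-onto {z} (cong not Qz))
  ιp : ι pᵢ ≡ p
  ιp = proj₂ (ι-onto {p} (cong not Qp))

  sameEdge-ι : ∀ {i j} → SameEdge (ι i) (ι j) z p → SameEdge i j zᵢ pᵢ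
  sameEdge-ι {i} {j} (inj₁ (a , b)) = inj₁ (ι-inj i zᵢ (trans a (sym ιz)) , ι-inj j pᵢ (trans b (sym ιp)))
  sameEdge-ι {i} {j} (inj₂ (a , b)) = inj₂ (ι-inj i pᵢ (trans a (sym ιp)) , ι-inj j zᵢ (trans b (sym ιz)))

  edge-zp : E piece zᵢ pᵢ
  edge-zp = A-new (inj₁ (ιz , ιp))

  via : ∀ {a b} → Q a ≡ false → Q b ≡ false → E G a b → EdgeVia piece G ι zᵢ pᵢ a b
  via {a} {b} Qa Qb ab with ι-onto {a} (cong not Qa) | ι-onto {b} (cong not Qb)
  ... | i , refl | j , refl = i , j , refl , refl , A-old ab , λ where
    (inj₁ (refl , refl)) → ¬zp (subst (λ x → E G x p) ιz (subst (E G _) ιp ab))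
    (inj₂ (refl , refl)) → ¬zp (E-sym G (subst (λ x → E G x z) ιp (subst (E G _) ιz ab)))

  via⁻¹ : ∀ {a b} → EdgeVia piece G ι zᵢ pᵢ a b → E G a b
  via⁻¹ (i , j , refl , refl , e , ¬same) = case A-elim {ι i} {ι j} e of λ where
    (inj₁ ab)   → ab
    (inj₂ same) → contradiction (sameEdge-ι same) ¬same

bridge⇒join : ∀ {k G} (good : Good (suc (suc (suc k))) G) (B : BridgeSep G) →
              HajosJoin (BridgePiece.piece good B) (BridgePiece.piece good (flip-bridge B)) G
bridge⇒join {k} {G} good B = record
  { v₁ = P₁.zᵢ ; w₁ = P₁.pᵢ ; e₁ = P₁.edge-zp
  ; v₂ = P₂.zᵢ ; w₂ = P₂.pᵢ ; e₂ = P₂.edge-zp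
  ; ι₁ = P₁.ι ; ι₂ = P₂.ι ; inj₁ = P₁.ι-inj ; inj₂ = P₂.ι-inj
  ; glue = trans P₁.ιz (sym P₂.ιz)
  ; meet = meet
  ; cover = cover
  ; adj-iff = λ a b → mk⇔ (to a b) (from a b) }
  where
  open BridgeSep B
  module P₁ = BridgePiece good B
  module P₂ = BridgePiece good (flip-bridge B)
  in₂ : ∀ {a} → Q a ≡ true ⊎ a ≡ z → not (Q a ∨ does (a ≟ z)) ≡ false
  in₂ {a} (inj₁ Qa)   = cong not (∨-introˡ (does (a ≟ z)) Qa)
  in₂ {a} (inj₂ refl) = cong not (∨-introʳ (Q z) (dec-true (z ≟ z) refl))
  meet : ∀ x y → P₁.ι x ≡ P₂.ι y → x ≡ P₁.zᵢ × y ≡ P₂.zᵢ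
  meet x y eq with P₁.other-side {P₂.ι y} (P₂.out (P₂.ι∈ y))
  ... | inj₁ Qy = true≢false Qy (trans (cong Q (sym eq)) (P₁.out (P₁.ι∈ x)))
  ... | inj₂ y≡z = P₁.ι-inj x P₁.zᵢ (trans eq (trans y≡z (sym P₁.ιz))) , P₂.ι-inj y P₂.zᵢ (trans y≡z (sym P₂.ιz))
  cover : ∀ a → (∃[ x ] P₁.ι x ≡ a) ⊎ (∃[ y ] P₂.ι y ≡ a)
  cover a with Q a in Qa
  ... | false = inj₁ (P₁.ι-onto (cong not Qa))
  ... | true  = inj₂ (P₂.ι-onto (cong not (in₂ (inj₁ Qa))))
  Edge : V G → V G → Set
  Edge a b = EdgeVia P₁.piece G P₁.ι P₁.zᵢ P₁.pᵢ a b ⊎ EdgeVia P₂.piece G P₂.ι P₂.zᵢ P₂.pᵢ a b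
             ⊎ SameEdge a b (P₁.ι P₁.pᵢ) (P₂.ι P₂.pᵢ)
  to : ∀ a b → E G a b → Edge a b
  to a b ab with Q a in Qa | Q b in Qb
  ... | false | false = inj₁ (P₁.via Qa Qb ab)
  ... | true  | true  = inj₂ (inj₁ (P₂.via (in₂ (inj₁ Qa)) (in₂ (inj₁ Qb)) ab))
  ... | true  | false with b ≟ z
  ...   | yes refl = inj₂ (inj₁ (P₂.via (in₂ (inj₁ Qa)) (in₂ (inj₂ refl)) ab))
  ...   | no b≢z = let b≡p , a≡q = unique Qb b≢z Qa (E-sym G ab) in
                   inj₂ (inj₂ (inj₂ (trans a≡q (sym P₂.ιp) , trans b≡p (sym P₁.ιp))))
  to a b ab | false | true with a ≟ z
  ...   | yes refl = inj₂ (inj₁ (P₂.via (in₂ (inj₂ refl)) (in₂ (inj₁ Qb)) ab))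
  ...   | no a≢z = let a≡p , b≡q = unique Qa a≢z Qb ab in
                   inj₂ (inj₂ (inj₁ (trans a≡p (sym P₁.ιp) , trans b≡q (sym P₂.ιp))))
  from : ∀ a b → Edge a b → E G a b
  from a b (inj₁ e) = P₁.via⁻¹ e
  from a b (inj₂ (inj₁ e)) = P₂.via⁻¹ e
  from a b (inj₂ (inj₂ (inj₁ (refl , refl)))) = subst (λ x → E G x (P₂.ι P₂.pᵢ)) (sym P₁.ιp) (subst (E G p) (sym P₂.ιp) pq)
  from a b (inj₂ (inj₂ (inj₂ (refl , refl)))) =
    E-sym G (subst (λ x → E G x (P₂.ι P₂.pᵢ)) (sym P₁.ιp) (subst (E G p) (sym P₂.ιp) pq))

-- Cycles of low vertices

_∈ˡ?_ : ∀ {m} (a : Fin m) (l : List (Fin m)) → Dec (a ∈ l)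
_∈ˡ?_ = mem? _≟_

-- When a vertex of the chain is painted its successor is still uncoloured; the last one, `y`, stays
-- so.
paint-chain : ∀ G {k} {T : List (V G)} {y} M (f : V G → Fin k) → Linked (E G) (M ++ [ y ]) → y ∈ T →
              (∀ {m} → m ∈ M → deg G m ≤ k) → ProperOn G (_∉ M ++ T) f →
              ∃[ f′ ] ProperOn G (_∉ T) f′ × (∀ {v} → v ∉ M → f′ v ≡ f v)
paint-chain G []      f _ _  _   pf = f , pf , λ _ → refl
paint-chain G {k} {T} {y} (m ∷ M) f L y∈ low pf =
  let u , mu , u∈ = next M L
      c , pf₁ = paint-gap G {Q = _∉ M ++ T} f pf (low (here refl))
                  (λ a a∉ a≢m → λ where (here a≡m) → a≢m a≡m ; (there a∈) → a∉ a∈) mu (λ u∉ → u∉ u∈)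
      f′ , pf′ , same = paint-chain G M (f [ m ↦ c ]) (Linked.tail L) y∈ (low ∘ there) pf₁
  in f′ , pf′ , λ v∉ → trans (same (v∉ ∘ there)) (update-other f c (v∉ ∘ here))
  where
  next : ∀ M → Linked (E G) (m ∷ M ++ [ y ]) → ∃[ u ] E G m u × u ∈ M ++ T
  next []      (my ∷ _) = y , my , y∈
  next (u ∷ M) (mu ∷ _) = u , mu , here refl

-- A single edge walked there and back counts as a cycle.
record Cycle G (x : V G) (R : List (V G)) : Set where
  constructor cycle
  field
    linked : Linked (E G) (x ∷ R ++ [ x ])
    uniq   : Unique (x ∷ R)

linked-snoc : ∀ {A : Set} {R : A → A → Set} xs {x y} → Linked R (xs ++ [ x ]) → R x y → Linked R ((xs ++ [ x ]) ++ [ y ])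
linked-snoc []           [-]     r = r ∷ [-]
linked-snoc (a ∷ [])     (p ∷ L) r = p ∷ linked-snoc [] L r
linked-snoc (a ∷ b ∷ xs) (p ∷ L) r = p ∷ linked-snoc (b ∷ xs) L r

unique-rotate : ∀ {A : Set} {x : A} {xs} → Unique (x ∷ xs) → Unique (xs ++ [ x ])
unique-rotate (x∉ ∷ uniq) = Unique.++⁺ uniq ([] ∷ []) λ where (x∈ , here refl) → All.lookup x∉ x∈ refl

rotate : ∀ {G x m R} → Cycle G x (m ∷ R) → Cycle G m (R ++ [ x ])
rotate {R = R} (cycle (xm ∷ L) uniq) = cycle (linked-snoc (_ ∷ R) L xm) (unique-rotate uniq)

-- `R₁` is still to be searched for `c`; vertices already passed are appended to `R₂`.
rotations : ∀ {G x} R₁ R₂ {c} → Cycle G x (R₁ ++ R₂) → c ∈ x ∷ R₁ →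
            ∃[ R ] Cycle G c R × (c ∷ R) ↭ (x ∷ R₁ ++ R₂)
rotations R₁ R₂ C (here refl) = R₁ ++ R₂ , C , ↭-refl
rotations {G} {x} (m ∷ R₁) R₂ C (there c∈)
  with R , C′ , perm ← rotations R₁ (R₂ ++ [ x ]) (subst (Cycle G m) (List.++-assoc R₁ R₂ [ x ]) (rotate C)) c∈
  = R , C′ , ↭-trans perm (↭-trans
      (subst (λ l → m ∷ R₁ ++ R₂ ++ [ x ] ↭ m ∷ l) (sym (List.++-assoc R₁ R₂ [ x ])) ↭-refl)
      (↭-sym (Perm.∷↭∷ʳ x (m ∷ R₁ ++ R₂))))

rotate-to : ∀ {G x R c} → Cycle G x R → c ∈ x ∷ R → ∃[ R′ ] Cycle G c R′ × (c ∷ R′) ↭ (x ∷ R)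
rotate-to {G} {x} {R} {c} C c∈
  with R′ , C′ , perm ← rotations R [] (subst (Cycle G x) (sym (List.++-identityʳ R)) C) c∈
  = R′ , C′ , subst (λ l → c ∷ R′ ↭ x ∷ l) (List.++-identityʳ R) perm

linked-last : ∀ {A : Set} {R : A → A → Set} xs {y z} → Linked R (xs ++ y ∷ z ∷ []) → R y z
linked-last []           (r ∷ _) = r
linked-last (x ∷ [])     (_ ∷ L) = linked-last [] L
linked-last (x ∷ w ∷ xs) (_ ∷ L) = linked-last (w ∷ xs) L

linked-prefix : ∀ {A : Set} {R : A → A → Set} xs {ys} → Linked R (xs ++ ys) → Linked R xs
linked-prefix []           _       = []
linked-prefix (x ∷ [])     _       = [-]
linked-prefix (x ∷ y ∷ xs) (r ∷ L) = r ∷ linked-prefix (y ∷ xs) L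

module LowCycle {k G} (good : Good k G) {x₀ R₀} (C₀ : Cycle G x₀ R₀)
                (low : ∀ {v} → v ∈ x₀ ∷ R₀ → deg G v ≤ k) where
  open Good good

  L₀ : List (V G)
  L₀ = x₀ ∷ R₀

  Out : (V G → Fin k) → V G → Fin k → Set
  Out f c col = ∃[ c′ ] c′ ∉ L₀ × E G c c′ × f c′ ≡ col

  -- Otherwise colour x with the colour of an outer neighbour y′ of y and continue
  -- round the cycle from x to y: the last vertex y sees the colour of y′ twice.
  spread-back : ∀ f → ProperOn G (_∉ L₀) f → ∀ {x M y} → Cycle G x (M ++ [ y ]) → (x ∷ M ++ [ y ]) ↭ L₀ →
                ∀ {col} → Out f y col → Out f x col
  spread-back f pf {x} {M} {y} (cycle L (x∉ ∷ _)) perm {col} (y′ , y′∉ , yy′ , fy′)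
    with Fin.any? (λ c′ → ¬? (c′ ∈ˡ? L₀) ×-dec adj? G x c′ ×-dec f c′ ≟ col)
  ... | yes out = out
  ... | no ¬out =
    let f₁ = f [ x ↦ col ]
        pf₁ = paint G {Q = _∉ M ++ [ y ]} f x col pf
          (λ a a∉ a≢x a∈ → case Perm.∈-resp-↭ (↭-sym perm) a∈ of λ where
            (here a≡x) → a≢x a≡x
            (there a∈′) → a∉ a∈′)
          (λ b b∉ xb fb → ¬out (b , (λ b∈ → case Perm.∈-resp-↭ (↭-sym perm) b∈ of λ where
            (here b≡x) → E⇒≢ G xb (sym b≡x)
            (there b∈′) → b∉ b∈′) , xb , fb))
        f₂ , pf₂ , same = paint-chain G M f₁ (linked-prefix (M ++ [ y ]) (Linked.tail L)) (here refl)
          (λ m∈ → low (Perm.∈-resp-↭ perm (there (Mem.∈-++⁺ˡ m∈)))) pf₁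
        y′≢x : y′ ≢ x
        y′≢x = λ where refl → y′∉ (Perm.∈-resp-↭ perm (here refl))
        x∉M : x ∉ M
        x∉M = λ x∈ → All.lookup x∉ (Mem.∈-++⁺ˡ x∈) refl
        f₂x = trans (same x∉M) (update-same f x col)
        f₂y′ = trans (same (λ y′∈ → y′∉ (Perm.∈-resp-↭ perm (there (Mem.∈-++⁺ˡ y′∈)))))
                 (trans (update-other f col y′≢x) fy′)
        c , pf₃ = paint-twins G {Q = λ _ → ⊤} f₂ pf₂ (low (Perm.∈-resp-↭ perm (there (Mem.∈-++⁺ʳ M (here refl)))))
          (λ a _ a≢y → λ where (here a≡y) → a≢y a≡y) (yx M L) yy′ (y′≢x ∘ sym) (trans f₂x (sym f₂y′))
    in contradiction (_ , λ a b → pf₃ a b tt tt) uncolourable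
    where
    yx : ∀ M → Linked (E G) (x ∷ (M ++ [ y ]) ++ [ x ]) → E G y x
    yx M L = linked-last (x ∷ M) (subst (λ l → Linked (E G) (x ∷ l)) (List.++-assoc M [ y ] [ x ]) L)

  walk : ∀ f → ProperOn G (_∉ L₀) f → ∀ {x} R₁ R₂ → Cycle G x (R₁ ++ R₂) → (x ∷ R₁ ++ R₂) ↭ L₀ →
         ∀ {col} → Out f x col → ∀ {c} → c ∈ R₁ → Out f c col
  walk f pf {x} (m ∷ R₁) R₂ C perm out {c} c∈ = go c∈
    where
    C′ : Cycle G m ((R₁ ++ R₂) ++ [ x ])
    C′ = rotate C
    perm′ : m ∷ (R₁ ++ R₂) ++ [ x ] ↭ L₀
    perm′ = ↭-trans (↭-sym (Perm.∷↭∷ʳ x (m ∷ R₁ ++ R₂))) perm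
    out′ : Out f m _
    out′ = spread-back f pf {M = R₁ ++ R₂} C′ perm′ out
    assoc : (R₁ ++ R₂) ++ [ x ] ≡ R₁ ++ (R₂ ++ [ x ])
    assoc = List.++-assoc R₁ R₂ [ x ]
    go : c ∈ m ∷ R₁ → Out f c _
    go (here refl) = out′
    go (there c∈)  = walk f pf R₁ (R₂ ++ [ x ]) (subst (Cycle G m) assoc C′)
                       (subst (λ l → m ∷ l ↭ L₀) assoc perm′) out′ c∈

  -- All vertices of the cycle see the same set of colours outside it.
  spread : ∀ f → ProperOn G (_∉ L₀) f → ∀ {c d col} → c ∈ L₀ → d ∈ L₀ → Out f c col → Out f d col
  spread f pf {c} {d} {col} c∈ d∈ out
    with R , C , perm ← rotate-to C₀ c∈
    with Perm.∈-resp-↭ (↭-sym perm) d∈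
  ... | here refl = out
  ... | there d∈R = walk f pf R [] (subst (Cycle G c) (sym (List.++-identityʳ R)) C)
                      (subst (λ l → c ∷ l ↭ L₀) (sym (List.++-identityʳ R)) perm) out d∈R

-- Maximal paths and graphs with at most one vertex of high degree

record LastNeighbour G (v : V G) (l : List (V G)) : Set where
  constructor lastNeighbour
  field
    {pre post} : List (V G)
    {w}   : V G
    split : l ≡ pre ++ w ∷ post
    edge  : E G v w
    final : ∀ {a} → a ∈ post → ¬ E G v a

last-neighbour : ∀ G v l → LastNeighbour G v l ⊎ (∀ {a} → a ∈ l → ¬ E G v a)
last-neighbour G v [] = inj₂ λ ()
last-neighbour G v (x ∷ l) with last-neighbour G v l
... | inj₁ (lastNeighbour refl e fin) = inj₁ (lastNeighbour {pre = x ∷ _} refl e fin)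
... | inj₂ none with adj? G v x
...   | yes vx = inj₁ (lastNeighbour {pre = []} refl vx none)
...   | no ¬vx = inj₂ λ where (here refl) → ¬vx ; (there a∈) → none a∈

record MaximalPath G (h : V G) : Set where
  field
    v       : V G
    rest    : List (V G)
    linked  : Linked (E G) (v ∷ rest)
    uniq    : Unique (v ∷ rest)
    avoids  : h ∉ v ∷ rest
    maximal : ∀ {w} → E G v w → w ≢ h → w ∈ rest

maximal-path : ∀ G h {u} → u ≢ h → MaximalPath G h
maximal-path G h {u} u≢h = go (n G) u [] [-] ([] ∷ []) (λ where (here refl) → u≢h refl) (ℕ.≤-reflexive (sym (ℕ.+-comm (n G) 1)))
  where
  go : ∀ fuel v rest → Linked (E G) (v ∷ rest) → Unique (v ∷ rest) → h ∉ v ∷ rest →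
       n G < fuel + suc (length rest) → MaximalPath G h
  go zero v rest L uniq _ short = contradiction
    (subst (suc (length rest) ≤_) (List.length-tabulate {n = n G} id)
      (unique⊆⇒≤length uniq (λ {a} _ → Mem.∈-allFin a))) (ℕ.<⇒≱ short)
  go (suc fuel) v rest L uniq h∉ short
    with Fin.any? (λ w → adj? G v w ×-dec ¬? (w ≟ h) ×-dec ¬? (w ∈ˡ? rest))
  ... | yes (w , vw , w≢h , w∉) = go fuel w (v ∷ rest) (E-sym G vw ∷ L)
          (All.tabulate (λ { (here refl) refl → E⇒≢ G vw refl ; (there a∈) refl → w∉ a∈ }) ∷ uniq)
          (λ where (here refl) → w≢h refl ; (there h∈) → h∉ h∈)
          (subst (n G <_) (sym (ℕ.+-suc fuel _)) short)
  ... | no none = record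
          { v = v ; rest = rest ; linked = L ; uniq = uniq ; avoids = h∉
          ; maximal = λ {w} vw w≢h → decidable-stable (w ∈ˡ? rest) (λ w∉ → none (w , vw , w≢h , w∉)) }

record ConeCycle (k : ℕ) G : Set where
  field
    h       : V G
    x       : V G
    R       : List (V G)
    cyc     : Cycle G x R
    apex∉   : h ∉ x ∷ R
    covers  : ∀ {v} → v ≢ h → v ∈ x ∷ R
    spokes  : ∀ {v} → v ≢ h → E G h v
    low     : ∀ {v} → v ≢ h → deg G v ≤ k

unique-prefix : ∀ {A : Set} (xs : List A) {ys} → Unique (xs ++ ys) → Unique xs
unique-prefix []       _           = []
unique-prefix (x ∷ xs) (x∉ ∷ uniq) = All.++⁻ˡ xs x∉ ∷ unique-prefix xs uniq

module OneHigh {k G} (good : Good (suc (suc k)) G) (h : V G) (low : ∀ {v} → v ≢ h → deg G v ≤ suc (suc k)) where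
  open Good good

  K : ℕ
  K = suc (suc k)

  P : MaximalPath G h
  P = maximal-path G h {proj₁ (no-isolated h)} (E⇒≢ G (proj₂ (no-isolated h)) ∘ sym)
  open MaximalPath P

  closing : LastNeighbour G v rest
  closing with last-neighbour G v rest
  ... | inj₁ found = found
  ... | inj₂ none = contradiction
          (degree≥ v [ h ] λ w vw → case w ≟ h of λ where
            (yes refl) → here refl
            (no w≢h)   → ⊥-elim (none (maximal vw w≢h) vw))
          (ℕ.<⇒≱ (s≤s (s≤s z≤n)))
  open LastNeighbour closing

  R : List (V G)
  R = pre ++ [ w ]

  L : List (V G)
  L = v ∷ R

  L++post : v ∷ rest ≡ L ++ post
  L++post = cong (v ∷_) (trans split (sym (List.++-assoc pre [ w ] post)))

  C : Cycle G v R
  C = cycle (linked-snoc (v ∷ pre) (linked-prefix L (subst (Linked (E G)) L++post linked)) (E-sym G edge))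
            (unique-prefix L (subst Unique L++post uniq))

  h∉L : h ∉ L
  h∉L h∈ = avoids (subst (h ∈_) (sym L++post) (Mem.∈-++⁺ˡ h∈))

  L⇒≢h : ∀ {c} → c ∈ L → c ≢ h
  L⇒≢h c∈ refl = h∉L c∈

  module LC = LowCycle good C (λ c∈ → low (L⇒≢h c∈))
  open LC using (Out; spread)

  -- The path is maximal and `w` is the last neighbour of `v` on it, so the cycle up to `w` contains
  -- every neighbour of `v` other than `h`.
  outer-of-v : ∀ {v′} → v′ ∉ L → E G v v′ → v′ ≡ h
  outer-of-v {v′} v′∉ vv′ = decidable-stable (v′ ≟ h) λ v′≢h →
    case Mem.∈-++⁻ L {post} (subst (v′ ∈_) L++post (there (maximal vv′ v′≢h))) of λ where
      (inj₁ v′∈)    → v′∉ v′∈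
      (inj₂ v′∈post) → final v′∈post vv′

  outer-colour : ∀ f → ProperOn G (_∉ L) f → ∀ {c c′} → c ∈ L → c′ ∉ L → E G c c′ → f c′ ≡ f h
  outer-colour f pf c∈ c′∉ cc′ with spread f pf c∈ (here refl) (_ , c′∉ , cc′ , refl)
  ... | v′ , v′∉ , vv′ , eq = trans (sym eq) (cong f (outer-of-v v′∉ vv′))

  outer : Σ (V G → Fin K) λ f → ProperOn G (_∉ L) f
  outer = side-colouring (_∉ L) {v} (λ v∉ → v∉ (here refl))

  -- By connectivity some edge leaves the cycle. The colour it sees is also seen from `v`, whose
  -- only possible outer neighbour is `h`.
  vh : E G v h
  vh with Fin.any? (λ a → Fin.any? λ b → (a ∈ˡ? L) ×-dec ¬? (b ∈ˡ? L) ×-dec adj? G a b)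
  ... | no none = contradiction
          (edge-connected (λ a → does (a ∈ˡ? L)) {v} {h} {0} (dec-true (v ∈ˡ? L) (here refl)) (dec-false (h ∈ˡ? L) h∉L)
            ([] , z≤n , λ a b (Xa , Xb , ab) →
              contradiction (a , b , dec-does (a ∈ˡ? L) Xa , dec-does-not (b ∈ˡ? L) Xb , ab) none))
          λ ()
  ... | yes (a , b , a∈ , b∉ , ab) with spread (proj₁ outer) (proj₂ outer) a∈ (here refl) (b , b∉ , ab , refl)
  ...   | v′ , v′∉ , vv′ , _ = subst (E G v) (outer-of-v v′∉ vv′) vv′

  has-outer : ∀ {c} → c ∈ L → ∃[ c′ ] c′ ∉ L × E G c c′
  has-outer c∈ with spread (proj₁ outer) (proj₂ outer) (here refl) c∈ (h , h∉L , vh , refl)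
  ... | c′ , c′∉ , cc′ , _ = c′ , c′∉ , cc′

  -- If the cycle has no outer neighbour but `h`, then `h` would cut off every vertex beyond it, and
  -- the neighbour supplied by `has-outer` is `h`.
  cone : (∀ {a b} → a ∈ L → b ∉ L → b ≢ h → ¬ E G a b) → ConeCycle K G
  cone none = record
    { h = h ; x = v ; R = R ; cyc = C ; apex∉ = h∉L ; covers = covers ; low = low
    ; spokes = λ {a} a≢h → spoke (covers a≢h) (has-outer (covers a≢h)) }
    where
    covers : ∀ {a} → a ≢ h → a ∈ L
    covers {a} a≢h = decidable-stable (a ∈ˡ? L) λ a∉ →
      no-cutvertex good h (λ b → does (b ∈ˡ? L)) {a} {v} (dec-false (h ∈ˡ? L) h∉L) (dec-true (v ∈ˡ? L) (here refl))
        (dec-false (a ∈ˡ? L) a∉) a≢h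
        λ {c} {d} Qc Qd d≢h → none (dec-does (c ∈ˡ? L) Qc) (dec-does-not (d ∈ˡ? L) Qd) d≢h
    spoke : ∀ {a} → a ∈ L → ∃[ c′ ] c′ ∉ L × E G a c′ → E G h a
    spoke {a} a∈ (c′ , c′∉ , ac′) = E-sym G (subst (E G a)
      (decidable-stable (c′ ≟ h) (λ c′≢h → none a∈ c′∉ c′≢h ac′)) ac′)

  module Component {w t} (w∈ : w ∈ L) (t∉ : t ∉ L) (t≢h : t ≢ h) (wt : E G w t) where
    Inner : V G → V G → Set
    Inner a b = a ∉ L × a ≢ h × E G a b

    inner? : ∀ a b → Dec (Inner a b)
    inner? a b = ¬? (a ∈ˡ? L) ×-dec ¬? (a ≟ h) ×-dec adj? G a b

    D : Reach Inner t
    D = reach inner? t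
    open Reach D

    inside : ∀ {b l} → SPath Inner t b l → b ∉ L × b ≢ h
    inside stop                      = t∉ , t≢h
    inside (step (a∉ , a≢h , _) _ _) = a∉ , a≢h

    S⇒inside : ∀ {b} → S b ≡ true → b ∉ L × b ≢ h
    S⇒inside Sb = inside (proj₁ (proj₂ (path Sb)))

    impossible : ∀ f → ProperOn G (_∉ L) f → ∀ {b a} → a ∈ L → b ∉ L → E G a b → f b ≢ f h → ⊥
    impossible f pf a∈ b∉ ab fb≢fh = fb≢fh (outer-colour f pf a∈ b∉ ab)

    -- Moving the uncoloured vertex along a path to t, where it disappears because t
    -- has the uncoloured neighbour w.
    shift-hole : ∀ {b s l} → SPath Inner t s l → b ∉ l → ∀ (f : V G → Fin K) → ProperOn G (λ a → a ∉ L × a ≢ s) f →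
                 ∃[ f′ ] ProperOn G (_∉ L) f′ × f′ b ≡ f b × f′ h ≡ f h
    shift-hole {b} stop b∉ f pf
      with c , pf′ ← paint-gap G {Q = _∉ L} f pf (low t≢h) (λ a a∉ a≢t → a∉ , a≢t) (E-sym G wt) (λ w∉ → w∉ w∈)
      = f [ t ↦ c ] , pf′ , update-other f c (λ b≡t → b∉ (here b≡t)) , update-other f c (t≢h ∘ sym)
    shift-hole {b} {s} (step {b = s′} (s∉ , s≢h , ss′) p _) b∉ f pf
      with c , pf₁ ← paint-gap G {Q = λ a → a ∉ L × a ≢ s′} f pf (low s≢h)
                       (λ a (a∉ , _) a≢s → a∉ , a≢s) ss′ (λ (_ , s′≢s′) → s′≢s′ refl)
      with f′ , pf′ , fb , fh ← shift-hole p (b∉ ∘ there) (f [ s ↦ c ]) pf₁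
      = f′ , pf′ , trans fb (update-other f c (λ b≡s → b∉ (here b≡s))) , trans fh (update-other f c (s≢h ∘ sym))

    -- Otherwise `b` can avoid the colour of `h`, since `a` and the next vertex `s` towards `t` are
    -- both uncoloured. The hole at `s` is then moved to `t` and filled, against `outer-colour`.
    same-end : ∀ {a b} → a ∈ L → S b ≡ true → E G a b → b ≡ t
    same-end {a} {b} a∈ Sb ab = decidable-stable (b ≟ t) λ b≢t → go b≢t (proj₁ (proj₂ (path Sb)))
      where
      f = proj₁ outer
      go : ∀ {l} → b ≢ t → SPath Inner t b l → ⊥
      go b≢t stop = b≢t refl
      go b≢t (step {b = s} {l} (b∉ , b≢h , bs) p b∉l)
        with c , c≢ , pf₁ ← paint-two-gaps G {Q = λ a → a ∉ L × a ≢ s} f (f h) (proj₂ outer) (low b≢h)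
                 (λ a (a∉ , _) _ → a∉) bs (E-sym G ab) (λ where refl → proj₁ (inside p) a∈)
                 (λ (_ , s≢s) → s≢s refl) (λ (a∉ , _) → a∉ a∈)
        with f′ , pf′ , fb , fh ← shift-hole p b∉l (f [ b ↦ c ]) pf₁
        = impossible f′ pf′ a∈ b∉ ab λ eq → c≢ (trans (sym (trans fb (update-same f b c)))
            (trans eq (trans fh (update-other f c (b≢h ∘ sym)))))

    -- With two uncoloured neighbours on the cycle, `t` could avoid the colour of `h`.
    same-start : ∀ {a} → a ∈ L → E G a t → a ≡ w
    same-start {a} a∈ at = decidable-stable (a ≟ w) λ a≢w →
      let f , pf = outer
          c , c≢ , pf₁ = paint-two-gaps G {Q = _∉ L} f (f h) pf (low t≢h) (λ a a∉ _ → a∉)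
                           (E-sym G at) (E-sym G wt) a≢w (λ a∉ → a∉ a∈) (λ w∉ → w∉ w∈)
      in impossible (f [ t ↦ c ]) pf₁ a∈ t∉ at λ eq →
           c≢ (trans (sym (update-same f t c)) (trans eq (update-other f c (t≢h ∘ sym))))

    bridge : BridgeSep G
    bridge = record
      { z = h ; p = w ; q = t ; Q = S ; Qz = outside (λ Sh → proj₂ (S⇒inside Sh) refl) ; Qq = t∈S
      ; Qp = outside (λ Sw → proj₁ (S⇒inside Sw) w∈)
      ; p≢z = L⇒≢h w∈ ; pq = wt
      ; unique = λ {a} {b} Sa a≢h Sb ab →
          let a∈ = decidable-stable (a ∈ˡ? L) (λ a∉ → true≢false (closed (a∉ , a≢h , ab) Sb) Sa)
              b≡t = same-end a∈ Sb ab
          in same-start a∈ (subst (E G a) b≡t ab) , b≡t }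
      where
      outside : ∀ {a} → ¬ (S a ≡ true) → S a ≡ false
      outside {a} ¬Sa = case true-or-false (S a) of λ where
        (inj₁ Sa) → contradiction Sa ¬Sa
        (inj₂ Sa) → Sa

  result : BridgeSep G ⊎ ConeCycle K G
  result with Fin.any? (λ a → Fin.any? λ b → (a ∈ˡ? L) ×-dec ¬? (b ∈ˡ? L) ×-dec ¬? (b ≟ h) ×-dec adj? G a b)
  ... | yes (a , b , a∈ , b∉ , b≢h , ab) = inj₁ (Component.bridge a∈ b∉ b≢h ab)
  ... | no none = inj₂ (cone λ a∈ b∉ b≢h ab → none (_ , _ , a∈ , b∉ , b≢h , ab))

-- Two high vertices

crossing : Bool → Bool → Bool → Bool
crossing e p q = e ∧ (p ∧ not q)

-- Submodularity of the cut function, one ordered pair of vertices at a time.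
crossing-submodular : ∀ e s x s′ x′ →
  bit (crossing e (s ∧ x) (s′ ∧ x′)) + bit (crossing e (s ∨ x) (s′ ∨ x′)) ≤ bit (crossing e s s′) + bit (crossing e x x′)
crossing-submodular false _     _     _     _     = z≤n
crossing-submodular true  false false _     _     = z≤n
crossing-submodular true  true  true  true  true  = z≤n
crossing-submodular true  true  true  true  false = s≤s z≤n
crossing-submodular true  true  true  false true  = s≤s z≤n
crossing-submodular true  true  true  false false = s≤s (s≤s z≤n)
crossing-submodular true  true  false true  _     = z≤n
crossing-submodular true  true  false false true  = z≤n
crossing-submodular true  true  false false false = s≤s z≤n
crossing-submodular true  false true  true  _     = z≤n
crossing-submodular true  false true  false true  = z≤n
crossing-submodular true  false true  false false = s≤s z≤n

crossing-true : ∀ {e p q} → crossing e p q ≡ true → e ≡ true × p ≡ true × q ≡ false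
crossing-true {true} {true} {false} _ = refl , refl , refl

cutSize : ∀ G → (V G → Bool) → ℕ
cutSize G X = count (λ (a , b) → crossing (adj G a b) (X a) (X b)) (pairs G)

count-submodular : ∀ G (T X : V G → Bool) →
                   cutSize G (λ a → T a ∧ X a) + cutSize G (λ a → T a ∨ X a) ≤ cutSize G T + cutSize G X
count-submodular G T X = go (pairs G)
  where
  c : (V G → Bool) → V G × V G → Bool
  c X (a , b) = crossing (adj G a b) (X a) (X b)
  T∧X T∨X : V G → Bool
  T∧X a = T a ∧ X a
  T∨X a = T a ∨ X a
  interchange : ∀ a b c d → (a + b) + (c + d) ≡ (a + c) + (b + d)
  interchange = solve 4 (λ a b c d → (a :+ b) :+ (c :+ d) := (a :+ c) :+ (b :+ d)) refl
    where open +-*-Solver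
  go : ∀ ps → count (c T∧X) ps + count (c T∨X) ps ≤ count (c T) ps + count (c X) ps
  go [] = z≤n
  go (e@(a , b) ∷ ps) = begin
    (bit (c T∧X e) + count (c T∧X) ps) + (bit (c T∨X e) + count (c T∨X) ps)
      ≡⟨ interchange (bit (c T∧X e)) (count (c T∧X) ps) (bit (c T∨X e)) (count (c T∨X) ps) ⟩
    (bit (c T∧X e) + bit (c T∨X e)) + (count (c T∧X) ps + count (c T∨X) ps)
      ≤⟨ ℕ.+-mono-≤ (crossing-submodular (adj G a b) (T a) (X a) (T b) (X b)) (go ps) ⟩
    (bit (c T e) + bit (c X e)) + (count (c T) ps + count (c X) ps)
      ≡⟨ interchange (bit (c T e)) (bit (c X e)) (count (c T) ps) (count (c X) ps) ⟩
    (bit (c T e) + count (c T) ps) + (bit (c X e) + count (c X) ps) ∎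
    where open ℕ.≤-Reasoning

trues : ∀ {A : Set} → (A → Bool) → List A → List A
trues p = filter (λ x → p x Bool.≟ true)

count≡length : ∀ {A : Set} (p : A → Bool) xs → count p xs ≡ length (trues p xs)
count≡length p [] = refl
count≡length p (x ∷ xs) with p x
... | true  = cong suc (count≡length p xs)
... | false = count≡length p xs

cutSize≤ : ∀ G X {m} → CutAtMost G X m → cutSize G X ≤ m
cutSize≤ G X {m} (L , L≤ , cov) = subst (_≤ m) (sym (count≡length c (pairs G)))
  (ℕ.≤-trans (unique⊆⇒≤length
    (Unique.filter⁺ (λ e → c e Bool.≟ true) (Unique.cartesianProduct⁺ (Unique.allFin⁺ (n G)) (Unique.allFin⁺ (n G))))
    λ {(a , b)} e∈ → let e , Xa , Xb = crossing-true (proj₂ (Mem.∈-filter⁻ (λ e → c e Bool.≟ true) {xs = pairs G} e∈))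
                      in cov a b (Xa , Xb , e)) L≤)
  where
  c : V G × V G → Bool
  c (a , b) = crossing (adj G a b) (X a) (X b)

cutSize-cut : ∀ G X → CutAtMost G X (cutSize G X)
cutSize-cut G X = trues c (pairs G) , ℕ.≤-reflexive (sym (count≡length c (pairs G))) ,
  λ a b (Xa , Xb , e) → Mem.∈-filter⁺ (λ e → c e Bool.≟ true) (∈-pairs G a b)
    (trans (cong₂ _∧_ e (cong₂ _∧_ Xa (cong not Xb))) refl)
  where
  c : V G × V G → Bool
  c (a , b) = crossing (adj G a b) (X a) (X b)

-- The union of `T` and `X` contains `u` and misses `b`, so its cut has at least `k` edges;
-- submodularity leaves at most `k` for the intersection.
uncross : ∀ {k G} → Good k G → ∀ T X {u b} → CutAtMost G T k → CutAtMost G X k →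
          T u ≡ true → T b ≡ false → X b ≡ false → CutAtMost G (λ a → T a ∧ X a) k
uncross {k} {G} good T X {u} {b} cT cX Tu Tb Xb with cutSize-cut G (λ a → T a ∧ X a)
... | L , L≤ , cov = L , ℕ.≤-trans L≤ small , cov
  where
  open Good good
  big : k ≤ cutSize G (λ a → T a ∨ X a)
  big = edge-connected (λ a → T a ∨ X a) {u} {b} (∨-introˡ (X u) Tu) (cong₂ _∨_ Tb Xb) (cutSize-cut G _)
  small : cutSize G (λ a → T a ∧ X a) ≤ k
  small = ℕ.+-cancelʳ-≤ k _ _ (ℕ.≤-trans (ℕ.+-monoʳ-≤ _ big)
    (ℕ.≤-trans (count-submodular G T X) (ℕ.+-mono-≤ (cutSize≤ G T cT) (cutSize≤ G X cX))))

count-disjoint : ∀ {A : Set} (p q : A → Bool) xs → (∀ x → p x ≡ true → q x ≡ false) →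
                 count p xs + count q xs ≤ length xs
count-disjoint p q [] _ = z≤n
count-disjoint p q (x ∷ xs) disj with p x in px | q x in qx
... | true  | true  = case trans (sym (disj x px)) qx of λ ()
... | true  | false = s≤s (count-disjoint p q xs disj)
... | false | true  = subst (_≤ suc (length xs)) (sym (ℕ.+-suc _ _)) (s≤s (count-disjoint p q xs disj))
... | false | false = ℕ.m≤n⇒m≤1+n (count-disjoint p q xs disj)

-- The cut round `Q` consists of `qp` and the edges from `Q` to `z`.
bridge-neighbours : ∀ {k G} → Good k G → (B : BridgeSep G) → k ≤ suc (count (BridgeSep.Q B) (nbrs G (BridgeSep.z B)))
bridge-neighbours {k} {G} good B = edge-connected Q {q} {p} Qq Qp
  ( (q , p) ∷ map (_, z) (trues Q (nbrs G z))
  , s≤s (ℕ.≤-reflexive (trans (List.length-map (_, z) (trues Q (nbrs G z))) (sym (count≡length Q (nbrs G z)))))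
  , cov )
  where
  open BridgeSep B
  open Good good
  cov : ∀ a b → Cross G Q a b → (a , b) ∈ (q , p) ∷ map (_, z) (trues Q (nbrs G z))
  cov a b (Qa , Qb , ab) with b ≟ z
  ... | yes refl = there (Mem.∈-map⁺ (_, z) (Mem.∈-filter⁺ (λ x → Q x Bool.≟ true) (∈-nbrs G (E-sym G ab)) Qa))
  ... | no b≢z with unique Qb b≢z Qa (E-sym G ab)
  ...   | refl , refl = here refl

-- Each side contains at least `K` - 1 neighbours of `z`, and 2(`K` - 1) exceeds `K` because `K` is
-- at least three.
bridge-apex-high : ∀ {k G} → Good (suc (suc (suc k))) G → (B : BridgeSep G) → ¬ (deg G (BridgeSep.z B) ≤ suc (suc (suc k)))
bridge-apex-high {k} {G} good B low = ℕ.<⇒≱ (ℕ.m<m+n K (s≤s (z≤n {k})))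
  (ℕ.+-cancelˡ-≤ 2 _ _ (begin
    2 + (K + suc k)                 ≡⟨ solve 1 (λ k → con 2 :+ ((con 3 :+ k) :+ (con 1 :+ k)) := (con 3 :+ k) :+ (con 3 :+ k)) refl k ⟩
    K + K                           ≤⟨ ℕ.+-mono-≤ (bridge-neighbours good B) (bridge-neighbours good (flip-bridge B)) ⟩
    suc #Q + suc #Q′                ≡⟨ cong suc (ℕ.+-suc #Q #Q′) ⟩
    2 + (#Q + #Q′)                  ≤⟨ ℕ.+-monoʳ-≤ 2 (ℕ.≤-trans (count-disjoint _ _ (nbrs G z)
                                         (λ x Qx → cong not (∨-introˡ (does (x ≟ z)) Qx))) low) ⟩
    2 + K                           ∎))
  where
  open BridgeSep B
  open ℕ.≤-Reasoning
  open +-*-Solver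
  K #Q #Q′ : ℕ
  K = suc (suc (suc k))
  #Q = count Q (nbrs G z)
  #Q′ = count (BridgeSep.Q (flip-bridge B)) (nbrs G z)

-- `X` is the one-coloured side, which is kept. The degree of `yʰ` ensures that replacing the other
-- side loses a vertex, that of `xʰ` that the smaller graph is no cone.
module TwoHigh {k G} (good : Good (suc (suc (suc k))) G) (X : V G → Bool)
  (cutX : CutAtMost G X (suc (suc (suc k))))
  {xʰ yʰ : V G} (Xx : X xʰ ≡ true) (Xy : X yʰ ≡ false)
  (high-x : suc (suc (suc k)) < deg G xʰ) (high-y : suc (suc (suc k)) < deg G yʰ)
  (f₀ g₀ : V G → Fin (suc (suc (suc k))))
  (pf₀ : ProperOn G (λ a → X a ≡ true) f₀) (pg₀ : ProperOn G (λ a → X a ≡ false) g₀)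
  (mono₀ : Mono G X f₀) (rainbow₀ : Rainbow G X g₀) (star : ColourStar G X f₀ g₀) where
  open Good good

  K : ℕ
  K = suc (suc (suc k))

  open ColourStar star using (x; y; cross; edge-inj)

  enum : ∀ {a b} → Cross G X a b → ∃[ j ] x j ≡ a × y j ≡ b
  enum = StarCut.enumerates G star cutX

  distinct : ¬ ((x zero , y zero) ≡ (x (suc zero) , y (suc zero)))
  distinct eq = case edge-inj zero (suc zero) eq of λ ()

  -- The other case of the dichotomy would give the far ends one colour under `g₀`, against
  -- `rainbow₀`, as there are at least two crossing edges.
  monoX : ∀ f → ProperOn G (λ a → X a ≡ true) f → Mono G X f
  monoX f pf with StarCut.dichotomy G (colourStar G X f g₀ uncolourable pf pg₀) uncolourable pf pg₀ cutX
  ... | inj₁ (mono , _) = mono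
  ... | inj₂ (mono , _) = λ _ _ → ⊥-elim (distinct (uncurry (cong₂ _,_)
          (rainbow₀ (cross zero) (cross (suc zero)) (mono (not-cross G X (cross zero)) (not-cross G X (cross (suc zero)))))))

  rainbowY : ∀ g → ProperOn G (λ a → X a ≡ false) g → Rainbow G X g
  rainbowY g pg with StarCut.dichotomy G (colourStar G X f₀ g uncolourable pf₀ pg) uncolourable pf₀ pg cutX
  ... | inj₁ (_ , rainbow) = rainbow
  ... | inj₂ (_ , rainbow) = λ _ _ → ⊥-elim (distinct (uncurry (cong₂ _,_)
          (swap (rainbow (not-cross G X (cross zero)) (not-cross G X (cross (suc zero))) (mono₀ (cross zero) (cross (suc zero)))))))

  y-inj : ∀ i j → y i ≡ y j → i ≡ j
  y-inj i j eq with rainbow₀ (cross i) (cross j) (cong g₀ eq)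
  ... | p , q = edge-inj i j (cong₂ _,_ p q)

  Xyⱼ : ∀ j → X (y j) ≡ false
  Xyⱼ j = proj₁ (proj₂ (cross j))

  end? : ∀ b → Dec (∃[ j ] y j ≡ b)
  end? b = Fin.any? (λ j → y j ≟ b)

  S : V G → Bool
  S a = X a ∨ does (end? a)

  S-elim : ∀ {a} → S a ≡ true → X a ≡ false → ∃[ j ] y j ≡ a
  S-elim {a} Sa Xa with ∨-elim (X a) Sa
  ... | inj₁ Xa′ = true≢false Xa′ Xa
  ... | inj₂ e   = dec-does (end? a) e

  S-X : ∀ {a} → X a ≡ true → S a ≡ true
  S-X = ∨-introˡ _

  S-y : ∀ j → S (y j) ≡ true
  S-y j = ∨-introʳ (X (y j)) (dec-true (end? (y j)) (j , refl))

  -- Any two distinct vertices off `X` are adjacent. Of these `S` keeps only the ends of the cut,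
  -- which thus form a clique.
  A : V G → V G → Bool
  A a b = if X a ∨ X b then adj G a b else not (does (a ≟ b))

  A-sym : ∀ a b → A a b ≡ A b a
  A-sym a b rewrite Bool.∨-comm (X a) (X b) | Graph.sym G a b | does-cong (a ≟ b) (b ≟ a) sym sym = refl

  A-irrefl : ∀ a → A a a ≡ false
  A-irrefl a with X a
  ... | true  = irrefl G a
  ... | false = cong not (dec-true (a ≟ a) refl)

  A-X : ∀ {a b} → X a ≡ true ⊎ X b ≡ true → A a b ≡ adj G a b
  A-X {a} {b} (inj₁ Xa) rewrite Xa = refl
  A-X {a} {b} (inj₂ Xb) rewrite Xb | Bool.∨-zeroʳ (X a) = refl

  A-Y : ∀ {a b} → X a ≡ false → X b ≡ false → A a b ≡ not (does (a ≟ b))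
  A-Y Xa Xb rewrite Xa | Xb = refl

  clique : ∀ {a b} → X a ≡ false → X b ≡ false → a ≢ b → A a b ≡ true
  clique {a} {b} Xa Xb a≢b = trans (A-Y Xa Xb) (cong not (dec-false (a ≟ b) a≢b))

  ends-differ : ∀ g → ProperOn G (λ a → X a ≡ false) g → ∀ i j → g (y i) ≡ g (y j) → y i ≡ y j
  ends-differ g pg i j eq = proj₂ (rainbowY g pg (cross i) (cross j) eq)

  data Ends (a b : V G) : Set where
    left  : X a ≡ true → E G a b → Ends a b
    right : X a ≡ false → X b ≡ true → E G a b → Ends a b
    both  : ∀ i j → y i ≡ a → y j ≡ b → a ≢ b → Ends a b

  ends : ∀ a b → S a ≡ true → S b ≡ true → A a b ≡ true → Ends a b
  ends a b Sa Sb Aab = go (true-or-false (X a)) (true-or-false (X b))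
    where
    go : X a ≡ true ⊎ X a ≡ false → X b ≡ true ⊎ X b ≡ false → Ends a b
    go (inj₁ Xa) _         = left Xa (trans (sym (A-X (inj₁ Xa))) Aab)
    go (inj₂ Xa) (inj₁ Xb) = right Xa Xb (trans (sym (A-X (inj₂ Xb))) Aab)
    go (inj₂ Xa) (inj₂ Xb) = let i , yi = S-elim Sa Xa ; j , yj = S-elim Sb Xb in
      both i j yi yj λ where
        refl → true≢false (dec-true (a ≟ a) refl) (Bool.not-injective (trans (sym (A-Y Xa Xb)) Aab))

  -- The neighbours of `y j` in the smaller graph: one vertex of `X` and the `K` - 1 other ends.
  N : Fin K → List (V G)
  N j = x j ∷ map y (without j (allFin K))

  N≤ : ∀ j → length (N j) ≤ K
  N≤ j = subst₂ (λ l m → suc l ≤ m) (sym (List.length-map y (without j (allFin K)))) (List.length-tabulate {n = K} id)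
           (length-without (Mem.∈-allFin j))

  N-X : ∀ j {b} → X b ≡ true → E G (y j) b → b ∈ N j
  N-X j {b} Xb e with enum (Xb , Xyⱼ j , E-sym G e)
  ... | i , xi≡b , yi≡yj = here (trans (sym xi≡b) (cong x (y-inj i j yi≡yj)))

  N-Y : ∀ j i → y j ≢ y i → y i ∈ N j
  N-Y j i ≢ = there (Mem.∈-map⁺ y (∈-without (Mem.∈-allFin i) λ i≡j → ≢ (sym (cong y i≡j))))

  -- The `K` ends carry all `K` colours. Let `y i` be the one with the common colour of the ends in
  -- `X`; once it is recoloured like `y j`, that colour is gone from the far ends and no crossing
  -- edge is in conflict.
  colour-clique-edge : ∀ i j → y i ≢ y j → Σ (V G → Fin K) λ f →
    ∀ a b → S a ≡ true → S b ≡ true → A a b ≡ true → ¬ SameEdge a b (y i) (y j) → f a ≢ f b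
  colour-clique-edge i j yi≢yj = c , λ a b Sa Sb Aab ¬same → ok (ends a b Sa Sb Aab) Sa Sb ¬same
    where
    π : Fin K → Fin K
    π = transpose (g₀ (y i)) (f₀ (x i))
    g : V G → Fin K
    g = π ∘ g₀
    pg : ProperOn G (λ a → X a ≡ false) g
    pg = permute-proper G (g₀ (y i)) (f₀ (x i)) pg₀
    g-yi : g (y i) ≡ f₀ (x i)
    g-yi = transpose-fst (g₀ (y i)) (f₀ (x i))
    g′ : V G → Fin K
    g′ = g [ y i ↦ g (y j) ]
    c : V G → Fin K
    c a = if X a then f₀ a else g′ a
    c-X : ∀ {a} → X a ≡ true → c a ≡ f₀ a
    c-X {a} Xa = cong (λ b → if b then f₀ a else g′ a) Xa
    c-y : ∀ l → c (y l) ≡ g′ (y l)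
    c-y l = cong (λ b → if b then f₀ (y l) else g′ (y l)) (Xyⱼ l)
    g′≢ : ∀ l → g′ (y l) ≢ g (y i)
    g′≢ l eq with y l ≟ y i
    ... | yes _  = yi≢yj (sym (ends-differ g pg j i eq))
    ... | no yl≢ = yl≢ (ends-differ g pg l i eq)
    crossed : ∀ {a} l → X a ≡ true → E G a (y l) → c a ≢ c (y l)
    crossed {a} l Xa e eq = g′≢ l (trans (sym (c-y l)) (trans (sym eq)
      (trans (c-X Xa) (trans (mono₀ (Xa , Xyⱼ l , e) (cross i)) (sym g-yi)))))
    inner : ∀ l m → y l ≢ y m → ¬ SameEdge (y l) (y m) (y i) (y j) → g′ (y l) ≢ g′ (y m)
    inner l m l≢m ¬same eq with y l ≟ y i | y m ≟ y i
    ... | yes p | yes q = l≢m (trans p (sym q))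
    ... | yes p | no _  = ¬same (inj₁ (p , sym (ends-differ g pg j m eq)))
    ... | no _  | yes q = ¬same (inj₂ (ends-differ g pg l j eq , q))
    ... | no _  | no _  = l≢m (ends-differ g pg l m eq)
    ok : ∀ {a b} → Ends a b → S a ≡ true → S b ≡ true → ¬ SameEdge a b (y i) (y j) → c a ≢ c b
    ok {a} {b} (left Xa e) Sa Sb ¬same eq = case true-or-false (X b) of λ where
      (inj₁ Xb) → pf₀ a b Xa Xb e (trans (sym (c-X Xa)) (trans eq (c-X Xb)))
      (inj₂ Xb) → case S-elim Sb Xb of λ where (l , refl) → crossed l Xa e eq
    ok (right Xa Xb e) Sa Sb ¬same eq = case S-elim Sa Xa of λ where
      (l , refl) → crossed l Xb (E-sym G e) (sym eq)
    ok (both l m refl refl l≢m) Sa Sb ¬same eq = inner l m l≢m ¬same (trans (sym (c-y l)) (trans eq (c-y m)))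

  cutOn-inside : ∀ W → (∀ {a} → W a ≡ true → X a ≡ true) → CutAtMost G W K → CutOn S A W K
  cutOn-inside W W⊆X (L , L≤ , cov) = L , L≤ , λ a b _ _ Wa Wb Aab →
    cov a b (Wa , Wb , trans (sym (A-X (inj₁ (W⊆X Wa)))) Aab)

  cutOn-end : ∀ j → CutOn S A (λ a → does (a ≟ y j)) K
  cutOn-end j = map (y j ,_) (N j) , length-map≤ (y j ,_) (N j) (N≤ j) , cov
    where
    cov : ∀ a b → S a ≡ true → S b ≡ true → does (a ≟ y j) ≡ true → does (b ≟ y j) ≡ false → A a b ≡ true →
          (a , b) ∈ map (y j ,_) (N j)
    cov a b Sa Sb Wa _ Aab with dec-does (a ≟ y j) Wa
    ... | refl with ends (y j) b Sa Sb Aab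
    ...   | left Xa _               = true≢false Xa (Xyⱼ j)
    ...   | right _ Xb e            = Mem.∈-map⁺ (y j ,_) (N-X j Xb e)
    ...   | both _ i _ refl yj≢yi   = Mem.∈-map⁺ (y j ,_) (N-Y j i yj≢yi)

  -- A cut of `G` may divide the replaced side. The side of `T` that avoids `yʰ` is intersected with
  -- `X`; at vertices of `X` both graphs have the same edges.
  cut-inside : ∀ u v → X u ≡ true → X v ≡ true → u ≢ v → ∃[ W ] W u ≡ true × W v ≡ false × CutOn S A W K
  cut-inside u v Xu Xv u≢v with cut u v u≢v
  ... | T , Tu , Tv , c with T yʰ in Ty
  ...   | false = (λ a → T a ∧ X a) , cong₂ _∧_ Tu Xu , cong (_∧ X v) Tv ,
            cutOn-inside (λ a → T a ∧ X a) (λ {a} → Bool.∧-conicalʳ (T a) (X a)) (uncross good T X {u} {yʰ} c cutX Tu Ty Xy)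
  ...   | true = (λ a → not (not (T a) ∧ X a)) ,
            cong not (cong (λ b → not b ∧ X u) Tu) , cong not (cong₂ (λ b c → not b ∧ c) Tv Xv) ,
            cutOn-not A-sym (λ a → not (T a) ∧ X a) (cutOn-inside (λ a → not (T a) ∧ X a) (λ {a} → Bool.∧-conicalʳ (not (T a)) (X a))
              (uncross good (not ∘ T) X {v} {yʰ} (cutAtMost-not G T c) cutX (cong not Tv) (cong not Ty) Xy))

  goodOn : GoodOn K S A
  goodOn = record { uncolourable = uncol ; edge-critical = crit ; no-isolated = nbr ; cut = cut′ }
    where
    uncol : ∀ (f : V G → Fin K) → ¬ (∀ a b → S a ≡ true → S b ≡ true → A a b ≡ true → f a ≢ f b)
    uncol f proper
      -- The clique on `K` ends uses all `K` colours, among them the common colour of the ends in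
      -- `X`.
      with j , fyj ← injective⇒surjective (f ∘ y) (λ i j eq → decidable-stable (i ≟ j) λ i≢j →
             proper (y i) (y j) (S-y i) (S-y j) (clique (Xyⱼ i) (Xyⱼ j) (i≢j ∘ y-inj i j)) eq) (f (x zero))
      = proper (x j) (y j) (S-X (proj₁ (cross j))) (S-y j)
          (trans (A-X (inj₁ (proj₁ (cross j)))) (proj₂ (proj₂ (cross j))))
          (trans (monoX f (λ a b Xa Xb ab → proper a b (S-X Xa) (S-X Xb) (trans (A-X (inj₁ Xa)) ab)) (cross j) (cross zero))
                 (sym fyj))
    old : ∀ u v → E G u v → X u ≡ true ⊎ X v ≡ true → Σ (V G → Fin K) λ f →
          ∀ a b → S a ≡ true → S b ≡ true → A a b ≡ true → ¬ SameEdge a b u v → f a ≢ f b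
    old u v uv Xuv with edge-critical u v uv
    ... | f , proper = f , λ a b Sa Sb Aab ¬same → case ends a b Sa Sb Aab of λ where
        (left _ ab)    → proper a b ab ¬same
        (right _ _ ab) → proper a b ab ¬same
        (both i j refl refl yi≢yj) → yi≢yj ∘ ends-differ f (λ a b Xa Xb ab → proper a b ab (missed Xuv Xa Xb)) i j
      where
      missed : ∀ {a b} → X u ≡ true ⊎ X v ≡ true → X a ≡ false → X b ≡ false → ¬ SameEdge a b u v
      missed (inj₁ Xu) Xa Xb (inj₁ (refl , refl)) = true≢false Xu Xa
      missed (inj₁ Xu) Xa Xb (inj₂ (refl , refl)) = true≢false Xu Xb
      missed (inj₂ Xv) Xa Xb (inj₁ (refl , refl)) = true≢false Xv Xb
      missed (inj₂ Xv) Xa Xb (inj₂ (refl , refl)) = true≢false Xv Xa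
    crit : ∀ u v → S u ≡ true → S v ≡ true → A u v ≡ true → Σ (V G → Fin K) λ f →
           ∀ a b → S a ≡ true → S b ≡ true → A a b ≡ true → ¬ SameEdge a b u v → f a ≢ f b
    crit u v Su Sv Auv with ends u v Su Sv Auv
    ... | left Xu uv            = old u v uv (inj₁ Xu)
    ... | right _ Xv uv         = old u v uv (inj₂ Xv)
    ... | both i j refl refl ≢  = colour-clique-edge i j ≢
    nbr : ∀ u → S u ≡ true → ∃[ v ] S v ≡ true × A u v ≡ true
    nbr u Su = case true-or-false (X u) of λ where
      (inj₁ Xu) → let v , uv = no-isolated u in
        v , (case true-or-false (X v) of λ where
               (inj₁ Xv) → S-X Xv
               (inj₂ Xv) → let j , _ , yj≡v = enum (Xu , Xv , uv) in subst (λ b → S b ≡ true) yj≡v (S-y j))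
          , trans (A-X (inj₁ Xu)) uv
      (inj₂ Xu) → let j , yj≡u = S-elim Su Xu in
        x j , S-X (proj₁ (cross j)) ,
        trans (A-X (inj₂ (proj₁ (cross j)))) (subst (λ b → E G b (x j)) yj≡u (E-sym G (proj₂ (proj₂ (cross j)))))
    cut′ : ∀ u v → S u ≡ true → S v ≡ true → u ≢ v → ∃[ W ] W u ≡ true × W v ≡ false × CutOn S A W K
    cut′ u v Su Sv u≢v = case true-or-false (X u) of λ where
      (inj₂ Xu) → case S-elim Su Xu of λ where
        (j , refl) → (λ a → does (a ≟ y j)) , dec-true (y j ≟ y j) refl , dec-false (v ≟ y j) (u≢v ∘ sym) , cutOn-end j
      (inj₁ Xu) → case true-or-false (X v) of λ where
        (inj₂ Xv) → case S-elim Sv Xv of λ where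
          (j , refl) → (λ a → not (does (a ≟ y j))) , cong not (dec-false (u ≟ y j) u≢v) , cong not (dec-true (y j ≟ y j) refl) ,
                       cutOn-not A-sym (λ a → does (a ≟ y j)) (cutOn-end j)
        (inj₁ Xv) → cut-inside u v Xu Xv u≢v

  open Restrict S

  H : Graph
  H = restrict A A-sym A-irrefl

  goodH : Good K H
  goodH = restrict-good S A A-sym A-irrefl goodOn

  smaller : n H < n G
  smaller with Fin.any? (λ b → S b Bool.≟ false)
  ... | yes (b , Sb) = size< Sb
  ... | no none = contradiction high-y (ℕ.≤⇒≯ low)
    where
    all : ∀ b → S b ≡ true
    all b = case true-or-false (S b) of λ where
      (inj₁ Sb) → Sb
      (inj₂ Sb) → contradiction (b , Sb) none
    low : deg G yʰ ≤ K
    low with S-elim (all yʰ) Xy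
    ... | j , refl = ℕ.≤-trans (deg≤ G (y j) (N j) λ b e → case true-or-false (X b) of λ where
            (inj₁ Xb) → N-X j Xb e
            (inj₂ Xb) → case S-elim (all b) Xb of λ where (i , refl) → N-Y j i (E⇒≢ G e)) (N≤ j)

  yᵢ : Fin K → V H
  yᵢ j = proj₁ (ι-onto (S-y j))
  ιy : ∀ j → ι (yᵢ j) ≡ y j
  ιy j = proj₂ (ι-onto (S-y j))

  xᵢ : V H
  xᵢ = proj₁ (ι-onto (S-X Xx))
  ιx : ι xᵢ ≡ xʰ
  ιx = proj₂ (ι-onto (S-X Xx))

  S-nbr : ∀ {a b} → X a ≡ true → E G a b → S b ≡ true
  S-nbr {a} {b} Xa ab = case true-or-false (X b) of λ where
    (inj₁ Xb) → S-X Xb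
    (inj₂ Xb) → let j , _ , yj≡b = enum (Xa , Xb , ab) in subst (λ c → S c ≡ true) yj≡b (S-y j)

  high-xᵢ : K < deg H xᵢ
  high-xᵢ = ℕ.<-≤-trans high-x (subst (deg G xʰ ≤_) (List.length-map ι (nbrs H xᵢ))
    (deg≤ G xʰ (map ι (nbrs H xᵢ)) λ b e → let i , ιi≡b = ι-onto (S-nbr Xx e) in
      subst (_∈ map ι (nbrs H xᵢ)) ιi≡b (Mem.∈-map⁺ ι (∈-nbrs H
        (trans (A-X (inj₁ (trans (cong X ιx) Xx))) (subst (λ a → E G a (ι i)) (sym ιx) (subst (E G xʰ) (sym ιi≡b) e)))))))

  -- The apex could only be `xʰ`, whose degree stays high. It would be adjacent to all far ends, so
  -- every crossing edge would start at it. Then it is a cut vertex of `G`, or it has no neighbour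
  -- in `X` and degree at most `K`.
  ¬cone : ¬ ConeCycle K H
  ¬cone cone = escape (Fin.any? (λ a → adj? G xʰ a ×-dec X a Bool.≟ true))
    where
    open ConeCycle cone using (h; low; spokes)
    xᵢ≡h : xᵢ ≡ h
    xᵢ≡h = decidable-stable (xᵢ ≟ h) λ ≢ → ℕ.<⇒≱ high-xᵢ (low ≢)
    yᵢ≢h : ∀ j → yᵢ j ≢ h
    yᵢ≢h j eq = true≢false (trans (cong X (trans (cong ι (trans eq (sym xᵢ≡h))) ιx)) Xx)
                  (trans (cong X (ιy j)) (Xyⱼ j))
    spoke : ∀ j → A (ι h) (ι (yᵢ j)) ≡ true
    spoke j = spokes (yᵢ≢h j)
    xy : ∀ j → A xʰ (y j) ≡ true
    xy j = subst₂ (λ a b → A a b ≡ true) (trans (cong ι (sym xᵢ≡h)) ιx) (ιy j) (spoke j)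
    all-x : ∀ j → x j ≡ xʰ
    all-x j = let i , xi≡ , yi≡ = enum {xʰ} {y j} (Xx , Xyⱼ j , trans (sym (A-X (inj₁ Xx))) (xy j))
              in trans (cong x (sym (y-inj i j yi≡))) xi≡
    escape : Dec (∃[ a ] E G xʰ a × X a ≡ true) → ⊥
    escape (yes (a , e , Xa)) = no-cutvertex good xʰ (λ b → X b ∧ not (does (b ≟ xʰ))) {yʰ} {a}
      (trans (cong (X xʰ ∧_) (cong not (dec-true (xʰ ≟ xʰ) refl))) (Bool.∧-zeroʳ (X xʰ)))
      (cong₂ _∧_ Xa (cong not (dec-false (a ≟ xʰ) (E⇒≢ G e ∘ sym)))) (cong (_∧ _) Xy)
      (λ where refl → true≢false Xx Xy)
      λ {c} {d} Qc Qd d≢ cd → case true-or-false (X d) of λ where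
        (inj₁ Xd) → true≢false (cong₂ _∧_ Xd (cong not (dec-false (d ≟ xʰ) d≢))) Qd
        (inj₂ Xd) → let i , xi≡c , _ = enum (Bool.∧-conicalˡ (X c) _ Qc , Xd , cd) in
          dec-does-not (c ≟ xʰ) (Bool.not-injective (Bool.∧-conicalʳ (X c) _ Qc)) (trans (sym xi≡c) (all-x i))
    escape (no none) = ℕ.<⇒≱ high-x (subst (deg G xʰ ≤_)
      (trans (List.length-map y (allFin K)) (List.length-tabulate {n = K} id))
      (deg≤ G xʰ (map y (allFin K)) λ b e → case true-or-false (X b) of λ where
        (inj₁ Xb) → contradiction (b , e , Xb) none
        (inj₂ Xb) → let j , _ , yj≡b = enum (Xx , Xb , e) in
          subst (_∈ map y (allFin K)) yj≡b (Mem.∈-map⁺ y (Mem.∈-allFin j))))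

  -- The ends of the cut have degree at most `K` in `H`, the apex of a bridge separation has more.
  apex-inside : (B : BridgeSep H) → X (ι (BridgeSep.z B)) ≡ true
  apex-inside B = case true-or-false (X (ι z)) of λ where
      (inj₁ Xz) → Xz
      (inj₂ Xz) → let j , yj≡z = S-elim (ι∈ z) Xz in
        ⊥-elim (bridge-apex-high goodH B (ℕ.≤-trans
          (deg≤ H z (map (extend z id) (N j)) λ b e →
            subst (_∈ map (extend z id) (N j)) (extend-ι z id b) (Mem.∈-map⁺ (extend z id)
              (case ends (ι z) (ι b) (ι∈ z) (ι∈ b) e of λ where
                (left Xa _)           → true≢false Xa Xz
                (right _ Xb e)        → N-X j Xb (subst (λ a → E G a (ι b)) (sym yj≡z) e)
                (both _ i _ yi≡b z≢b) → subst (_∈ N j) yi≡b (N-Y j i (λ eq → z≢b (trans (sym yj≡z) (trans eq yi≡b)))))))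
          (length-map≤ (extend z id) (N j) (N≤ j))))
    where open BridgeSep B

  -- Without ends of the cut `Q` lies in `X`, where adjacency is that of `G`. The default `false`
  -- puts the vertices outside `H` on the other side.
  pull-back : (B : BridgeSep H) → (∀ j → BridgeSep.Q B (yᵢ j) ≡ false) → BridgeSep G
  pull-back B y∉Q = record
    { z = ι z ; p = ι p ; q = ι q ; Q = Q̂
    ; Qz = trans (extend-ι false Q z) Qz ; Qq = trans (extend-ι false Q q) Qq ; Qp = trans (extend-ι false Q p) Qp
    ; p≢z = p≢z ∘ ι-inj p z
    ; pq = trans (sym (A-X (inj₂ (Q⇒X q Qq)))) pq
    ; unique = uniq }
    where
    open BridgeSep B
    Q̂ : V G → Bool
    Q̂ = extend false Q
    Q⇒X : ∀ i → Q i ≡ true → X (ι i) ≡ true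
    Q⇒X i Qi = case true-or-false (X (ι i)) of λ where
      (inj₁ Xi) → Xi
      (inj₂ Xi) → let j , yj≡ = S-elim (ι∈ i) Xi in
        (true≢false (trans (cong Q (ι-inj (yᵢ j) i (trans (ιy j) yj≡))) Qi) (y∉Q j))
    Q̂-elim : ∀ {b} → Q̂ b ≡ true → ∃[ i ] ι i ≡ b × Q i ≡ true
    Q̂-elim {b} Qb with Fin.any? (λ i → ι i ≟ b)
    ... | yes (i , eq) = i , eq , Qb
    uniq : ∀ {a b} → Q̂ a ≡ false → a ≢ ι z → Q̂ b ≡ true → E G a b → a ≡ ι p × b ≡ ι q
    uniq {a} {b} Qa a≢z Qb ab with Q̂-elim Qb
    ... | j , refl , Qj with ι-onto (S-nbr (Q⇒X j Qj) (E-sym G ab))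
    ...   | i , refl with unique (trans (sym (extend-ι false Q i)) Qa) (λ where refl → a≢z refl) Qj
                           (trans (A-X (inj₂ (Q⇒X j Qj))) ab)
    ...     | refl , refl = refl , refl

  -- The clique on the ends lies on one side of the separation: two of its three
  -- or more vertices on one side and one on the other give two crossing edges.
  lift-bridge : BridgeSep H → BridgeSep G
  lift-bridge B with Fin.any? (λ j → Q (yᵢ j) Bool.≟ true) | Fin.any? (λ j → Q (yᵢ j) Bool.≟ false)
    where open BridgeSep B
  ... | no none | _ = pull-back B λ j → case true-or-false (Q (yᵢ j)) of λ where
          (inj₁ Qj) → contradiction (j , Qj) none
          (inj₂ Qj) → Qj
    where open BridgeSep B
  ... | yes _ | no none = pull-back (flip-bridge B) λ j → case true-or-false (Q (yᵢ j)) of λ where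
          (inj₁ Qj) → cong not (∨-introˡ (does (yᵢ j ≟ z)) Qj)
          (inj₂ Qj) → contradiction (j , Qj) none
    where open BridgeSep B
  ... | yes (b , Qb) | yes (a , Qa) = ⊥-elim (split (true-or-false (Q (yᵢ c))))
    where
    open BridgeSep B
    c = proj₁ (freshColour (a ∷ b ∷ []) (s≤s (s≤s (s≤s z≤n))))
    c∉ : c ∉ a ∷ b ∷ []
    c∉ = proj₂ (freshColour (a ∷ b ∷ []) (s≤s (s≤s (s≤s z≤n))))
    yᵢ≢z : ∀ j → yᵢ j ≢ z
    yᵢ≢z j refl = true≢false (apex-inside B) (trans (cong X (ιy j)) (Xyⱼ j))
    yᵢ-inj : ∀ i j → yᵢ i ≡ yᵢ j → i ≡ j
    yᵢ-inj i j eq = y-inj i j (trans (sym (ιy i)) (trans (cong ι eq) (ιy j)))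
    edge : ∀ {i j} → i ≢ j → E H (yᵢ i) (yᵢ j)
    edge {i} {j} i≢j = clique (trans (cong X (ιy i)) (Xyⱼ i)) (trans (cong X (ιy j)) (Xyⱼ j))
      (i≢j ∘ yᵢ-inj i j ∘ ι-inj _ _)
    a≢b : a ≢ b
    a≢b refl = true≢false Qb Qa
    ab : yᵢ a ≡ p × yᵢ b ≡ q
    ab = unique Qa (yᵢ≢z a) Qb (edge a≢b)
    split : Q (yᵢ c) ≡ true ⊎ Q (yᵢ c) ≡ false → ⊥
    split (inj₁ Qc) = c∉ (there (here (yᵢ-inj c b (trans (proj₂ (unique Qa (yᵢ≢z a) Qc (edge (λ eq → c∉ (here (sym eq))))))
                        (sym (proj₂ ab))))))
    split (inj₂ Qc) = c∉ (here (yᵢ-inj c a (trans (proj₁ (unique Qc (yᵢ≢z c) Qb (edge (λ eq → c∉ (there (here eq))))))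
                        (sym (proj₁ ab)))))

  result : (∀ H → n H < n G → Good K H → BridgeSep H ⊎ ConeCycle K H) → BridgeSep G
  result ih with ih H smaller goodH
  ... | inj₁ B    = lift-bridge B
  ... | inj₂ cone = contradiction cone ¬cone

structure : ∀ {k G} → Good (suc (suc (suc k))) G → BridgeSep G ⊎ ConeCycle (suc (suc (suc k))) G
structure {k} {G} = go G (<-wellFounded (n G))
  where
  K : ℕ
  K = suc (suc (suc k))
  go : ∀ G → Acc _<_ (n G) → Good K G → BridgeSep G ⊎ ConeCycle K G
  go G (acc rec) good
    with Fin.any? (λ u → Fin.any? λ v → ¬? (u ≟ v) ×-dec (K ℕ.<? deg G u) ×-dec (K ℕ.<? deg G v))
       | Fin.any? (λ u → K ℕ.<? deg G u)
  ... | no none | yes (h , high) = OneHigh.result good h λ {v} v≢h →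
          ℕ.≮⇒≥ λ high′ → none (v , h , v≢h , high′ , high)
  -- Without a high vertex any vertex can serve as `h`.
  ... | no _ | no none = case Fin.any? (λ (_ : V G) → yes tt) of λ where
          (no empty)    → contradiction ((λ v → contradiction (v , tt) empty) , λ v → contradiction (v , tt) empty)
                            (Good.uncolourable good)
          (yes (h , _)) → OneHigh.result good h λ {v} _ → ℕ.≮⇒≥ λ high → none (v , high)
  ... | yes (u , v , u≢v , high-u , high-v) | _ = inj₁ (two (Good.cut good u v u≢v))
    where
    open Good good
    ih : ∀ H → n H < n G → Good K H → BridgeSep H ⊎ ConeCycle K H
    ih H H<G = go H (rec H<G)
    two : (∃[ X ] X u ≡ true × X v ≡ false × CutAtMost G X K) → BridgeSep G
    two (X , Xu , Xv , c) with side-colouring (λ a → X a ≡ true) {v} (λ Xv′ → true≢false Xv′ Xv)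
                             | side-colouring (λ a → X a ≡ false) {u} (true≢false Xu)
    ... | f , pf | g , pg with StarCut.dichotomy G (colourStar G X f g uncolourable pf pg) uncolourable pf pg c
    ...   | inj₁ (mono , rainbow) =
              TwoHigh.result good X c Xu Xv high-u high-v f g pf pg mono rainbow
                (colourStar G X f g uncolourable pf pg) ih
    ...   | inj₂ (mono , rainbow) =
              TwoHigh.result good (not ∘ X) (cutAtMost-not G X c) (cong not Xv) (cong not Xu) high-v high-u g f pg′ pf′
                mono rainbow (colourStar G (not ∘ X) g f uncolourable pg′ pf′) ih
      where
      pg′ : ProperOn G (λ a → not (X a) ≡ true) g
      pg′ a b Xa Xb = pg a b (Bool.not-injective Xa) (Bool.not-injective Xb)
      pf′ : ProperOn G (λ a → not (X a) ≡ false) f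
      pf′ a b Xa Xb = pf a b (Bool.not-injective Xa) (Bool.not-injective Xb)

-- Cones over Hamiltonian cycles

linked-suffix : ∀ {A : Set} {R : A → A → Set} xs {ys} → Linked R (xs ++ ys) → Linked R ys
linked-suffix []       L = L
linked-suffix (x ∷ xs) L = linked-suffix xs (Linked.tail L)

-- The chain is painted from its far end towards `v`, so each vertex has an uncoloured predecessor;
-- for `v` this is `u`.
paint-back : ∀ G {k} M {v T u} (f : V G → Fin k) → Linked (E G) (v ∷ M) → u ∈ T → E G v u →
             (∀ {m} → m ∈ v ∷ M → deg G m ≤ k) → ProperOn G (_∉ (v ∷ M) ++ T) f →
             ∃[ f′ ] ProperOn G (_∉ T) f′ × (∀ {w} → w ∉ v ∷ M → f′ w ≡ f w)
paint-back G [] {v} {T} f _ u∈ vu low pf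
  with c , pf′ ← paint-gap G {Q = _∉ T} f pf (low (here refl))
         (λ a a∉ a≢v → λ where (here a≡v) → a≢v a≡v ; (there a∈) → a∉ a∈) vu (λ u∉ → u∉ u∈)
  = f [ v ↦ c ] , pf′ , λ w∉ → update-other f c (w∉ ∘ here)
paint-back G (m ∷ M) {v} {T} f (vm ∷ L) u∈ vu low pf
  with f₁ , pf₁ , same ← paint-back G M {m} {v ∷ T} f L (here refl) (E-sym G vm) (low ∘ there)
         (λ a b a∉ b∉ → pf a b (a∉ ∘ Perm.∈-resp-↭ (↭-sym (Perm.shift v (m ∷ M) T)))
                              (b∉ ∘ Perm.∈-resp-↭ (↭-sym (Perm.shift v (m ∷ M) T))))
  with c , pf′ ← paint-gap G {Q = _∉ T} f₁ pf₁ (low (here refl))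
         (λ a a∉ a≢v → λ where (here a≡v) → a≢v a≡v ; (there a∈) → a∉ a∈) vu (λ u∉ → u∉ u∈)
  = f₁ [ v ↦ c ] , pf′ , λ w∉ → trans (update-other f₁ c (w∉ ∘ here)) (same (w∉ ∘ there))

unique-last : ∀ {A : Set} (xs : List A) {x} → Unique (xs ++ [ x ]) → x ∉ xs
unique-last (y ∷ xs) (y∉ ∷ _)    (here refl) = All.lookup y∉ (Mem.∈-++⁺ʳ xs (here refl)) refl
unique-last (y ∷ xs) (_ ∷ uniq)  (there x∈)  = unique-last xs uniq x∈

module Cone {k G} (good : Good (suc (suc k)) G) (h : V G) where
  open Good good

  Covers : V G → List (V G) → Set
  Covers x R = h ∉ x ∷ R × (∀ {v} → v ≢ h → v ∈ x ∷ R)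

  cover-↭ : ∀ {x R y R′} → (x ∷ R) ↭ (y ∷ R′) → Covers x R → Covers y R′
  cover-↭ perm (h∉ , cov) = h∉ ∘ Perm.∈-resp-↭ (↭-sym perm) , Perm.∈-resp-↭ perm ∘ cov

  many : ∀ {x R} → Covers x R → suc (suc k) ≤ suc (length R)
  many {x} {R} (h∉ , cov) = degree≥ x (h ∷ R) λ w xw → case w ≟ h of λ where
    (yes refl) → here refl
    (no w≢h)   → case cov w≢h of λ where
      (here refl) → contradiction refl (E⇒≢ G xw)
      (there w∈)  → there w∈

-- Cones of larger degree are complete

module Complete {k G} (good : Good (suc (suc (suc (suc k)))) G) (h : V G)
                (low : ∀ {v} → v ≢ h → deg G v ≤ suc (suc (suc (suc k)))) where
  open Good good
  open Cone good h

  K : ℕ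
  K = suc (suc (suc (suc k)))

  -- Brooks' colouring: x and z get the same colour, the other vertices are coloured
  -- from both ends of the path M₁ v M₂ towards v, and y comes last.
  two-coloured-neighbours : ∀ {y z M₁ v M₂ x} → Cycle G y (z ∷ (M₁ ++ v ∷ M₂) ++ [ x ]) →
                            Covers y (z ∷ (M₁ ++ v ∷ M₂) ++ [ x ]) → E G y v → E G x z
  two-coloured-neighbours {y} {z} {M₁} {v} {M₂} {x} (cycle (yz ∷ L) (y∉ ∷ (z∉ ∷ uniq))) (h∉ , cov) yv =
    decidable-stable (adj? G x z) contra
    where
    M U : List (V G)
    M = M₁ ++ v ∷ M₂
    U = M₁ ++ (v ∷ M₂) ++ [ y ]
    U≡ : U ≡ M ++ [ y ]
    U≡ = sym (List.++-assoc M₁ (v ∷ M₂) [ y ])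
    y-x : E G y x
    y-x = E-sym G (linked-last (z ∷ M) (subst (λ l → Linked (E G) (z ∷ l)) (List.++-assoc M [ x ] [ y ]) L))
    LM : Linked (E G) M
    LM = linked-prefix M (linked-prefix (M ++ [ x ]) (Linked.tail L))
    L₁ : Linked (E G) (M₁ ++ [ v ])
    L₁ = linked-prefix (M₁ ++ [ v ]) (subst (Linked (E G)) (sym (List.++-assoc M₁ [ v ] M₂)) LM)
    in-M : ∀ {a} → a ∈ M → a ∈ y ∷ z ∷ M ++ [ x ]
    in-M a∈ = there (there (Mem.∈-++⁺ˡ a∈))
    low′ : ∀ {a} → a ∈ y ∷ z ∷ M ++ [ x ] → deg G a ≤ K
    low′ a∈ = low λ where refl → h∉ a∈
    -- Only `h`, `z` and `x` are coloured at the outset, `z` and `x` alike because they are assumed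
    -- not adjacent.
    f₀ : V G → Fin K
    f₀ a = if does (a ≟ h) then zero else suc zero
    f₀≢h : ∀ {a} → a ≢ h → f₀ a ≡ suc zero
    f₀≢h {a} a≢h = cong (λ b → if b then zero else suc zero) (dec-false (a ≟ h) a≢h)
    ends : ∀ {a} → a ∉ U → a ≢ h → a ≡ z ⊎ a ≡ x
    ends {a} a∉ a≢h = case cov a≢h of λ where
      (here refl)        → contradiction (subst (y ∈_) (sym U≡) (Mem.∈-++⁺ʳ M (here refl))) a∉
      (there (here a≡z)) → inj₁ a≡z
      (there (there a∈)) → case Mem.∈-++⁻ M a∈ of λ where
        (inj₁ a∈M)        → contradiction (subst (a ∈_) (sym U≡) (Mem.∈-++⁺ˡ a∈M)) a∉
        (inj₂ (here a≡x)) → inj₂ a≡x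
    pf₀ : ¬ E G x z → ProperOn G (_∉ U) f₀
    pf₀ ¬xz a b a∉ b∉ ab eq with a ≟ h | b ≟ h
    ... | yes refl | yes refl = E⇒≢ G ab refl
    ... | yes refl | no _     = case eq of λ ()
    ... | no _     | yes refl = case eq of λ ()
    ... | no a≢h   | no b≢h with ends a∉ a≢h | ends b∉ b≢h
    ...   | inj₁ refl | inj₁ refl = E⇒≢ G ab refl
    ...   | inj₁ refl | inj₂ refl = ¬xz (E-sym G ab)
    ...   | inj₂ refl | inj₁ refl = ¬xz ab
    ...   | inj₂ refl | inj₂ refl = E⇒≢ G ab refl
    x∉M : x ∉ M
    x∉M x∈ = unique-last M uniq x∈
    z∉M : z ∉ M
    z∉M z∈ = All.lookup z∉ (Mem.∈-++⁺ˡ z∈) refl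
    x≢z : x ≢ z
    x≢z refl = All.lookup z∉ (Mem.∈-++⁺ʳ M (here refl)) refl
    contra : ¬ ¬ E G x z
    contra ¬xz =
      let f₁ , pf₁ , same₁ = paint-chain G {T = (v ∷ M₂) ++ [ y ]} M₁ f₀ L₁ (here refl)
                               (λ m∈ → low′ (in-M (Mem.∈-++⁺ˡ m∈))) (pf₀ ¬xz)
          f₂ , pf₂ , same₂ = paint-back G M₂ {v} {[ y ]} f₁ (linked-suffix M₁ LM) (here refl) (E-sym G yv)
                               (λ m∈ → low′ (in-M (Mem.∈-++⁺ʳ M₁ m∈))) pf₁
          same : ∀ {a} → a ∉ M → f₂ a ≡ f₀ a
          same = λ a∉ → trans (same₂ (a∉ ∘ Mem.∈-++⁺ʳ M₁)) (same₁ (a∉ ∘ Mem.∈-++⁺ˡ))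
          fx : f₂ x ≡ suc zero
          fx = trans (same x∉M) (f₀≢h {x} λ where refl → h∉ (there (there (Mem.∈-++⁺ʳ M (here refl)))))
          fz : f₂ z ≡ suc zero
          fz = trans (same z∉M) (f₀≢h {z} λ where refl → h∉ (there (here refl)))
          c , pf₃ = paint-twins G {Q = λ _ → ⊤} f₂ pf₂ (low′ (here refl))
                      (λ a _ a≢y → λ where (here a≡y) → a≢y a≡y) y-x yz x≢z (trans fx (sym fz))
      in uncolourable (_ , λ a b → pf₃ a b tt tt)

  chord : ∀ {y z M x} → Cycle G y (z ∷ M ++ [ x ]) → Covers y (z ∷ M ++ [ x ]) → E G x z
  chord {y} {z} {M} {x} C (h∉ , cov) with Fin.any? (λ v → (v ∈ˡ? M) ×-dec adj? G y v)
  ... | yes (v , v∈M , yv) with Mem.∈-∃++ v∈M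
  ...   | M₁ , M₂ , refl = two-coloured-neighbours {M₁ = M₁} {M₂ = M₂} C (h∉ , cov) yv
  chord {y} {z} {M} {x} C (h∉ , cov) | no none =
    -- Minimum degree four gives `y` a neighbour besides `h`, `z` and `x`; with three, as in a
    -- wheel, there need be none.
    contradiction (degree≥ y (h ∷ z ∷ x ∷ []) λ w yw → case w ≟ h of λ where
            (yes refl) → here refl
            (no w≢h)   → case cov w≢h of λ where
              (here refl)         → contradiction refl (E⇒≢ G yw)
              (there (here refl)) → there (here refl)
              (there (there w∈))  → case Mem.∈-++⁻ M w∈ of λ where
                (inj₁ w∈M)         → contradiction (w , w∈M , yw) none
                (inj₂ (here refl)) → there (there (here refl)))
            (ℕ.<⇒≱ (s≤s (s≤s (s≤s (s≤s z≤n)))))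

  -- The chord at `y` joins its cycle neighbours `x` and `z`, the chord at `z` joins `y` to the
  -- vertex after `z`. So `y` and `z` can be exchanged on the cycle; read from `y`, `z` has moved to
  -- the end.
  pass : ∀ {y z R} → Cycle G y (z ∷ R) → Covers y (z ∷ R) → Cycle G y (R ++ [ z ]) × Covers y (R ++ [ z ])
  pass {y} {z} {R} C cov with initLast R
  ... | [] = contradiction (many cov) (ℕ.<⇒≱ (s≤s (s≤s (s≤s z≤n))))
  ... | M ∷ʳ′ x = rotate swapped , cover-↭ (prep y (Perm.∷↭∷ʳ z (M ++ [ x ]))) cov
    where
    xz : E G x z
    xz = chord {M = M} C cov
    linked-front : ∀ R → Cycle G y (z ∷ R ++ [ x ]) → Covers y (z ∷ R ++ [ x ]) → Linked (E G) (y ∷ R ++ [ x ])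
    linked-front [] C cov = chord {M = []} (rotate C) (cover-↭ (Perm.∷↭∷ʳ y (z ∷ x ∷ [])) cov) ∷ [-]
    linked-front (m ∷ R) C@(cycle (_ ∷ _ ∷ L) _) cov =
      chord {M = R ++ [ x ]} (rotate C) (cover-↭ (Perm.∷↭∷ʳ y (z ∷ m ∷ R ++ [ x ])) cov) ∷
      linked-prefix (m ∷ R ++ [ x ]) L
    swapped : Cycle G z (y ∷ M ++ [ x ])
    swapped = swap-uniq C
      where
      swap-uniq : Cycle G y (z ∷ M ++ [ x ]) → Cycle G z (y ∷ M ++ [ x ])
      swap-uniq (cycle (yz ∷ _) ((y≢z ∷ y∉) ∷ (z∉ ∷ uniq))) =
        cycle (E-sym G yz ∷ linked-snoc (y ∷ M) (linked-front M C cov) xz) (((y≢z ∘ sym) ∷ z∉) ∷ (y∉ ∷ uniq))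

  pass-all : ∀ {y} R₁ R₂ → Cycle G y (R₁ ++ R₂) → Covers y (R₁ ++ R₂) → Cycle G y (R₂ ++ R₁)
  pass-all {y} [] R₂ C cov = subst (Cycle G y) (sym (List.++-identityʳ R₂)) C
  pass-all {y} (z ∷ R₁) R₂ C cov =
    let C′ , cov′ = pass C cov
        assoc = List.++-assoc R₁ R₂ [ z ]
    in subst (Cycle G y) (List.++-assoc R₂ [ z ] R₁)
         (pass-all R₁ (R₂ ++ [ z ]) (subst (Cycle G y) assoc C′) (subst (Covers y) assoc cov′))

  -- Once the vertices before `w` have been passed, `w` follows `y` on the cycle.
  adjacent : ∀ {y R w} → Cycle G y R → Covers y R → w ∈ R → E G y w
  adjacent C cov w∈ with Mem.∈-∃++ w∈
  ... | R₁ , R₂ , refl with pass-all R₁ (_ ∷ R₂) C cov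
  ...   | cycle (yw ∷ _) _ = yw

complete-iso : ∀ {G N} → n G ≡ N → (∀ u v → u ≢ v → E G u v) → IsComplete N G
complete-iso {G} n≡N all = record
  { to = cast n≡N ; from = cast (sym n≡N)
  ; from-to = Fin.cast-involutive (sym n≡N) n≡N ; to-from = Fin.cast-involutive n≡N (sym n≡N)
  ; adj-iff = λ u v → mk⇔
      (λ uv eq → E⇒≢ G uv (trans (sym (Fin.cast-involutive (sym n≡N) n≡N u))
        (trans (cong (cast (sym n≡N)) eq) (Fin.cast-involutive (sym n≡N) n≡N v))))
      (λ ≢ → all u v λ where refl → ≢ refl) }

cone⇒complete : ∀ {k G} → Good (suc (suc (suc (suc k)))) G → ConeCycle (suc (suc (suc (suc k)))) G →
                IsComplete (suc (suc (suc (suc (suc k))))) G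
cone⇒complete {k} {G} good cone = complete-iso (ℕ.≤-antisym small large) all
  where
  open Good good
  open ConeCycle cone
  K : ℕ
  K = suc (suc (suc (suc k)))
  open Complete good h low using (adjacent)
  all : ∀ u v → u ≢ v → E G u v
  all u v u≢v with u ≟ h | v ≟ h
  ... | yes refl | yes refl = contradiction refl u≢v
  ... | yes refl | no v≢h = spokes v≢h
  ... | no u≢h | yes refl = E-sym G (spokes u≢h)
  ... | no u≢h | no v≢h with rotate-to cyc (covers u≢h)
  ...   | R′ , C , perm with Perm.∈-resp-↭ (↭-sym perm) (covers v≢h)
  ...     | here refl = contradiction refl u≢v
  ...     | there v∈ = adjacent C (apex∉ ∘ Perm.∈-resp-↭ perm , Perm.∈-resp-↭ (↭-sym perm) ∘ covers) v∈
  small : n G ≤ suc K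
  small = subst (_≤ suc K) (List.length-tabulate {n = n G} id) (ℕ.≤-trans
    (unique⊆⇒≤length {ys = x ∷ nbrs G x} (Unique.allFin⁺ (n G)) λ {v} _ → case v ≟ x of λ where
      (yes refl) → here refl
      (no v≢x)   → there (∈-nbrs G (all x v (v≢x ∘ sym))))
    (s≤s (low λ where refl → apex∉ (here refl))))
  large : suc K ≤ n G
  large = ℕ.≰⇒> λ n≤K → uncolourable ((λ v → inject≤ v n≤K) , λ u v uv eq →
    E⇒≢ G uv (Fin.inject≤-injective n≤K n≤K u v eq))

-- Parity and cyclic order

opp : Fin 2 → Fin 2
opp zero       = suc zero
opp (suc zero) = zero

opp≢ : ∀ c → opp c ≢ c
opp≢ zero       ()
opp≢ (suc zero) ()

≢⇒opp : ∀ {c d} → c ≢ d → d ≡ opp c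
≢⇒opp {zero}     {zero}     c≢d = contradiction refl c≢d
≢⇒opp {zero}     {suc zero} _   = refl
≢⇒opp {suc zero} {zero}     _   = refl
≢⇒opp {suc zero} {suc zero} c≢d = contradiction refl c≢d

opp-involutive : ∀ c → opp (opp c) ≡ c
opp-involutive zero       = refl
opp-involutive (suc zero) = refl

parity : ℕ → Fin 2
parity zero    = zero
parity (suc m) = opp (parity m)

parity-double : ∀ m → parity (2 * m) ≡ zero
parity-double zero = refl
parity-double (suc m) rewrite ℕ.+-suc m (m + 0) = trans (opp-involutive _) (parity-double m)

odd-form : ∀ N → parity N ≡ suc zero → ∃[ m ] N ≡ suc (2 * m)
odd-form (suc zero) _ = 0 , refl
odd-form (suc (suc N)) eq with odd-form N (trans (sym (opp-involutive _)) eq)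
... | m , refl = suc m , cong (λ l → suc (suc l)) (sym (ℕ.+-suc m (m + 0)))

cycSucc : ∀ {N} (i : Fin N) → ∃[ j ] CycSucc N i j
cycSucc {suc N} i with suc (toℕ i) ℕ.<? suc N
... | yes lt = fromℕ< lt , inj₁ (sym (Fin.toℕ-fromℕ< lt))
... | no ¬lt = zero , inj₂ (ℕ.≤-antisym (Fin.toℕ<n i) (ℕ.≮⇒≥ ¬lt) , refl)

cycPred : ∀ {N} (j : Fin N) → ∃[ i ] CycSucc N i j
cycPred {suc N} zero    = fromℕ N , inj₂ (cong suc (Fin.toℕ-fromℕ N) , refl)
cycPred {suc N} (suc j) = inject₁ j , inj₁ (cong suc (Fin.toℕ-inject₁ j))

cycSucc-functional : ∀ {N} {i j j′ : Fin N} → CycSucc N i j → CycSucc N i j′ → j ≡ j′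
cycSucc-functional (inj₁ p) (inj₁ q) = Fin.toℕ-injective (trans (sym p) q)
cycSucc-functional {j = j} (inj₁ p) (inj₂ (q , _)) = contradiction (trans (sym p) q) (ℕ.<⇒≢ (Fin.toℕ<n j))
cycSucc-functional {j′ = j} (inj₂ (q , _)) (inj₁ p) = contradiction (trans (sym p) q) (ℕ.<⇒≢ (Fin.toℕ<n j))
cycSucc-functional (inj₂ (_ , p)) (inj₂ (_ , q)) = Fin.toℕ-injective (trans p (sym q))

cycSucc-injective : ∀ {N} {i i′ j : Fin N} → CycSucc N i j → CycSucc N i′ j → i ≡ i′
cycSucc-injective (inj₁ p) (inj₁ q) = Fin.toℕ-injective (ℕ.suc-injective (trans p (sym q)))
cycSucc-injective (inj₁ p) (inj₂ (_ , q)) = case trans p q of λ ()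
cycSucc-injective (inj₂ (_ , q)) (inj₁ p) = case trans p q of λ ()
cycSucc-injective (inj₂ (p , _)) (inj₂ (q , _)) = Fin.toℕ-injective (ℕ.suc-injective (trans p (sym q)))

cycSucc-irrefl : ∀ {N} {i : Fin (suc (suc N))} → ¬ CycSucc (suc (suc N)) i i
cycSucc-irrefl (inj₁ p) = ℕ.1+n≢n p
cycSucc-irrefl (inj₂ (p , q)) = case trans (sym p) (cong suc q) of λ ()

cycSucc-asym : ∀ {N} {i j : Fin (suc (suc (suc N)))} → CycSucc _ i j → ¬ CycSucc _ j i
cycSucc-asym (inj₁ p) (inj₁ q) = ℕ.m≢1+n+m _ {1} (trans (sym q) (cong suc (sym p)))
cycSucc-asym (inj₁ p) (inj₂ (q , r)) = case trans (sym q) (cong suc (trans (sym p) (cong suc r))) of λ ()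
cycSucc-asym (inj₂ (q , r)) (inj₁ p) = case trans (sym q) (cong suc (trans (sym p) (cong suc r))) of λ ()
cycSucc-asym (inj₂ (p , q)) (inj₂ (r , s)) = case trans (sym p) (cong suc s) of λ ()

-- Two colours alternate, so the last vertex, whose index `N` is even, repeats the colour of the
-- first.
odd-cycle-uncolourable : ∀ m (c : Fin (suc (suc (suc (2 * m)))) → Fin 2) → ¬ (∀ i j → CycSucc _ i j → c i ≢ c j)
odd-cycle-uncolourable m c proper = proper (fromℕ N) zero (inj₂ (cong suc (Fin.toℕ-fromℕ N) , refl))
  (trans (alternates N (fromℕ N) (Fin.toℕ-fromℕ N)) (cong shift even))
  where
  N : ℕ
  N = suc (suc (2 * m))
  shift : Fin 2 → Fin 2
  shift zero       = c zero
  shift (suc zero) = opp (c zero)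
  shift-opp : ∀ p → opp (shift p) ≡ shift (opp p)
  shift-opp zero       = refl
  shift-opp (suc zero) = opp-involutive _
  even : parity N ≡ zero
  even = trans (opp-involutive _) (parity-double m)
  alternates : ∀ l (i : Fin (suc N)) → toℕ i ≡ l → c i ≡ shift (parity l)
  alternates zero    zero    refl = refl
  alternates (suc l) (suc i) eq   = trans
    (≢⇒opp (proper (inject₁ i) (suc i) (inj₁ (cong suc (Fin.toℕ-inject₁ i)))))
    (trans (cong opp (alternates l (inject₁ i) (trans (Fin.toℕ-inject₁ i) (ℕ.suc-injective eq)))) (shift-opp (parity l)))

linked-lookup : ∀ {A : Set} {R : A → A → Set} {xs} → Linked R xs → ∀ i j → suc (toℕ i) ≡ toℕ j → R (lookup xs i) (lookup xs j)
linked-lookup (r ∷ _) zero    (suc zero) refl = r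
linked-lookup (_ ∷ L) (suc i) (suc j)    eq   = linked-lookup L i j (ℕ.suc-injective eq)

linked-lookup-last : ∀ {A : Set} {R : A → A → Set} xs {z} → Linked R (xs ++ [ z ]) → ∀ i → suc (toℕ i) ≡ length xs → R (lookup xs i) z
linked-lookup-last (x ∷ [])     (r ∷ _) zero    refl = r
linked-lookup-last (x ∷ y ∷ xs) (_ ∷ L) (suc i) eq   = linked-lookup-last (y ∷ xs) L i (ℕ.suc-injective eq)

cycle-lookup : ∀ {G x R} → Cycle G x R → ∀ i j → CycSucc (suc (length R)) i j → E G (lookup (x ∷ R) i) (lookup (x ∷ R) j)
cycle-lookup {R = R} (cycle L _) i j    (inj₁ eq)        = linked-lookup (linked-prefix (_ ∷ R) L) i j eq
cycle-lookup {R = R} (cycle L _) i zero (inj₂ (eq , _)) = linked-lookup-last (_ ∷ R) L i eq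

-- Cones of rim degree three are odd wheels

wheel-colour : ∀ {N} → (Fin N → Fin 2) → Fin (suc N) → Fin 3
wheel-colour c zero    = suc (suc zero)
wheel-colour c (suc i) = inject₁ (c i)

2≢inject₁ : ∀ {c : Fin 2} → suc (suc zero) ≢ inject₁ c
2≢inject₁ {zero}     ()
2≢inject₁ {suc zero} ()

even-cycle-colouring : ∀ {N} → parity N ≡ zero → ∀ (i j : Fin N) → CycAdj N i j → parity (toℕ i) ≢ parity (toℕ j)
even-cycle-colouring {N} even i j adj = [ succ i j , (λ s eq → succ j i s (sym eq)) ]′ adj
  where
  succ : ∀ (i j : Fin N) → CycSucc N i j → parity (toℕ i) ≢ parity (toℕ j)
  succ i j (inj₁ p)       eq = opp≢ _ (trans (cong parity p) (sym eq))
  succ i j (inj₂ (p , q)) eq = opp≢ (parity (toℕ i)) (trans (trans (cong parity p) even) (trans (sym (cong parity q)) (sym eq)))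

cone⇒wheel : ∀ {G} → Good 3 G → ConeCycle 3 G → IsOddWheel G
cone⇒wheel {G} good cone = finish (odd-form N odd)
  where
  open Good good
  open ConeCycle cone
  L : List (V G)
  L = x ∷ R
  N : ℕ
  N = suc (length R)
  N≥3 : 2 ≤ length R
  N≥3 = s≤s⁻¹ (Cone.many good h (apex∉ , covers))
  from : Fin (suc N) → V G
  from zero    = h
  from (suc i) = lookup L i
  to-dec : ∀ v → Dec (v ≡ h) → Fin (suc N)
  to-dec v (yes _)  = zero
  to-dec v (no v≢h) = suc (index (covers v≢h))
  to : V G → Fin (suc N)
  to v = to-dec v (v ≟ h)
  from-to : ∀ v → from (to v) ≡ v
  from-to v = go (v ≟ h)
    where
    go : (d : Dec (v ≡ h)) → from (to-dec v d) ≡ v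
    go (yes refl) = refl
    go (no v≢h)   = sym (Any.lookup-index (covers v≢h))
  rim≢h : ∀ i → lookup L i ≢ h
  rim≢h i eq = apex∉ (subst (_∈ L) eq (Mem.∈-lookup i))
  L-inj : ∀ i j → lookup L i ≡ lookup L j → i ≡ j
  L-inj = lookup-injective (Cycle.uniq cyc)
  from-inj : ∀ a b → from a ≡ from b → a ≡ b
  from-inj zero    zero    _  = refl
  from-inj zero    (suc j) eq = contradiction (sym eq) (rim≢h j)
  from-inj (suc i) zero    eq = contradiction eq (rim≢h i)
  from-inj (suc i) (suc j) eq = cong suc (L-inj i j eq)
  rim-edge : ∀ i j → CycAdj N i j → E G (lookup L i) (lookup L j)
  rim-edge i j (inj₁ s) = cycle-lookup cyc i j s
  rim-edge i j (inj₂ s) = E-sym G (cycle-lookup cyc j i s)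
  3≤N : ∃[ l ] N ≡ suc (suc (suc l))
  3≤N = go (length R) N≥3
    where
    go : ∀ m → 2 ≤ m → ∃[ l ] suc m ≡ suc (suc (suc l))
    go (suc (suc m)) _ = m , refl
    go (suc zero) (s≤s ())
  asym : ∀ {i j : Fin N} → CycSucc N i j → ¬ CycSucc N j i
  asym = go N (proj₂ 3≤N)
    where
    go : ∀ N {l} → N ≡ suc (suc (suc l)) → ∀ {i j : Fin N} → CycSucc N i j → ¬ CycSucc N j i
    go .(suc (suc (suc _))) refl = cycSucc-asym
  -- A rim vertex already has three neighbours: the apex and its neighbours on the rim.
  rim-only : ∀ i j → E G (lookup L i) (lookup L j) → CycAdj N i j
  rim-only i j e with cycSucc i | cycPred i
  ... | s , is | p , pi with j ≟ s | j ≟ p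
  ...   | yes refl | _ = inj₁ is
  ...   | no _ | yes refl = inj₂ pi
  ...   | no j≢s | no j≢p = contradiction
          (ℕ.≤-trans (unique⊆⇒≤length distinct all-nbrs) (low (rim≢h i))) (ℕ.<⇒≱ ℕ.≤-refl)
    where
    distinct : Unique (h ∷ lookup L j ∷ lookup L s ∷ lookup L p ∷ [])
    distinct = ((rim≢h j ∘ sym) ∷ (rim≢h s ∘ sym) ∷ (rim≢h p ∘ sym) ∷ [])
             ∷ (((j≢s ∘ L-inj j s) ∷ (j≢p ∘ L-inj j p) ∷ [])
             ∷ ((((λ where refl → asym is pi) ∘ L-inj s p) ∷ []) ∷ ([] ∷ [])))
    all-nbrs : ∀ {a} → a ∈ h ∷ lookup L j ∷ lookup L s ∷ lookup L p ∷ [] → a ∈ nbrs G (lookup L i)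
    all-nbrs (here refl)                         = ∈-nbrs G (E-sym G (spokes (rim≢h i)))
    all-nbrs (there (here refl))                 = ∈-nbrs G e
    all-nbrs (there (there (here refl)))         = ∈-nbrs G (cycle-lookup cyc i s is)
    all-nbrs (there (there (there (here refl)))) = ∈-nbrs G (E-sym G (cycle-lookup cyc p i pi))
  iff : ∀ a b → E G (from a) (from b) ⇔ WheelAdj N a b
  iff zero    zero    = mk⇔ (λ e → E⇒≢ G e refl) λ ()
  iff zero    (suc j) = mk⇔ (λ _ → tt) (λ _ → spokes (rim≢h j))
  iff (suc i) zero    = mk⇔ (λ _ → tt) (λ _ → E-sym G (spokes (rim≢h i)))
  iff (suc i) (suc j) = mk⇔ (rim-only i j) (rim-edge i j)
  iso : IsoTo G (suc N) (WheelAdj N)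
  iso = record
    { to = to ; from = from ; from-to = from-to
    ; to-from = λ a → from-inj (to (from a)) a (from-to (from a))
    ; adj-iff = λ u v → subst₂ (λ u′ v′ → E G u′ v′ ⇔ WheelAdj N (to u) (to v)) (from-to u) (from-to v) (iff (to u) (to v)) }
  -- On an even rim two colours would alternate and the apex take the third.
  odd : parity N ≡ suc zero
  odd = ≢⇒opp λ even → uncolourable
    ( wheel-colour (parity ∘ toℕ) ∘ to
    , λ u v uv → proper (sym even) (to u) (to v) (Equivalence.to (IsoTo.adj-iff iso u v) uv) )
    where
    proper : parity N ≡ zero → ∀ a b → WheelAdj N a b → wheel-colour {N} (parity ∘ toℕ) a ≢ wheel-colour (parity ∘ toℕ) b
    proper _    zero    (suc j) _  eq = 2≢inject₁ eq
    proper _    (suc i) zero    _  eq = 2≢inject₁ (sym eq)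
    proper even (suc i) (suc j) ij eq = even-cycle-colouring even i j ij (Fin.inject₁-injective eq)
  finish : ∃[ m ] N ≡ suc (2 * m) → IsOddWheel G
  finish (zero , eq) = case trans (sym eq) (proj₂ 3≤N) of λ ()
  finish (suc m , eq) = m , subst (λ N → IsoTo G (suc N) (WheelAdj N))
    (trans eq (cong suc (cong suc (ℕ.+-suc m (m + 0))))) iso

-- Odd cycles

SPath-linked : ∀ G {R : V G → V G → Set} {t v l} → (∀ {a b} → R a b → E G a b) → SPath R t v l → ∀ {z} → E G t z →
               ∃[ l′ ] l ≡ v ∷ l′ × Linked (E G) (l ++ [ z ]) × Unique l
SPath-linked G R⊆E stop tz = [] , refl , tz ∷ [-] , [] ∷ []
SPath-linked G R⊆E (step r p a∉) tz with SPath-linked G R⊆E p tz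
... | l′ , refl , L , uniq = _ , refl , R⊆E r ∷ L , All.tabulate (λ { d∈ refl → a∉ d∈ }) ∷ uniq

SPath-length : ∀ {m R} {t v : Fin m} {l} → SPath R t v l → v ≢ t → 2 ≤ length l
SPath-length stop                    v≢t = contradiction refl v≢t
SPath-length (step _ stop _)         _   = s≤s (s≤s z≤n)
SPath-length (step _ (step _ _ _) _) _   = s≤s (s≤s z≤n)

SPath-parity : ∀ {m} {R : Fin m → Fin m → Set} {t v l} (f : Fin m → Fin 2) → (∀ {a b} → R a b → f a ≢ f b) →
               SPath R t v l → (f v ≡ f t → parity (length l) ≡ suc zero) × (f v ≢ f t → parity (length l) ≡ zero)
SPath-parity f proper stop = (λ _ → refl) , λ ≢ → contradiction refl ≢
SPath-parity {t = t} f proper (step {a} {b} r p _) with f b ≟ f t | SPath-parity f proper p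
... | yes eq | odd , _  = (λ eq′ → contradiction (trans eq′ (sym eq)) (proper r)) , λ _ → cong opp (odd eq)
... | no ≢   | _ , even = (λ _ → cong opp (even ≢)) ,
        λ ≢′ → contradiction (trans (≢⇒opp (≢′ ∘ sym)) (sym (≢⇒opp (≢ ∘ sym)))) (proper r)

cycSucc? : ∀ N i j → Dec (CycSucc N i j)
cycSucc? N i j = (suc (toℕ i) ℕ.≟ toℕ j) ⊎-dec ((suc (toℕ i) ℕ.≟ N) ×-dec (toℕ j ℕ.≟ 0))

nonempty : ∀ {k G} → Good k G → V G
nonempty {G = G} good = case Fin.any? (λ (_ : V G) → yes tt) of λ where
  (yes (v , _)) → v
  (no empty)    → contradiction ((λ v → contradiction (v , tt) empty) , λ v → contradiction (v , tt) empty)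
                    (Good.uncolourable good)

module OddCycle {G} {m : ℕ} (good : Good 2 G) {x R} (C : Cycle G x R) (len : length R ≡ 2 + 2 * m) where
  open Good good

  L : List (V G)
  L = x ∷ R
  N : ℕ
  N = suc (length R)

  uncolourable-rim : ∀ N → N ≡ suc (suc (suc (2 * m))) → (c : Fin N → Fin 2) → ¬ (∀ i j → CycSucc N i j → c i ≢ c j)
  uncolourable-rim _ refl = odd-cycle-uncolourable m

  -- The odd cycle alone is not 2-colourable, so every edge whose deletion permits two colours lies
  -- on it.
  on-rim : ∀ {a b} → E G a b → ∃[ i ] ∃[ j ] CycSucc N i j × SameEdge (lookup L i) (lookup L j) a b
  on-rim {a} {b} ab with Fin.any? (λ i → Fin.any? λ j → cycSucc? N i j ×-dec sameEdge? (lookup L i) (lookup L j) a b)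
  ... | yes found = found
  ... | no none with edge-critical a b ab
  ...   | f , proper = contradiction
          (λ i j s → proper _ _ (cycle-lookup C i j s) (λ same → none (i , j , s , same)))
          (uncolourable-rim N (cong suc len) (f ∘ lookup L))

  covers : ∀ v → v ∈ L
  covers v with on-rim (proj₂ (no-isolated v))
  ... | i , j , _ , inj₁ (refl , _) = Mem.∈-lookup i
  ... | i , j , _ , inj₂ (_ , refl) = Mem.∈-lookup j

  L-inj : ∀ i j → lookup L i ≡ lookup L j → i ≡ j
  L-inj = lookup-injective (Cycle.uniq C)

  rim-only : ∀ i j → E G (lookup L i) (lookup L j) → CycAdj N i j
  rim-only i j e with on-rim e
  ... | i′ , j′ , s , inj₁ (p , q) = inj₁ (subst₂ (CycSucc N) (L-inj i′ i p) (L-inj j′ j q) s)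
  ... | i′ , j′ , s , inj₂ (p , q) = inj₂ (subst₂ (CycSucc N) (L-inj i′ j p) (L-inj j′ i q) s)

  iso : IsoTo G N (CycAdj N)
  iso = record
    { to = λ v → index (covers v) ; from = lookup L ; from-to = from-to
    ; to-from = λ i → L-inj _ i (from-to (lookup L i))
    ; adj-iff = λ u v → mk⇔
        (λ uv → rim-only _ _ (subst₂ (E G) (sym (from-to u)) (sym (from-to v)) uv))
        (λ adj → subst₂ (E G) (from-to u) (from-to v) (case adj of λ where
          (inj₁ s) → cycle-lookup C _ _ s
          (inj₂ s) → E-sym G (cycle-lookup C _ _ s))) }
    where
    from-to : ∀ v → lookup L (index (covers v)) ≡ v
    from-to v = sym (Any.lookup-index (covers v))

  isOddCycle : IsOddCycle G
  isOddCycle = m , subst (λ N → IsoTo G N (CycAdj N)) (cong suc len) iso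

-- Without the edge `uv` both its ends get one colour, so a path between them has an odd number of
-- vertices and `uv` closes it to an odd cycle.
good⇒oddCycle : ∀ {G} → Good 2 G → IsOddCycle G
good⇒oddCycle {G} good = connect (Reach.S D u) refl
  where
  open Good good
  u v : V G
  u = nonempty good
  v = proj₁ (no-isolated u)
  uv : E G u v
  uv = proj₂ (no-isolated u)
  f : V G → Fin 2
  f = proj₁ (edge-critical u v uv)
  proper : ∀ a b → E G a b → ¬ SameEdge a b u v → f a ≢ f b
  proper = proj₂ (edge-critical u v uv)
  completes : ∀ (g : V G → Fin 2) → (∀ a b → E G a b → ¬ SameEdge a b u v → g a ≢ g b) → g u ≡ g v
  completes = colouring-forced {G = G} uncolourable
  R : V G → V G → Set
  R a b = E G a b × ¬ SameEdge a b u v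
  D : Reach R v
  D = reach (λ a b → adj? G a b ×-dec ¬? (sameEdge? a b u v)) v
  open Reach D
  connect : ∀ b → S u ≡ b → IsOddCycle G
  connect true Su with l , p , _ ← path Su with SPath-linked G proj₁ p (E-sym G uv)
  ... | l′ , refl , L , uniq = build p (odd-form (length (u ∷ l′)) (proj₁ (SPath-parity f (λ (e , ¬s) → proper _ _ e ¬s) p) (completes f proper)))
    where
    build : SPath R v u (u ∷ l′) → ∃[ m ] suc (length l′) ≡ suc (2 * m) → IsOddCycle G
    build p (zero , eq) = contradiction (SPath-length p (E⇒≢ G uv)) (ℕ.<⇒≱ (s≤s (ℕ.≤-reflexive eq)))
    build _ (suc m , eq) = OddCycle.isOddCycle {m = m} good (cycle L uniq)
      (trans (ℕ.suc-injective eq) (cong suc (ℕ.+-suc m (m + 0))))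
  -- If no such path existed, exchanging the colours on the component of `v` alone would break the
  -- forced equality at `u` and `v`.
  connect false Su = contradiction (trans (sym g-u) (trans (completes g pg) g-v))
      (λ eq → opp≢ (f v) (trans (sym eq) (completes f proper)))
    where
    g : V G → Fin 2
    g a = if S a then opp (f a) else f a
    g-u : g u ≡ f u
    g-u = cong (λ b → if b then opp (f u) else f u) Su
    g-v : g v ≡ opp (f v)
    g-v = cong (λ b → if b then opp (f v) else f v) t∈S
    pg : ∀ a b → E G a b → ¬ SameEdge a b u v → g a ≢ g b
    pg a b ab ¬same eq with S a in Sa | S b in Sb
    ... | true  | true  = proper a b ab ¬same (trans (sym (opp-involutive _)) (trans (cong opp eq) (opp-involutive _)))
    ... | false | false = proper a b ab ¬same eq
    ... | false | true  = true≢false (closed (ab , ¬same) Sb) Sa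
    ... | true  | false = true≢false (closed (E-sym G ab , ¬same ∘ sameEdge-swap) Sa) Sb

-- Complete graphs, cycles and wheels

LowIn : ℕ → ∀ {N} → (Fin N → Fin N → Set) → Fin N → Set
LowIn k {N} R i = Σ (List (Fin N)) λ L → length L ≤ k × (∀ j → R i j → j ∈ L)

-- Two vertices are separated by the edges at whichever has at most `k` neighbours; this allows one
-- vertex of larger degree, such as the hub of a wheel.
iso-good : ∀ {k G N R} → IsoTo G N R →
           (∀ (c : Fin N → Fin k) → ¬ (∀ i j → R i j → c i ≢ c j)) →
           (∀ i j → R i j → Σ (Fin N → Fin k) λ c → ∀ a b → R a b → ¬ SameEdge a b i j → c a ≢ c b) →
           (∀ i → ∃[ j ] R i j) →
           (∀ i j → i ≢ j → LowIn k R i ⊎ LowIn k R j) → Good k G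
iso-good {k} {G} {N} {R} iso uncol crit nbr low = record
  { uncolourable = λ (f , proper) → uncol (f ∘ from) λ i j r → proper (from i) (from j) (edge r)
  ; edge-critical = λ u v uv → let c , proper = crit (to u) (to v) (Equivalence.to (adj-iff u v) uv) in
      c ∘ to , λ a b ab ¬same → proper (to a) (to b) (Equivalence.to (adj-iff a b) ab) λ where
        (inj₁ (p , q)) → ¬same (inj₁ (to-inj p , to-inj q))
        (inj₂ (p , q)) → ¬same (inj₂ (to-inj p , to-inj q))
  ; no-isolated = λ u → let j , r = nbr (to u) in from j , subst (λ a → E G a (from j)) (from-to u) (edge r)
  ; cut = λ u v u≢v → case low (to u) (to v) (u≢v ∘ to-inj) of λ where
      (inj₁ l) → (λ a → does (a ≟ u)) , dec-true (u ≟ u) refl , dec-false (v ≟ u) (u≢v ∘ sym) , cutAt u l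
      (inj₂ l) → (λ a → not (does (a ≟ v))) , cong not (dec-false (u ≟ v) u≢v) , cong not (dec-true (v ≟ v) refl) ,
                 cutAtMost-not G (λ a → does (a ≟ v)) (cutAt v l) }
  where
  open IsoTo iso
  to-inj : ∀ {a b} → to a ≡ to b → a ≡ b
  to-inj {a} {b} eq = trans (sym (from-to a)) (trans (cong from eq) (from-to b))
  edge : ∀ {i j} → R i j → E G (from i) (from j)
  edge {i} {j} r = Equivalence.from (adj-iff (from i) (from j)) (subst₂ R (sym (to-from i)) (sym (to-from j)) r)
  cutAt : ∀ u → LowIn k R (to u) → CutAtMost G (λ a → does (a ≟ u)) k
  cutAt u (L , L≤ , cov) = map (λ j → u , from j) L , length-map≤ (λ j → u , from j) L L≤ ,
    λ a b (Xa , _ , ab) → case dec-does (a ≟ u) Xa of λ where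
      refl → subst (λ b′ → (u , b′) ∈ map (λ j → u , from j) L) (from-to b)
               (Mem.∈-map⁺ (λ j → u , from j) (cov (to b) (Equivalence.to (adj-iff u b) ab)))

complete⇒good : ∀ {k G} → IsComplete (suc (suc k)) G → Good (suc k) G
complete⇒good {k} {G} iso = iso-good iso
  (λ c proper → let i , j , i<j , eq = Fin.pigeonhole (ℕ.n<1+n (suc k)) c in proper i j (Fin.<⇒≢ i<j) eq)
  crit
  (λ i → punchIn i zero , Fin.punchInᵢ≢i i zero ∘ sym)
  (λ i _ _ → inj₁ ( map (punchIn i) (allFin (suc k))
                  , ℕ.≤-reflexive (trans (List.length-map (punchIn i) (allFin (suc k))) (List.length-tabulate {n = suc k} id))
                  , λ j i≢j → subst (_∈ map (punchIn i) (allFin (suc k))) (Fin.punchIn-punchOut i≢j)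
                                (Mem.∈-map⁺ (punchIn i) (Mem.∈-allFin (punchOut i≢j))) ))
  where
  crit : ∀ (i j : Fin (suc (suc k))) → i ≢ j → Σ (Fin (suc (suc k)) → Fin (suc k)) λ c →
         ∀ a b → a ≢ b → ¬ SameEdge a b i j → c a ≢ c b
  -- The vertices other than `j` get different colours, and `j` shares that of `i`.
  crit i j i≢j = (λ a → colour a (a ≟ j)) , λ a b → proper a b (a ≟ j) (b ≟ j)
    where
    colour : ∀ a → Dec (a ≡ j) → Fin (suc k)
    colour a (yes _)  = punchOut (i≢j ∘ sym)
    colour a (no a≢j) = punchOut (a≢j ∘ sym)
    proper : ∀ a b (a? : Dec (a ≡ j)) (b? : Dec (b ≡ j)) → a ≢ b → ¬ SameEdge a b i j → colour a a? ≢ colour b b?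
    proper a b (yes refl) (yes refl) a≢b _ _ = a≢b refl
    proper a b (yes refl) (no b≢j) _ ¬same eq =
      ¬same (inj₂ (refl , sym (Fin.punchOut-injective (i≢j ∘ sym) (b≢j ∘ sym) eq)))
    proper a b (no a≢j) (yes refl) _ ¬same eq =
      ¬same (inj₁ (Fin.punchOut-injective (a≢j ∘ sym) (i≢j ∘ sym) eq , refl))
    proper a b (no a≢j) (no b≢j) a≢b _ eq = a≢b (Fin.punchOut-injective (a≢j ∘ sym) (b≢j ∘ sym) eq)

module BrokenCycle (m : ℕ) where
  N : ℕ
  N = suc (suc (suc (2 * m)))

  -- Alternating colours with a shift of phase after i: only the edge leaving i fails.
  colour : Fin N → Fin N → Fin 2
  colour i j = parity (toℕ j + bit (does (toℕ i ℕ.<? toℕ j)))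

  odd-N : parity N ≡ suc zero
  odd-N = trans (opp-involutive (opp (parity (2 * m)))) (cong opp (parity-double m))

  after : ∀ {i j} → toℕ i < toℕ j → colour i j ≡ opp (parity (toℕ j))
  after {i} {j} i<j = trans (cong (λ b → parity (toℕ j + bit b)) (dec-true (toℕ i ℕ.<? toℕ j) i<j))
                            (cong parity (ℕ.+-comm (toℕ j) 1))

  before : ∀ {i j} → ¬ (toℕ i < toℕ j) → colour i j ≡ parity (toℕ j)
  before {i} {j} i≮j = trans (cong (λ b → parity (toℕ j + bit b)) (dec-false (toℕ i ℕ.<? toℕ j) i≮j))
                             (cong parity (ℕ.+-identityʳ (toℕ j)))

  proper : ∀ i a b → CycSucc N a b → a ≢ i → colour i a ≢ colour i b
  proper i a b ab a≢i = go ab (toℕ i ℕ.<? toℕ a) (toℕ i ℕ.<? toℕ b)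
    where
    go : CycSucc N a b → Dec (toℕ i < toℕ a) → Dec (toℕ i < toℕ b) → colour i a ≢ colour i b
    go (inj₁ p) (yes i<a) (yes i<b) eq =
      opp≢ _ (trans (cong opp (cong parity p)) (trans (sym (after i<b)) (trans (sym eq) (after i<a))))
    go (inj₁ p) (no i≮a) (no i≮b) eq =
      opp≢ _ (trans (cong parity p) (trans (sym (before i≮b)) (trans (sym eq) (before i≮a))))
    go (inj₁ p) (yes i<a) (no i≮b) _ = i≮b (ℕ.<-trans i<a (ℕ.≤-reflexive p))
    go (inj₁ p) (no i≮a) (yes i<b) _ =
      a≢i (Fin.toℕ-injective (ℕ.≤-antisym (ℕ.≮⇒≥ i≮a) (s≤s⁻¹ (subst (toℕ i <_) (sym p) i<b))))
    go (inj₂ (p , q)) _ (yes i<b) _ = case subst (toℕ i <_) q i<b of λ ()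
    go (inj₂ (p , q)) (no i≮a) (no _) _ =
      a≢i (Fin.toℕ-injective (ℕ.≤-antisym (ℕ.≮⇒≥ i≮a) (s≤s⁻¹ (subst (toℕ i <_) (sym p) (Fin.toℕ<n i)))))
    go (inj₂ (p , q)) (yes i<a) (no i≮b) eq =
      case trans (sym (trans (cong parity p) odd-N)) (trans (sym (after i<a)) (trans eq (trans (before i≮b) (cong parity q)))) of λ ()

  missed : ∀ {i j a b : Fin N} → CycSucc N i j → CycSucc N a b → ¬ SameEdge a b i j → a ≢ i
  missed ij ab ¬same refl = ¬same (inj₁ (refl , cycSucc-functional ab ij))

  crit : ∀ i j → CycAdj N i j → Σ (Fin N → Fin 2) λ c → ∀ a b → CycAdj N a b → ¬ SameEdge a b i j → c a ≢ c b
  crit i j (inj₁ ij) = colour i , λ where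
    a b (inj₁ ab) ¬same → proper i a b ab (missed ij ab ¬same)
    a b (inj₂ ba) ¬same → proper i b a ba (missed ij ba (¬same ∘ sameEdge-swap)) ∘ sym
  crit i j (inj₂ ji) = map₂ (λ pr a b ab ¬same → pr a b ab (¬same ∘ Sum.swap)) (crit j i (inj₁ ji))

  neighbours : ∀ i → LowIn 2 (CycAdj N) i
  neighbours i with cycSucc i | cycPred i
  ... | s , is | p , pi = s ∷ p ∷ [] , s≤s (s≤s z≤n) , λ where
    j (inj₁ ij) → here (cycSucc-functional ij is)
    j (inj₂ ji) → there (here (cycSucc-injective ji pi))

  wheel-crit : ∀ i j → WheelAdj N i j → Σ (Fin (suc N) → Fin 3) λ c →
               ∀ a b → WheelAdj N a b → ¬ SameEdge a b i j → c a ≢ c b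
  wheel-crit zero (suc i) _ = c , λ where
      zero    (suc a) _ ¬same eq → spoke a (λ where refl → ¬same (inj₁ (refl , refl))) eq
      (suc a) zero    _ ¬same eq → spoke a (λ where refl → ¬same (inj₂ (refl , refl))) (sym eq)
      (suc a) (suc b) (inj₁ ab) _ → rim ab
      (suc a) (suc b) (inj₂ ba) _ → rim ba ∘ sym
    where
    -- The rim vertex `i` takes the colour of the hub. The phase breaks after `i`, so the one bad
    -- rim edge starts at a recoloured vertex.
    c : Fin (suc N) → Fin 3
    c = wheel-colour (colour i) [ suc i ↦ suc (suc zero) ]
    c-i : c (suc i) ≡ suc (suc zero)
    c-i = update-same (wheel-colour (colour i)) (suc i) (suc (suc zero))
    c-other : ∀ {a} → a ≢ i → c (suc a) ≡ inject₁ (colour i a)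
    c-other a≢i = update-other (wheel-colour (colour i)) (suc (suc zero)) (a≢i ∘ Fin.suc-injective)
    spoke : ∀ a → a ≢ i → suc (suc zero) ≢ c (suc a)
    spoke a a≢i eq = 2≢inject₁ (trans eq (c-other a≢i))
    rim : ∀ {a b} → CycSucc N a b → c (suc a) ≢ c (suc b)
    rim {a} {b} ab eq = go (a ≟ i) (b ≟ i)
      where
      go : Dec (a ≡ i) → Dec (b ≡ i) → ⊥
      go (yes refl) (yes refl) = cycSucc-irrefl ab
      go (yes refl) (no b≢i)   = spoke b b≢i (trans (sym c-i) eq)
      go (no a≢i)   (yes refl) = spoke a a≢i (trans (sym c-i) (sym eq))
      go (no a≢i)   (no b≢i)   = proper i a b ab a≢i
        (Fin.inject₁-injective (trans (sym (c-other a≢i)) (trans eq (c-other b≢i))))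
  wheel-crit (suc i) zero _ = map₂ (λ pr a b ab ¬same → pr a b ab (¬same ∘ Sum.swap)) (wheel-crit zero (suc i) tt)
  wheel-crit (suc i) (suc j) ij with crit i j ij
  ... | c , pr = wheel-colour c , λ where
    zero    (suc b) _  _     → 2≢inject₁
    (suc a) zero    _  _     → 2≢inject₁ ∘ sym
    (suc a) (suc b) ab ¬same → pr a b ab (λ where
      (inj₁ (refl , refl)) → ¬same (inj₁ (refl , refl))
      (inj₂ (refl , refl)) → ¬same (inj₂ (refl , refl))) ∘ Fin.inject₁-injective

  wheel-uncolourable : ∀ (c : Fin (suc N) → Fin 3) → ¬ (∀ i j → WheelAdj N i j → c i ≢ c j)
  wheel-uncolourable c pr = odd-cycle-uncolourable m (λ i → punchOut (pr zero (suc i) tt)) λ i j s eq →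
    pr (suc i) (suc j) (inj₁ s) (Fin.punchOut-injective (pr zero (suc i) tt) (pr zero (suc j) tt) eq)

  wheel-neighbours : ∀ i → LowIn 3 (WheelAdj N) (suc i)
  wheel-neighbours i with neighbours i
  ... | L , L≤ , cov = zero ∷ map suc L , s≤s (length-map≤ suc L L≤) , λ where
    zero    _  → here refl
    (suc j) ij → there (Mem.∈-map⁺ suc (cov j ij))

oddCycle⇒good : ∀ {G} → IsOddCycle G → Good 2 G
oddCycle⇒good (m , iso) = iso-good iso
  (λ c pr → odd-cycle-uncolourable m c (λ i j s → pr i j (inj₁ s)))
  crit (λ i → map₂ inj₁ (cycSucc i)) (λ i _ _ → inj₁ (neighbours i))
  where open BrokenCycle m

oddWheel⇒good : ∀ {G} → IsOddWheel G → Good 3 G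
oddWheel⇒good (m , iso) = iso-good iso wheel-uncolourable wheel-crit nbr low
  where
  open BrokenCycle m
  nbr : ∀ i → ∃[ j ] WheelAdj N i j
  nbr zero    = suc zero , tt
  nbr (suc i) = zero , tt
  low : ∀ i j → i ≢ j → LowIn 3 (WheelAdj N) i ⊎ LowIn 3 (WheelAdj N) j
  low (suc i) _       _   = inj₁ (wheel-neighbours i)
  low zero    (suc j) _   = inj₂ (wheel-neighbours j)
  low zero    zero    0≢0 = contradiction refl 0≢0

-- Hajós joins

hajos-sym : ∀ {G₁ G₂ H} → HajosJoin G₁ G₂ H → HajosJoin G₂ G₁ H
hajos-sym J = record
  { v₁ = v₂ ; w₁ = w₂ ; e₁ = e₂ ; v₂ = v₁ ; w₂ = w₁ ; e₂ = e₁ ; ι₁ = ι₂ ; ι₂ = ι₁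
  ; inj₁ = J.inj₂ ; inj₂ = J.inj₁ ; glue = sym glue ; meet = λ x y eq → swap (meet y x (sym eq))
  ; cover = Sum.swap ∘ cover
  ; adj-iff = λ a b → mk⇔
      (λ e → case Equivalence.to (adj-iff a b) e of λ where
        (inj₁ via₁)        → inj₂ (inj₁ via₁)
        (inj₂ (inj₁ via₂)) → inj₁ via₂
        (inj₂ (inj₂ same)) → inj₂ (inj₂ (Sum.swap same)))
      (λ e → Equivalence.from (adj-iff a b) (case e of λ where
        (inj₁ via₂)        → inj₂ (inj₁ via₂)
        (inj₂ (inj₁ via₁)) → inj₁ via₁
        (inj₂ (inj₂ same)) → inj₂ (inj₂ (Sum.swap same)))) }
  where
  module J = HajosJoin J
  open J hiding (inj₁; inj₂)

module Join {G₁ G₂ H} (J : HajosJoin G₁ G₂ H) where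
  module J = HajosJoin J
  open J hiding (inj₁; inj₂)

  combine : ∀ {A : Set} (f₁ : V G₁ → A) (f₂ : V G₂ → A) → f₁ v₁ ≡ f₂ v₂ →
            Σ (V H → A) λ F → (∀ x → F (ι₁ x) ≡ f₁ x) × (∀ y → F (ι₂ y) ≡ f₂ y)
  combine {A} f₁ f₂ eq = (λ z → F (cover z)) , (λ x → on₁ x (cover (ι₁ x))) , λ y → on₂ y (cover (ι₂ y))
    where
    F : ∀ {z} → (∃[ x ] ι₁ x ≡ z) ⊎ (∃[ y ] ι₂ y ≡ z) → A
    F (inj₁ (x , _)) = f₁ x
    F (inj₂ (y , _)) = f₂ y
    on₁ : ∀ x (c : (∃[ x′ ] ι₁ x′ ≡ ι₁ x) ⊎ (∃[ y ] ι₂ y ≡ ι₁ x)) → F c ≡ f₁ x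
    on₁ x (inj₁ (x′ , p)) = cong f₁ (J.inj₁ x′ x p)
    on₁ x (inj₂ (y , p)) with meet x y (sym p)
    ... | refl , refl = sym eq
    on₂ : ∀ y (c : (∃[ x ] ι₁ x ≡ ι₂ y) ⊎ (∃[ y′ ] ι₂ y′ ≡ ι₂ y)) → F c ≡ f₂ y
    on₂ y (inj₂ (y′ , p)) = cong f₂ (J.inj₂ y′ y p)
    on₂ y (inj₁ (x , p)) with meet x y p
    ... | refl , refl = eq

  split : ∀ {a b} → E H a b → EdgeVia G₁ H ι₁ v₁ w₁ a b ⊎ EdgeVia G₂ H ι₂ v₂ w₂ a b ⊎ SameEdge a b (ι₁ w₁) (ι₂ w₂)
  split {a} {b} = Equivalence.to (adj-iff a b)

  edge₁ : ∀ {x y} → E G₁ x y → ¬ SameEdge x y v₁ w₁ → E H (ι₁ x) (ι₁ y)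
  edge₁ {x} {y} e ¬same = Equivalence.from (adj-iff _ _) (inj₁ (x , y , refl , refl , e , ¬same))

  edge₂ : ∀ {x y} → E G₂ x y → ¬ SameEdge x y v₂ w₂ → E H (ι₂ x) (ι₂ y)
  edge₂ {x} {y} e ¬same = Equivalence.from (adj-iff _ _) (inj₂ (inj₁ (x , y , refl , refl , e , ¬same)))

  edge-w : E H (ι₁ w₁) (ι₂ w₂)
  edge-w = Equivalence.from (adj-iff _ _) (inj₂ (inj₂ (inj₁ (refl , refl))))

  -- Colourings of both sides, aligned at the common vertex; only w₁w₂ may fail.
  assemble : ∀ {k} (f₁ : V G₁ → Fin k) (f₂ : V G₂ → Fin k) → Σ (V H → Fin k) λ F →
             (∀ x y → f₁ x ≢ f₁ y → F (ι₁ x) ≢ F (ι₁ y)) × (∀ x y → f₂ x ≢ f₂ y → F (ι₂ x) ≢ F (ι₂ y)) ×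
             (f₂ v₂ ≡ f₂ w₂ → f₁ v₁ ≢ f₁ w₁ → F (ι₁ w₁) ≢ F (ι₂ w₂))
  assemble f₁ f₂ with combine f₁ (transpose (f₂ v₂) (f₁ v₁) ∘ f₂) (sym (transpose-fst (f₂ v₂) (f₁ v₁)))
  ... | F , F₁ , F₂ = F ,
    (λ x y ≢ eq → ≢ (trans (sym (F₁ x)) (trans eq (F₁ y)))) ,
    (λ x y ≢ eq → ≢ (transpose-injective (f₂ v₂) (f₁ v₁) (trans (sym (F₂ x)) (trans eq (F₂ y))))) ,
    λ v₂≡w₂ ≢ eq → ≢ (trans (sym (transpose-fst (f₂ v₂) (f₁ v₁))) (trans (cong (transpose (f₂ v₂) (f₁ v₁)) v₂≡w₂)
      (trans (sym (F₂ w₂)) (trans (sym eq) (F₁ w₁)))))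

  -- Without its deleted edge each side still forces equal colours on `v` and `w`, so `w₁` and `w₂`
  -- would both have the colour of the common vertex.
  uncolourable-join : ∀ {k} → ¬ Colorable G₁ k → ¬ Colorable G₂ k → ¬ Colorable H k
  uncolourable-join ¬col₁ ¬col₂ (f , proper) = proper _ _ edge-w (trans
    (sym (colouring-forced {G = G₁} {v₁} {w₁} ¬col₁ (f ∘ ι₁) λ a b ab ¬same → proper (ι₁ a) (ι₁ b) (edge₁ ab ¬same)))
    (trans (cong f glue) (colouring-forced {G = G₂} {v₂} {w₂} ¬col₂ (f ∘ ι₂) λ a b ab ¬same → proper (ι₂ a) (ι₂ b) (edge₂ ab ¬same))))

  -- A colouring of `G₁` without `xy` separates `v₁` from `w₁`, while one of `G₂` without `v₂w₂`
  -- gives `w₂` the colour of `v₂`; so `w₁w₂` is properly coloured.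
  critical-via₁ : ∀ {k} → Good k G₁ → Good k G₂ → ∀ {u v} → EdgeVia G₁ H ι₁ v₁ w₁ u v →
                  Σ (V H → Fin k) λ f → ∀ a b → E H a b → ¬ SameEdge a b u v → f a ≢ f b
  critical-via₁ good₁ good₂ (x , y , refl , refl , xy , ¬vw)
    with f₁ , pf₁ ← Good.edge-critical good₁ x y xy
    with f₂ , pf₂ ← Good.edge-critical good₂ v₂ w₂ e₂
    with F , F₁ , F₂ , Fw ← assemble f₁ f₂ = F , λ a b ab ¬same → case split ab of λ where
      (inj₁ (x′ , y′ , refl , refl , e , _)) → F₁ x′ y′ (pf₁ x′ y′ e λ where
        (inj₁ (refl , refl)) → ¬same (inj₁ (refl , refl))
        (inj₂ (refl , refl)) → ¬same (inj₂ (refl , refl)))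
      (inj₂ (inj₁ (x′ , y′ , refl , refl , e , ¬same₂))) → F₂ x′ y′ (pf₂ x′ y′ e ¬same₂)
      (inj₂ (inj₂ (inj₁ (refl , refl)))) → Fw (colouring-forced {G = G₂} {v₂} {w₂} (Good.uncolourable good₂) f₂ pf₂) (v₁≢w₁ pf₁)
      (inj₂ (inj₂ (inj₂ (refl , refl)))) → Fw (colouring-forced {G = G₂} {v₂} {w₂} (Good.uncolourable good₂) f₂ pf₂) (v₁≢w₁ pf₁) ∘ sym
    where
    v₁≢w₁ : ∀ {k} {f₁ : V G₁ → Fin k} → (∀ a b → E G₁ a b → ¬ SameEdge a b x y → f₁ a ≢ f₁ b) → f₁ v₁ ≢ f₁ w₁
    v₁≢w₁ pf₁ = pf₁ v₁ w₁ e₁ λ where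
      (inj₁ (refl , refl)) → ¬vw (inj₁ (refl , refl))
      (inj₂ (refl , refl)) → ¬vw (inj₂ (refl , refl))

  critical-w : ∀ {k} → Good k G₁ → Good k G₂ → ∀ {u v} → SameEdge u v (ι₁ w₁) (ι₂ w₂) →
               Σ (V H → Fin k) λ f → ∀ a b → E H a b → ¬ SameEdge a b u v → f a ≢ f b
  critical-w good₁ good₂ {u} {v} same
    with f₁ , pf₁ ← Good.edge-critical good₁ v₁ w₁ e₁
    with f₂ , pf₂ ← Good.edge-critical good₂ v₂ w₂ e₂
    with F , F₁ , F₂ , _ ← assemble f₁ f₂ = F , λ a b ab ¬same → case split ab of λ where
      (inj₁ (x′ , y′ , refl , refl , e , ¬same₁)) → F₁ x′ y′ (pf₁ x′ y′ e ¬same₁)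
      (inj₂ (inj₁ (x′ , y′ , refl , refl , e , ¬same₂))) → F₂ x′ y′ (pf₂ x′ y′ e ¬same₂)
      (inj₂ (inj₂ same′)) → contradiction (sameEdge-common same′ same) ¬same

  neighbour₁ : ∀ {k} → Good (suc (suc k)) G₁ → ∀ x → ∃[ b ] E H (ι₁ x) b
  neighbour₁ good₁ x with x ≟ w₁
  ... | yes refl = _ , edge-w
  ... | no x≢w with Fin.any? (λ y → adj? G₁ x y ×-dec ¬? (y ≟ w₁))
  ...   | yes (y , xy , y≢w) = ι₁ y , edge₁ xy λ where
            (inj₁ (_ , y≡w)) → y≢w y≡w
            (inj₂ (x≡w , _)) → x≢w x≡w
  ...   | no none = contradiction (Good.degree≥ good₁ x [ w₁ ] λ y xy →
            here (decidable-stable (y ≟ w₁) λ y≢w → none (y , xy , y≢w))) (ℕ.<⇒≱ (s≤s (s≤s z≤n)))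

  Separates : ℕ → V H → V H → Set
  Separates k a b = ∃[ X ] X a ≡ true × X b ≡ false × CutAtMost H X k

  -- The second side follows v₁; the edge w₁w₂ of the join replaces v₁w₁ in the cut.
  extend-cut : ∀ {k} (X₁ : V G₁ → Bool) → CutAtMost G₁ X₁ k →
               Σ (V H → Bool) λ X → (∀ x → X (ι₁ x) ≡ X₁ x) × (∀ y → X (ι₂ y) ≡ X₁ v₁) × CutAtMost H X k
  extend-cut {k} X₁ (L , L≤ , cov) with combine X₁ (λ _ → X₁ v₁) refl
  ... | X , on₁ , on₂ = X , on₁ , on₂ , map e L , length-map≤ e L L≤ , cov′
    where
    e-dec : ∀ p → Dec (p ≡ (v₁ , w₁)) → Dec (p ≡ (w₁ , v₁)) → V H × V H
    e-dec p       (yes _) _       = ι₂ w₂ , ι₁ w₁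
    e-dec p       (no _)  (yes _) = ι₁ w₁ , ι₂ w₂
    e-dec (x , y) (no _)  (no _)  = ι₁ x , ι₁ y
    e : V G₁ × V G₁ → V H × V H
    e p = e-dec p (p ≟² (v₁ , w₁)) (p ≟² (w₁ , v₁))
    e-old : ∀ x y → ¬ SameEdge x y v₁ w₁ → e (x , y) ≡ (ι₁ x , ι₁ y)
    e-old x y ¬same = go ((x , y) ≟² (v₁ , w₁)) ((x , y) ≟² (w₁ , v₁))
      where
      go : ∀ d d′ → e-dec (x , y) d d′ ≡ (ι₁ x , ι₁ y)
      go (yes refl) _          = contradiction (inj₁ (refl , refl)) ¬same
      go (no _)     (yes refl) = contradiction (inj₂ (refl , refl)) ¬same
      go (no _)     (no _)     = refl
    e-vw : e (v₁ , w₁) ≡ (ι₂ w₂ , ι₁ w₁)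
    e-vw = go ((v₁ , w₁) ≟² (v₁ , w₁)) ((v₁ , w₁) ≟² (w₁ , v₁))
      where
      go : ∀ d d′ → e-dec (v₁ , w₁) d d′ ≡ (ι₂ w₂ , ι₁ w₁)
      go (yes _) _ = refl
      go (no ≢)  _ = contradiction refl ≢
    e-wv : e (w₁ , v₁) ≡ (ι₁ w₁ , ι₂ w₂)
    e-wv = go ((w₁ , v₁) ≟² (v₁ , w₁)) ((w₁ , v₁) ≟² (w₁ , v₁))
      where
      go : ∀ d d′ → e-dec (w₁ , v₁) d d′ ≡ (ι₁ w₁ , ι₂ w₂)
      go (yes eq) _       = contradiction (sym (cong proj₁ eq)) (E⇒≢ G₁ e₁)
      go (no _)   (yes _) = refl
      go (no _)   (no ≢)  = contradiction refl ≢
    cov′ : ∀ a b → Cross H X a b → (a , b) ∈ map e L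
    cov′ a b (Xa , Xb , ab) with split ab
    ... | inj₁ (x , y , refl , refl , xy , ¬same) = subst (_∈ map e L) (e-old x y ¬same)
            (Mem.∈-map⁺ e (cov x y (trans (sym (on₁ x)) Xa , trans (sym (on₁ y)) Xb , xy)))
    ... | inj₂ (inj₁ (x , y , refl , refl , _)) = true≢false (trans (sym (on₂ x)) Xa) (trans (sym (on₂ y)) Xb)
    ... | inj₂ (inj₂ (inj₁ (refl , refl))) = subst (_∈ map e L) e-wv
            (Mem.∈-map⁺ e (cov w₁ v₁ (trans (sym (on₁ w₁)) Xa , trans (sym (on₂ w₂)) Xb , E-sym G₁ e₁)))
    ... | inj₂ (inj₂ (inj₂ (refl , refl))) = subst (_∈ map e L) e-vw
            (Mem.∈-map⁺ e (cov v₁ w₁ (trans (sym (on₂ w₂)) Xa , trans (sym (on₁ w₁)) Xb , e₁)))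

  cut₁₁ : ∀ {k} → Good k G₁ → ∀ x y → x ≢ y → Separates k (ι₁ x) (ι₁ y)
  cut₁₁ good₁ x y x≢y =
    let X₁ , Xx , Xy , c = Good.cut good₁ x y x≢y
        X , on₁ , _ , c′ = extend-cut X₁ c
    in X , trans (on₁ x) Xx , trans (on₁ y) Xy , c′

  -- The whole second side follows `v₁`, so it suffices to separate `x` from `v₁` in `G₁`.
  cut₁₂ : ∀ {k} → Good k G₁ → ∀ x y → x ≢ v₁ → Separates k (ι₁ x) (ι₂ y)
  cut₁₂ good₁ x y x≢v =
    let X₁ , Xx , Xv , c = Good.cut good₁ x v₁ x≢v
        X , on₁ , on₂ , c′ = extend-cut X₁ c
    in X , trans (on₁ x) Xx , trans (on₂ y) Xv , c′

join-good : ∀ {k G₁ G₂ H} → HajosJoin G₁ G₂ H → Good (suc (suc k)) G₁ → Good (suc (suc k)) G₂ → Good (suc (suc k)) H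
join-good {k} {G₁} {G₂} {H} J good₁ good₂ = record
  { uncolourable = A.uncolourable-join (Good.uncolourable good₁) (Good.uncolourable good₂)
  ; edge-critical = λ u v uv → case A.split uv of λ where
      (inj₁ via₁)        → A.critical-via₁ good₁ good₂ via₁
      (inj₂ (inj₁ via₂)) → B.critical-via₁ good₂ good₁ via₂
      (inj₂ (inj₂ same)) → A.critical-w good₁ good₂ same
  ; no-isolated = λ u → case cover u of λ where
      (inj₁ (x , refl)) → A.neighbour₁ good₁ x
      (inj₂ (y , refl)) → B.neighbour₁ good₂ y
  ; cut = λ a b a≢b → cut a b a≢b (cover a) (cover b) }
  where
  module A = Join J
  module B = Join (hajos-sym J)
  open HajosJoin J using (ι₁; ι₂; v₁; v₂; glue; cover)
  cut : ∀ a b → a ≢ b → (∃[ x ] ι₁ x ≡ a) ⊎ (∃[ y ] ι₂ y ≡ a) → (∃[ x ] ι₁ x ≡ b) ⊎ (∃[ y ] ι₂ y ≡ b) →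
        A.Separates (suc (suc k)) a b
  cut _ _ a≢b (inj₁ (x , refl)) (inj₁ (y , refl)) = A.cut₁₁ good₁ x y λ where refl → a≢b refl
  cut _ _ a≢b (inj₂ (x , refl)) (inj₂ (y , refl)) = B.cut₁₁ good₂ x y λ where refl → a≢b refl
  cut _ _ a≢b (inj₁ (x , refl)) (inj₂ (y , refl)) with x ≟ v₁
  ... | no x≢v   = A.cut₁₂ good₁ x y x≢v
  -- The common vertex is read as a vertex of the second side.
  ... | yes refl = subst (λ a → A.Separates _ a (ι₂ y)) (sym glue) (B.cut₁₁ good₂ v₂ y λ where refl → a≢b glue)
  cut _ _ a≢b (inj₂ (y , refl)) (inj₁ (x , refl)) with y ≟ v₂
  ... | no y≢v   = B.cut₁₂ good₂ y x y≢v
  ... | yes refl = subst (λ a → A.Separates _ a (ι₁ x)) glue (A.cut₁₁ good₁ v₁ x λ where refl → a≢b (sym glue))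

closure⇒good : ∀ {k B} → (∀ {G} → B G → Good (suc (suc k)) G) → ∀ {G} → HajosClosure B G → Good (suc (suc k)) G
closure⇒good B-good (base b)     = B-good b
closure⇒good B-good (join c d J) = join-good J (closure⇒good B-good c) (closure⇒good B-good d)

good⇒closure : ∀ {k B} → (∀ {G} → Good (suc (suc (suc k))) G → ConeCycle (suc (suc (suc k))) G → B G) →
               ∀ {G} → Good (suc (suc (suc k))) G → HajosClosure B G
good⇒closure {k} {B} cone⇒B {G} = go G (<-wellFounded (n G))
  where
  go : ∀ G → Acc _<_ (n G) → Good (suc (suc (suc k))) G → HajosClosure B G
  go G (acc rec) good with structure good
  ... | inj₂ cone = base (cone⇒B good cone)
  ... | inj₁ sep = join (go _ (rec (P.smaller)) P.good-piece) (go _ (rec Q.smaller) Q.good-piece) (bridge⇒join good sep)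
    where
    module P = BridgePiece good sep
    module Q = BridgePiece good (flip-bridge sep)

-- The two smallest cases

-- A colouring with one colour tolerates no edge, so the deleted edge is the only one; as no vertex
-- is isolated, its ends are all vertices.
good⇒K₂ : ∀ {G} → Good 1 G → IsComplete 2 G
good⇒K₂ {G} good = complete-iso (ℕ.≤-antisym small large) all
  where
  open Good good
  u v : V G
  u = nonempty good
  v = proj₁ (no-isolated u)
  uv : E G u v
  uv = proj₂ (no-isolated u)
  only : ∀ {a b} → E G a b → SameEdge a b u v
  only {a} {b} ab = decidable-stable (sameEdge? a b u v) λ ¬same →
    let f , proper = edge-critical u v uv in proper a b ab ¬same (Fin1 (f a) (f b))
    where
    Fin1 : ∀ (i j : Fin 1) → i ≡ j
    Fin1 zero zero = refl
  end : ∀ a → a ≡ u ⊎ a ≡ v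
  end a = Sum.map proj₁ proj₁ (only (proj₂ (no-isolated a)))
  all : ∀ a b → a ≢ b → E G a b
  all a b a≢b with end a | end b
  ... | inj₁ refl | inj₁ eq   = contradiction (sym eq) a≢b
  ... | inj₁ refl | inj₂ refl = uv
  ... | inj₂ refl | inj₁ refl = E-sym G uv
  ... | inj₂ refl | inj₂ eq   = contradiction (sym eq) a≢b
  small : n G ≤ 2
  small = subst (_≤ 2) (List.length-tabulate {n = n G} id)
    (unique⊆⇒≤length {ys = u ∷ v ∷ []} (Unique.allFin⁺ (n G)) λ {a} _ → case end a of λ where
      (inj₁ a≡u) → here a≡u
      (inj₂ a≡v) → there (here a≡v))
  large : 2 ≤ n G
  large = subst (2 ≤_) (List.length-tabulate {n = n G} id)
    (unique⊆⇒≤length {xs = u ∷ v ∷ []} ((E⇒≢ G uv ∷ []) ∷ ([] ∷ [])) (λ {a} _ → Mem.∈-allFin a))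

-- If there were two vertices, deleting one would leave a nonempty graph coloured with no colours.
𝒞₀⇒K₁ : ∀ {G} → 𝒞 0 G → IsComplete 1 G
𝒞₀⇒K₁ {G} (crit , χ@((f , proper) , minimal) , _) = case Fin.any? (λ (_ : V G) → yes tt) of λ where
    (no empty) → contradiction
      (minimal 0 ((λ v → contradiction (v , tt) empty) , λ v → contradiction (v , tt) empty)) λ ()
    (yes (u , _)) → complete-iso (ℕ.≤-antisym (small u) (large u)) (λ a b a≢b → contradiction (single a b) a≢b)
  where
  single : ∀ a b → a ≡ b
  single a b = decidable-stable (a ≟ b) λ a≢b →
    let g , _ = critical⇒colorable crit χ (deleteVertex-proper G b)
        i , _ = Restrict.ι-onto (λ c → not (does (c ≟ b))) {a} (cong not (dec-false (a ≟ b) a≢b))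
    in case g i of λ ()
  small : V G → n G ≤ 1
  small u = subst (_≤ 1) (List.length-tabulate {n = n G} id)
    (unique⊆⇒≤length {ys = u ∷ []} (Unique.allFin⁺ (n G)) λ {a} _ → here (single a u))
  large : V G → 1 ≤ n G
  large u = ℕ.≤-trans (s≤s z≤n) (Fin.toℕ<n u)

K₁⇒𝒞₀ : ∀ {G} → IsComplete 1 G → 𝒞 0 G
K₁⇒𝒞₀ {G} iso = critical , (((λ _ → zero) , λ u v uv → contradiction (single u v) (E⇒≢ G uv)) , minimal) ,
    λ u v u≢v → contradiction (single u v) u≢v
  where
  open IsoTo iso
  single : ∀ u v → u ≡ v
  single u v with to u in eu | to v in ev
  ... | zero | zero = trans (sym (from-to u)) (trans (cong from (trans eu (sym ev))) (from-to v))
  minimal : ∀ c → Colorable G c → 1 ≤ c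
  minimal c (f , _) = ℕ.≤-trans (s≤s z≤n) (Fin.toℕ<n (f (from zero)))
  critical : Critical G
  critical H sub a b (_ , H-min) (G-col , _) = ℕ.<-≤-trans (s≤s (H-min 0 (empty , λ i → contradiction i (¬vertex)))) (minimal b G-col)
    where
    open ProperSubgraphOf sub using (proper)
    ¬vertex : ¬ V H
    ¬vertex i = proper ((λ z → i , single _ z) , λ j l e → contradiction (single _ _) (E⇒≢ G e))
    empty : V H → Fin 0
    empty i = contradiction i ¬vertex

theorem9 : ∀ (k : ℕ) (G : Graph) → 𝒞 k G ⇔ ℋ k G
theorem9 0 G = mk⇔ 𝒞₀⇒K₁ K₁⇒𝒞₀
theorem9 1 G = mk⇔ (good⇒K₂ ∘ 𝒞⇒good) (good⇒𝒞 ∘ complete⇒good)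
theorem9 2 G = mk⇔ (good⇒oddCycle ∘ 𝒞⇒good) (good⇒𝒞 ∘ oddCycle⇒good)
theorem9 3 G = mk⇔ (good⇒closure cone⇒wheel ∘ 𝒞⇒good) (good⇒𝒞 ∘ closure⇒good oddWheel⇒good)
theorem9 (suc (suc (suc (suc k)))) G =
  mk⇔ (good⇒closure cone⇒complete ∘ 𝒞⇒good) (good⇒𝒞 ∘ closure⇒good complete⇒good)
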